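{- There is a deterministic algorithm which, given a real number $d>1$ and an undirected weighted graph $G=(V,E,w)$ with $n$ vertices and $m$ edges, computes in time $O(dn^3m)$ a weighted subgraph $H=(V,F,\tilde w)$ of $G$, $F\subseteq E$, with at most $\lceil d(n-1)\rceil$ edges, such that $$x^T L_G x \;\le\; x^T L_H x \;\le\; \left(\frac{d+1+2\sqrt d}{d+1-2\sqrt d}\right) x^T L_G x\qquad\text{for all } x\in\mathbb{R}^V .$$
   Context: A weighted undirected graph $G=(V,E,w)$ is a finite simple graph with edge weights $w_e>0$ for $e\in E$. Its Laplacian $L_G$ is the symmetric $V\times V$ matrix with quadratic form $x^T L_G x=\sum_{(u,v)\in E} w_{u,v}(x_u-x_v)^2$. A weighted subgraph $H=(V,F,\tilde w)$ of $G$ has the same vertex set, an edge set $F\subseteq E$, and positive edge weights $\tilde w$, which need not agree with the weights $w$ of $G$; $L_H$ is its Laplacian. Running time is measured as the number of exact operations on real numbers (arithmetic operations, square roots and comparisons), each of unit cost; the constant in $O(\cdot)$ is absolute. It is assumed that $m\ge 1$. -}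

module Defs where

open import Algebra.Bundles using (CommutativeRing)
open import Algebra.Structures using (IsCommutativeRing)
import Algebra.Properties.Semiring.Mult as Mult
import Algebra.Properties.Semiring.Sum as Sum
import Algebra.Properties.Ring as RingProperties
import Algebra.Solver.CommutativeMonoid as MonoidSolver
open import Data.Bool.Base using (Bool; true; false; if_then_else_)
open import Data.Fin.Base as Fin using (Fin; toℕ)
open import Data.Fin.Properties as Fin using ()
open import Data.List.Base using (List; []; _∷_; map; foldr; length)
open import Data.List.Membership.Propositional using (_∈_)
open import Data.List.Relation.Binary.Subset.Propositional using (_⊆_)
open import Data.List.Relation.Unary.All using (All; []; _∷_; lookup)
open import Data.List.Relation.Unary.Unique.Propositional using (Unique)
open import Data.Nat.Base as ℕ using (ℕ; zero; suc)
open import Data.Nat.Properties as ℕ using ()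
open import Data.Product.Base using (Σ; Σ-syntax; ∃; _×_; _,_; proj₁; proj₂)
open import Data.Sum.Base using (inj₁; inj₂)
open import Level using (0ℓ)
open import Relation.Binary.Core using (Rel)
import Relation.Binary.Construct.NonStrictToStrict as ToStrict
open import Relation.Binary.PropositionalEquality
open import Relation.Binary.Structures using (IsDecTotalOrder)
open import Relation.Nullary using (does; yes; no)
open import Relation.Nullary.Negation using (contradiction)

------------------------------------------------------------------------
-- The real numbers
--
-- Classically, a model of this record is exactly the Dedekind-complete
-- ordered field ℝ, with its (unit cost) operations.  `_⁻¹` and `√_` are
-- total, with unspecified values at 0 and at negative numbers.
-- `archimedean` follows from `complete` in classical logic; it is listed
-- because the bound has to be available as a natural number.

record Reals : Set₁ where
  infix  9 _⁻¹ √_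
  infix  8 -_
  infixl 7 _*_
  infixl 6 _+_
  infix  4 _≤_
  field
    Carrier           : Set
    _≤_               : Rel Carrier 0ℓ
    _+_ _*_           : Carrier → Carrier → Carrier
    -_ _⁻¹ √_         : Carrier → Carrier
    0# 1#             : Carrier
    isCommutativeRing : IsCommutativeRing _≡_ _+_ _*_ -_ 0# 1#
    isDecTotalOrder   : IsDecTotalOrder _≡_ _≤_
    0≢1               : 0# ≢ 1#
    *-inverseʳ        : ∀ x → x ≢ 0# → x * x ⁻¹ ≡ 1#
    +-monoˡ-≤         : ∀ z {x y} → x ≤ y → x + z ≤ y + z
    *-nonneg          : ∀ {x y} → 0# ≤ x → 0# ≤ y → 0# ≤ x * y
    √-nonneg          : ∀ {x} → 0# ≤ x → 0# ≤ √ x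
    √-square          : ∀ {x} → 0# ≤ x → √ x * √ x ≡ x

  commutativeRing : CommutativeRing 0ℓ 0ℓ
  commutativeRing = record { isCommutativeRing = isCommutativeRing }

  open Mult (CommutativeRing.semiring commutativeRing) using () renaming (_×_ to _·_)

  fromℕ : ℕ → Carrier
  fromℕ k = k · 1#

  UpperBound : (Carrier → Set) → Carrier → Set
  UpperBound P b = ∀ {x} → P x → x ≤ b

  field
    archimedean : ∀ x → Σ[ k ∈ ℕ ] x ≤ fromℕ k
    complete    : (P : Carrier → Set) → ∃ P → ∃ (UpperBound P) →
                  Σ[ s ∈ Carrier ] UpperBound P s × (∀ b → UpperBound P b → s ≤ b)

  open CommutativeRing commutativeRing public
    using (_-_; +-assoc; +-comm; +-identityˡ; +-identityʳ; -‿inverseˡ; -‿inverseʳ;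
           *-assoc; *-comm; *-identityˡ; *-identityʳ; distribˡ; distribʳ; zeroˡ; zeroʳ;
           ring; semiring; commutativeSemiring)
  open IsDecTotalOrder isDecTotalOrder public
    using (_≟_; _≤?_; total; antisym; module Eq)
    renaming (refl to ≤-refl; trans to ≤-trans; reflexive to ≤-reflexive)
  open ToStrict _≡_ _≤_ public using (_<_)
  open Sum semiring public using (sum; sum-syntax)

  infixl 7 _/_
  _/_ : Carrier → Carrier → Carrier
  x / y = x * y ⁻¹

  private
    climb : Carrier → ℕ → ℕ → ℕ
    climb x zero    k = k
    climb x (suc f) k = if does (x ≤? fromℕ k) then k else climb x f (suc k)

  -- The least natural number ≥ x, so the usual ceiling when x ≥ 0
  -- (and 0 when x < 0).
  ⌈_⌉ : Carrier → ℕ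
  ⌈ x ⌉ = climb x (proj₁ (archimedean x)) 0

  ≤⌈⌉ : ∀ x → x ≤ fromℕ ⌈ x ⌉
  ≤⌈⌉ x = go b 0 (subst (λ j → x ≤ fromℕ j) (sym (ℕ.+-identityʳ b)) (proj₂ (archimedean x)))
    where
    b = proj₁ (archimedean x)
    go : ∀ f k → x ≤ fromℕ (f ℕ.+ k) → x ≤ fromℕ (climb x f k)
    go zero    k h = h
    go (suc f) k h with x ≤? fromℕ k
    ... | yes p = p
    ... | no  _ = go f (suc k) (subst (λ j → x ≤ fromℕ j) (sym (ℕ.+-suc f k)) h)

  ⌈⌉-least : ∀ x k → x ≤ fromℕ k → ⌈ x ⌉ ℕ.≤ k
  ⌈⌉-least x k h = go (proj₁ (archimedean x)) 0 ℕ.z≤n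
    where
    go : ∀ f j → j ℕ.≤ k → climb x f j ℕ.≤ k
    go zero    j j≤k = j≤k
    go (suc f) j j≤k with x ≤? fromℕ j
    ... | yes _ = j≤k
    ... | no  ¬p with ℕ.m≤n⇒m<n∨m≡n j≤k
    ...   | inj₁ j<k  = go f (suc j) j<k
    ...   | inj₂ refl = contradiction h ¬p

------------------------------------------------------------------------
-- Weighted graphs on the vertex set Fin n and their Laplacians

module Graphs (ℝ : Reals) where

  open Reals ℝ

  -- An undirected edge {u , v} is represented by the pair (u , v), u < v.
  record WeightedGraph (n : ℕ) : Set where
    field
      wedges   : List ((Fin n × Fin n) × Carrier)
    edges : List (Fin n × Fin n)
    edges = map proj₁ wedges
    field
      ordered  : All (λ (u , v) → u Fin.< v) edges
      simple   : Unique edges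
      positive : All (λ (_ , w) → 0# < w) wedges

  open WeightedGraph public

  #edges : ∀ {n} → WeightedGraph n → ℕ
  #edges G = length (edges G)

  -- The weights of a subgraph need not agree with those of the graph.
  IsSubgraph : ∀ {n} → WeightedGraph n → WeightedGraph n → Set
  IsSubgraph H G = edges H ⊆ edges G

  Matrix : ℕ → Set
  Matrix n = Fin n → Fin n → Carrier

  quadForm : ∀ {n} → Matrix n → (Fin n → Carrier) → Carrier
  quadForm {n} M x = ∑[ i < n ] ∑[ j < n ] (x i * M i j * x j)

  indicator : ∀ {n} → Fin n → Fin n → Carrier
  indicator u i = if does (u Fin.≟ i) then 1# else 0#

  ∑ᴱ : ∀ {n} → List ((Fin n × Fin n) × Carrier) →
       (Fin n → Fin n → Carrier → Carrier) → Carrier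
  ∑ᴱ es f = foldr (λ ((u , v) , w) s → f u v w + s) 0# es

  -- Σ over (u,v) ∈ E of w (1ᵤ - 1ᵥ)(1ᵤ - 1ᵥ)ᵀ
  laplacian : ∀ {n} → WeightedGraph n → Matrix n
  laplacian G i j = ∑ᴱ (wedges G) λ u v w →
    w * ((indicator u i - indicator v i) * (indicator u j - indicator v j))

  energy : ∀ {n} → WeightedGraph n → (Fin n → Carrier) → Carrier
  energy G x = ∑ᴱ (wedges G) λ u v w → w * ((x u - x v) * (x u - x v))

  -- `laplacian G` is the symmetric matrix whose quadratic form is `energy G`.
  laplacian-sym : ∀ {n} (G : WeightedGraph n) i j → laplacian G i j ≡ laplacian G j i
  laplacian-sym {n} G i j = go (wedges G)
    where
    b : Fin n → Fin n → Fin n → Carrier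
    b u v k = indicator u k - indicator v k
    go : ∀ es → ∑ᴱ es (λ u v w → w * (b u v i * b u v j))
              ≡ ∑ᴱ es (λ u v w → w * (b u v j * b u v i))
    go []                   = refl
    go (((u , v) , w) ∷ es) = cong₂ _+_ (cong (w *_) (*-comm _ _)) (go es)

  laplacian-form : ∀ {n} (G : WeightedGraph n) x → quadForm (laplacian G) x ≡ energy G x
  laplacian-form {n} G x = go (wedges G)
    where
    open ≡-Reasoning
    open Sum semiring hiding (sum; sum-syntax)
    open RingProperties ring using ([y-z]x≈yx-zx; -‿+-comm; -0#≈0#)
    open MonoidSolver (CommutativeRing.*-commutativeMonoid commutativeRing) using (solve; _⊕_; _⊜_)

    b : Fin n → Fin n → Fin n → Carrier
    b u v k = indicator u k - indicator v k

    rank1 : Fin n → Fin n → Carrier → Matrix n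
    rank1 u v w i j = w * (b u v i * b u v j)

    ∑-neg : ∀ {k} (y : Fin k → Carrier) → ∑[ i < k ] (- y i) ≡ - (∑[ i < k ] y i)
    ∑-neg {zero}  y = sym -0#≈0#
    ∑-neg {suc k} y =
      trans (cong (- y Fin.zero +_) (∑-neg (λ i → y (Fin.suc i)))) (-‿+-comm _ _)

    ∑-indicator : ∀ {k} (u : Fin k) (y : Fin k → Carrier) →
                  ∑[ i < k ] (indicator u i * y i) ≡ y u
    ∑-indicator {suc k} Fin.zero y = trans
      (cong₂ _+_ (*-identityˡ _)
        (trans (sum-cong-≗ (λ i → zeroˡ (y (Fin.suc i)))) (sum-replicate-zero k)))
      (+-identityʳ _)
    ∑-indicator {suc k} (Fin.suc u) y =
      trans (cong₂ _+_ (zeroˡ _) (∑-indicator u (λ i → y (Fin.suc i)))) (+-identityˡ _)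

    ∑-b : ∀ u v → ∑[ i < n ] (b u v i * x i) ≡ x u - x v
    ∑-b u v = begin
      ∑[ i < n ] (b u v i * x i)
        ≡⟨ sum-cong-≗ (λ i → [y-z]x≈yx-zx (x i) (indicator u i) (indicator v i)) ⟩
      ∑[ i < n ] (indicator u i * x i - indicator v i * x i)
        ≡⟨ ∑-distrib-+ (λ i → indicator u i * x i) (λ i → - (indicator v i * x i)) ⟩
      ∑[ i < n ] (indicator u i * x i) + ∑[ i < n ] (- (indicator v i * x i))
        ≡⟨ cong₂ _+_ (∑-indicator u x)
             (trans (∑-neg (λ i → indicator v i * x i)) (cong -_ (∑-indicator v x))) ⟩
      x u - x v ∎

    form-rank1 : ∀ u v w → quadForm (rank1 u v w) x ≡ w * ((x u - x v) * (x u - x v))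
    form-rank1 u v w = begin
      ∑[ i < n ] ∑[ j < n ] (x i * (w * (b u v i * b u v j)) * x j)
        ≡⟨ sum-cong-≗ (λ i → sum-cong-≗ (λ j →
             solve 5 (λ p q r s t → (p ⊕ (q ⊕ (r ⊕ s))) ⊕ t ⊜ (q ⊕ (r ⊕ p)) ⊕ (s ⊕ t))
               refl (x i) w (b u v i) (b u v j) (x j))) ⟩
      ∑[ i < n ] ∑[ j < n ] (w * (b u v i * x i) * (b u v j * x j))
        ≡⟨ sum-cong-≗ (λ i → sym (*-distribˡ-sum (w * (b u v i * x i)) (λ j → b u v j * x j))) ⟩
      ∑[ i < n ] (w * (b u v i * x i) * ∑[ j < n ] (b u v j * x j))
        ≡⟨ *-distribʳ-sum (∑[ j < n ] (b u v j * x j)) (λ i → w * (b u v i * x i)) ⟨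
      ∑[ i < n ] (w * (b u v i * x i)) * ∑[ j < n ] (b u v j * x j)
        ≡⟨ cong₂ _*_ (sym (*-distribˡ-sum w (λ i → b u v i * x i))) refl ⟩
      w * ∑[ i < n ] (b u v i * x i) * ∑[ j < n ] (b u v j * x j)
        ≡⟨ cong₂ (λ s t → w * s * t) (∑-b u v) (∑-b u v) ⟩
      w * (x u - x v) * (x u - x v)
        ≡⟨ *-assoc _ _ _ ⟩
      w * ((x u - x v) * (x u - x v)) ∎

    form-zero : quadForm (λ _ _ → 0#) x ≡ 0#
    form-zero = trans (sum-cong-≗ λ i → trans (sum-cong-≗ λ j →
      trans (cong (_* x j) (zeroʳ (x i))) (zeroˡ (x j)))
      (sum-replicate-zero n)) (sum-replicate-zero n)

    form-+ : ∀ (M N : Matrix n) →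
             quadForm (λ i j → M i j + N i j) x ≡ quadForm M x + quadForm N x
    form-+ M N = trans (sum-cong-≗ λ i → trans (sum-cong-≗ λ j →
      trans (cong (_* x j) (distribˡ (x i) (M i j) (N i j))) (distribʳ (x j) _ _))
      (∑-distrib-+ (λ j → x i * M i j * x j) (λ j → x i * N i j * x j)))
      (∑-distrib-+ (λ i → ∑[ j < n ] (x i * M i j * x j)) (λ i → ∑[ j < n ] (x i * N i j * x j)))

    go : ∀ es → quadForm (λ i j → ∑ᴱ es (λ u v w → rank1 u v w i j)) x
              ≡ ∑ᴱ es (λ u v w → w * ((x u - x v) * (x u - x v)))
    go []                   = form-zero
    go (((u , v) , w) ∷ es) = trans
      (form-+ (rank1 u v w) (λ i j → ∑ᴱ es (λ u v w → rank1 u v w i j)))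
      (cong₂ _+_ (form-rank1 u v w) (go es))

------------------------------------------------------------------------
-- Algorithms
--
-- A deterministic algorithm is a closed program, mentioning neither a
-- particular graph nor a particular model of ℝ, in a call-by-value simply
-- typed λ-calculus with natural numbers, lists and an opaque type of reals.
-- The time is the number of executed instructions among add, sub, mul, div,
-- sqrt and leq, the only access to reals besides the constants 0 and 1.
-- `if` runs only the branch taken, and the body of a function is charged
-- for at every call.  Discrete data and control are not counted.

data Ty : Set where
  nat bool real : Ty
  list          : Ty → Ty
  _⊗_ _⇒_       : Ty → Ty → Ty

infixr 7 _⊗_
infixr 6 _⇒_

Ctx : Set
Ctx = List Ty

infix 3 _⊢_

data _⊢_ (Γ : Ctx) : Ty → Set where
  var        : ∀ {τ} → τ ∈ Γ → Γ ⊢ τ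
  lam        : ∀ {σ τ} → σ ∷ Γ ⊢ τ → Γ ⊢ σ ⇒ τ
  app        : ∀ {σ τ} → Γ ⊢ σ ⇒ τ → Γ ⊢ σ → Γ ⊢ τ
  let′       : ∀ {σ τ} → Γ ⊢ σ → σ ∷ Γ ⊢ τ → Γ ⊢ τ
  pair       : ∀ {σ τ} → Γ ⊢ σ → Γ ⊢ τ → Γ ⊢ σ ⊗ τ
  fst        : ∀ {σ τ} → Γ ⊢ σ ⊗ τ → Γ ⊢ σ
  snd        : ∀ {σ τ} → Γ ⊢ σ ⊗ τ → Γ ⊢ τ
  true false : Γ ⊢ bool
  if         : ∀ {τ} → Γ ⊢ bool → Γ ⊢ τ → Γ ⊢ τ → Γ ⊢ τ
  zero       : Γ ⊢ nat
  suc        : Γ ⊢ nat → Γ ⊢ nat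
  natrec     : ∀ {τ} → Γ ⊢ τ → τ ∷ nat ∷ Γ ⊢ τ → Γ ⊢ nat → Γ ⊢ τ
  leqℕ       : Γ ⊢ nat → Γ ⊢ nat → Γ ⊢ bool
  nil        : ∀ {σ} → Γ ⊢ list σ
  cons       : ∀ {σ} → Γ ⊢ σ → Γ ⊢ list σ → Γ ⊢ list σ
  listrec    : ∀ {σ τ} → Γ ⊢ τ → τ ∷ σ ∷ list σ ∷ Γ ⊢ τ → Γ ⊢ list σ → Γ ⊢ τ
  zeroᴿ one  : Γ ⊢ real
  add sub mul div : Γ ⊢ real → Γ ⊢ real → Γ ⊢ real
  sqrt       : Γ ⊢ real → Γ ⊢ real
  leq        : Γ ⊢ real → Γ ⊢ real → Γ ⊢ bool

module Execution (ℝ : Reals) where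

  open Reals ℝ
  open Graphs ℝ

  Timed : Set → Set
  Timed A = A × ℕ

  ⟦_⟧ : Ty → Set
  ⟦ nat ⟧    = ℕ
  ⟦ bool ⟧   = Bool
  ⟦ real ⟧   = Carrier
  ⟦ list σ ⟧ = List ⟦ σ ⟧
  ⟦ σ ⊗ τ ⟧  = ⟦ σ ⟧ × ⟦ τ ⟧
  ⟦ σ ⇒ τ ⟧  = ⟦ σ ⟧ → Timed ⟦ τ ⟧

  return : ∀ {A : Set} → A → Timed A
  return a = a , 0

  tick : ∀ {A : Set} → A → Timed A
  tick a = a , 1

  infixl 1 _>>=_
  _>>=_ : ∀ {A B : Set} → Timed A → (A → Timed B) → Timed B
  (a , s) >>= f = proj₁ (f a) , s ℕ.+ proj₂ (f a)

  natrecᵀ : ∀ {A : Set} → Timed A → (ℕ → A → Timed A) → ℕ → Timed A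
  natrecᵀ z s zero    = z
  natrecᵀ z s (suc k) = natrecᵀ z s k >>= s k

  listrecᵀ : ∀ {A B : Set} → Timed B → (A → List A → B → Timed B) → List A → Timed B
  listrecᵀ z s []       = z
  listrecᵀ z s (a ∷ as) = listrecᵀ z s as >>= s a as

  Env : Ctx → Set
  Env = All ⟦_⟧

  eval : ∀ {Γ τ} → Γ ⊢ τ → Env Γ → Timed ⟦ τ ⟧
  eval (var i)         ρ = return (lookup ρ i)
  eval (lam t)         ρ = return λ a → eval t (a ∷ ρ)
  eval (app t u)       ρ = eval t ρ >>= λ f → eval u ρ >>= f
  eval (let′ t u)      ρ = eval t ρ >>= λ a → eval u (a ∷ ρ)
  eval (pair t u)      ρ = eval t ρ >>= λ a → eval u ρ >>= λ b → return (a , b)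
  eval (fst t)         ρ = eval t ρ >>= λ p → return (proj₁ p)
  eval (snd t)         ρ = eval t ρ >>= λ p → return (proj₂ p)
  eval true            ρ = return true
  eval false           ρ = return false
  eval (if c t u)      ρ = eval c ρ >>= λ b → if b then eval t ρ else eval u ρ
  eval zero            ρ = return 0
  eval (suc t)         ρ = eval t ρ >>= λ k → return (suc k)
  eval (natrec z s t)  ρ = eval t ρ >>= natrecᵀ (eval z ρ) (λ k a → eval s (a ∷ k ∷ ρ))
  eval (leqℕ t u)      ρ = eval t ρ >>= λ j → eval u ρ >>= λ k → return (j ℕ.≤ᵇ k)
  eval nil             ρ = return []
  eval (cons t u)      ρ = eval t ρ >>= λ a → eval u ρ >>= λ as → return (a ∷ as)
  eval (listrec z s t) ρ =
    eval t ρ >>= listrecᵀ (eval z ρ) (λ a as b → eval s (b ∷ a ∷ as ∷ ρ))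
  eval zeroᴿ           ρ = return 0#
  eval one             ρ = return 1#
  eval (add t u)       ρ = eval t ρ >>= λ a → eval u ρ >>= λ b → tick (a + b)
  eval (sub t u)       ρ = eval t ρ >>= λ a → eval u ρ >>= λ b → tick (a - b)
  eval (mul t u)       ρ = eval t ρ >>= λ a → eval u ρ >>= λ b → tick (a * b)
  eval (div t u)       ρ = eval t ρ >>= λ a → eval u ρ >>= λ b → tick (a / b)
  eval (sqrt t)        ρ = eval t ρ >>= λ a → tick (√ a)
  eval (leq t u)       ρ = eval t ρ >>= λ a → eval u ρ >>= λ b → tick (does (a ≤? b))

-- Vertices are passed as natural numbers; an edge (u , v) of weight w as
-- ((u , v) , w).
edgeTy : Ty
edgeTy = (nat ⊗ nat) ⊗ real

-- Input: d, the number of vertices, and the list of weighted edges.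
-- Output: a list of weighted edges.
Algorithm : Set
Algorithm = real ∷ nat ∷ list edgeTy ∷ [] ⊢ list edgeTy

module Running (ℝ : Reals) where

  open Reals ℝ
  open Graphs ℝ
  open Execution ℝ

  encode : ∀ {n} → WeightedGraph n → ⟦ list edgeTy ⟧
  encode G = map (λ ((u , v) , w) → (toℕ u , toℕ v) , w) (wedges G)

  run : ∀ {n} → Algorithm → Carrier → WeightedGraph n → Timed ⟦ list edgeTy ⟧
  run {n} A d G = eval A (d ∷ n ∷ encode G ∷ [])

  output : ∀ {n} → Algorithm → Carrier → WeightedGraph n → ⟦ list edgeTy ⟧
  output A d G = proj₁ (run A d G)

  time : ∀ {n} → Algorithm → Carrier → WeightedGraph n → ℕ
  time A d G = proj₂ (run A d G)

{-# OPTIONS --safe #-}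
module Submission where

-- Batson–Spielman–Srivastava barriers, without eigenvalues. Let W be the space of potential
-- differences h_e = y_u - y_v on the edges, and let ⟨h, k⟩_c = Σ c_e h_e k_e. If ⟨,⟩_c is definite on W,
-- it has a reproducing kernel K_c, and adding t to one weight changes K_c by the Sherman–Morrison
-- formula. The algorithm keeps weights s and the kernels K of u w - s and J of s - l w, as n × n
-- matrices, with the potentials Φ(K) = Σ w_e K_ee and Φ(J). One step raises u by a and l by 1, through
-- m rank-one updates, and then moves weight onto one edge. Nonnegativity of ⟨,⟩_c at the vectors
-- K_e - K′_e and J′_e - (1 + Δ) J_e, where ′ is the state after raising and Δ = Φ(J′) - Φ(J), gives by
-- averaging over e an edge which can absorb weight without increasing either potential. The first kernel
-- comes from Gram–Schmidt on n - 1 unit vectors, so that Φ is at most n - 1 for s = 0 and u = 1.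
-- After ⌈d (n - 1)⌉ steps u / l has reached the required ratio. If m ≤ d (n - 1), G itself is returned.

open import Defs
import Algebra.Properties.Ring as RingProperties
import Algebra.Properties.Semiring.Mult as Mult
import Algebra.Properties.Semiring.Mult.TCOptimised as Multᵒ
import Algebra.Solver.Ring as RingSolver
open import Algebra.Solver.Ring.AlmostCommutativeRing
  using (AlmostCommutativeRing; fromCommutativeRing; _-Raw-AlmostCommutative⟶_)
open import Data.Bool.Base as Bool using (true; false; if_then_else_)
open import Data.Fin.Base as Fin using (Fin; toℕ; fromℕ<)
import Data.Fin.Properties as Fin
open import Data.Integer.Base as ℤ using (ℤ; -[1+_]; _⊖_)
import Data.Integer.Properties as ℤ
open import Data.List.Base using (List; []; _∷_; length; lookup; map)
open import Data.List.Membership.Propositional using (_∈_)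
open import Data.List.Membership.Propositional.Properties using (∈-lookup)
open import Data.List.Properties using (length-map)
open import Data.List.Relation.Binary.Subset.Propositional using (_⊆_)
open import Data.List.Relation.Unary.All as All using (All; []; _∷_)
import Data.List.Relation.Unary.All.Properties as All
open import Data.List.Relation.Unary.AllPairs using ([]; _∷_)
open import Data.List.Relation.Unary.Any using (here; there)
open import Data.List.Relation.Unary.Unique.Propositional using (Unique)
open import Data.Maybe.Base using (Maybe; just; nothing)
open import Data.Nat.Base as ℕ using (ℕ; zero; suc)
import Data.Nat.Properties as ℕ
open import Data.Product.Base using (Σ-syntax; ∃; _×_; _,_; proj₁; proj₂)
open import Data.Sum.Base using (_⊎_; inj₁; inj₂)
open import Data.Unit.Base using (tt)
open import Relation.Binary.Definitions using (tri<; tri≈; tri>)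
open import Relation.Binary.PropositionalEquality
open import Relation.Nullary using (¬_; Dec; yes; no; does)
open import Relation.Nullary.Negation using (contradiction)

-- The obstacle is exact arithmetic: eigenvalues and the inverse square root of L_G are out of
-- reach, and L_G is singular. Passing to potential differences quotients out the kernel of L_G,
-- whether or not G is connected, and each spectral inequality becomes the value of a form at an
-- explicit vector, or Cauchy-Schwarz against a section of the kernel. The constants: put s = √d and
-- N = n - 1. The barriers start at u = N s a and l = - N s, so the potentials start at most at 1/(s
-- a) and 1/s. Averaging needs 1/a + 1/(s a) ≤ 1 - 1/s, and equality gives a = (s + 1)/(s - 1).
-- After q ≥ d N steps, u / l = a (q + N s)/(q - N s) is at most a² = (d + 1 + 2 s)/(d + 1 - 2 s).
-- Dividing the weights by l turns the lower barrier into L_G. The time: a step costs O(m n²), since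
-- a rank-one update takes O(n²) and comparing the edges takes O(m²) with m ≤ n². Primitive
-- recursion cannot search for ⌈d N⌉ without a bound; once G has been returned for m ≤ d N, the
-- number m is such a bound.

-- Ordered field arithmetic and a ring solver with integer coefficients.

module OrderedField (ℝ : Reals) where

  open Reals ℝ
  open RingProperties ring using (-‿+-comm; -‿distribˡ-*; -‿distribʳ-*; -0#≈0#; -‿involutive)
  open ≡-Reasoning

  private
    ACR : AlmostCommutativeRing _ _
    ACR = fromCommutativeRing commutativeRing

    open Multᵒ semiring using (×-homo-+; ×1-homo-*) renaming (_×_ to _×ᵒ_)

    -- Coefficients are integers because their equality is decided by computation, which lets the
    -- solver cancel terms. The optimised multiple makes the images of 0 and 1 definitionally `0#`
    -- and `1#`.
    ⟦_⟧ᶻ : ℤ → Carrier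
    ⟦ ℤ.+ n ⟧ᶻ      = n ×ᵒ 1#
    ⟦ -[1+ n ] ⟧ᶻ = - (suc n ×ᵒ 1#)

    neg-homo : ∀ i → ⟦ ℤ.- i ⟧ᶻ ≡ - ⟦ i ⟧ᶻ
    neg-homo (ℤ.+ zero)   = sym -0#≈0#
    neg-homo (ℤ.+ suc n)  = refl
    neg-homo (-[1+ n ]) = sym (-‿involutive _)

    cancelʳ : ∀ a b → a ≡ a + b - b
    cancelʳ a b = sym (trans (+-assoc a b (- b)) (trans (cong (a +_) (-‿inverseʳ b)) (+-identityʳ a)))

    ⊖-homo : ∀ m n → ⟦ m ⊖ n ⟧ᶻ ≡ m ×ᵒ 1# - n ×ᵒ 1#
    ⊖-homo m n with ℕ.≤-total n m
    ... | inj₁ n≤m = begin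
      ⟦ m ⊖ n ⟧ᶻ                             ≡⟨ cong ⟦_⟧ᶻ (ℤ.⊖-≥ n≤m) ⟩
      (m ℕ.∸ n) ×ᵒ 1#                        ≡⟨ cancelʳ _ _ ⟩
      (m ℕ.∸ n) ×ᵒ 1# + n ×ᵒ 1# - n ×ᵒ 1#    ≡⟨ cong (_- n ×ᵒ 1#) (×-homo-+ 1# (m ℕ.∸ n) n) ⟨
      (m ℕ.∸ n ℕ.+ n) ×ᵒ 1# - n ×ᵒ 1#        ≡⟨ cong (λ k → k ×ᵒ 1# - n ×ᵒ 1#) (ℕ.m∸n+n≡m n≤m) ⟩
      m ×ᵒ 1# - n ×ᵒ 1#                      ∎
    ... | inj₂ m≤n = begin
      ⟦ m ⊖ n ⟧ᶻ                             ≡⟨ cong ⟦_⟧ᶻ (ℤ.⊖-≤ m≤n) ⟩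
      ⟦ ℤ.- (ℤ.+ (n ℕ.∸ m)) ⟧ᶻ                 ≡⟨ neg-homo (ℤ.+ (n ℕ.∸ m)) ⟩
      - ((n ℕ.∸ m) ×ᵒ 1#)                    ≡⟨ cong -_ (cancelʳ _ _) ⟩
      - ((n ℕ.∸ m) ×ᵒ 1# + m ×ᵒ 1# - m ×ᵒ 1#)
        ≡⟨ cong (λ a → - (a - m ×ᵒ 1#)) (×-homo-+ 1# (n ℕ.∸ m) m) ⟨
      - ((n ℕ.∸ m ℕ.+ m) ×ᵒ 1# - m ×ᵒ 1#)
        ≡⟨ cong (λ k → - (k ×ᵒ 1# - m ×ᵒ 1#)) (ℕ.m∸n+n≡m m≤n) ⟩
      - (n ×ᵒ 1# - m ×ᵒ 1#)                  ≡⟨ -‿+-comm _ _ ⟨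
      - (n ×ᵒ 1#) - - (m ×ᵒ 1#)              ≡⟨ cong (- (n ×ᵒ 1#) +_) (-‿involutive _) ⟩
      - (n ×ᵒ 1#) + m ×ᵒ 1#                  ≡⟨ +-comm _ _ ⟩
      m ×ᵒ 1# - n ×ᵒ 1#                      ∎

    +-homo : ∀ i j → ⟦ i ℤ.+ j ⟧ᶻ ≡ ⟦ i ⟧ᶻ + ⟦ j ⟧ᶻ
    +-homo (ℤ.+ m)    (ℤ.+ n)    = ×-homo-+ 1# m n
    +-homo (ℤ.+ m)    -[1+ n ] = ⊖-homo m (suc n)
    +-homo -[1+ m ] (ℤ.+ n)    = trans (⊖-homo n (suc m)) (+-comm _ _)
    +-homo -[1+ m ] -[1+ n ] = begin
      - (suc (suc (m ℕ.+ n)) ×ᵒ 1#)          ≡⟨ cong (λ k → - (suc k ×ᵒ 1#)) (ℕ.+-suc m n) ⟨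
      - ((suc m ℕ.+ suc n) ×ᵒ 1#)            ≡⟨ cong -_ (×-homo-+ 1# (suc m) (suc n)) ⟩
      - (suc m ×ᵒ 1# + suc n ×ᵒ 1#)          ≡⟨ -‿+-comm _ _ ⟨
      - (suc m ×ᵒ 1#) + - (suc n ×ᵒ 1#)      ∎

    *-homo : ∀ i j → ⟦ i ℤ.* j ⟧ᶻ ≡ ⟦ i ⟧ᶻ * ⟦ j ⟧ᶻ
    *-homo (ℤ.+ m)    (ℤ.+ n)    = trans (cong ⟦_⟧ᶻ (ℤ.+◃n≡+n (m ℕ.* n))) (×1-homo-* m n)
    *-homo (ℤ.+ m)    -[1+ n ] = begin
      ⟦ ℤ.+ m ℤ.* -[1+ n ] ⟧ᶻ                  ≡⟨ cong ⟦_⟧ᶻ (ℤ.-◃n≡-n (m ℕ.* suc n)) ⟩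
      ⟦ ℤ.- (ℤ.+ (m ℕ.* suc n)) ⟧ᶻ             ≡⟨ neg-homo (ℤ.+ (m ℕ.* suc n)) ⟩
      - ((m ℕ.* suc n) ×ᵒ 1#)                ≡⟨ cong -_ (×1-homo-* m (suc n)) ⟩
      - (m ×ᵒ 1# * suc n ×ᵒ 1#)              ≡⟨ -‿distribʳ-* _ _ ⟩
      m ×ᵒ 1# * - (suc n ×ᵒ 1#)              ∎
    *-homo -[1+ m ] (ℤ.+ n)    = begin
      ⟦ -[1+ m ] ℤ.* ℤ.+ n ⟧ᶻ                  ≡⟨ cong ⟦_⟧ᶻ (ℤ.-◃n≡-n (suc m ℕ.* n)) ⟩
      ⟦ ℤ.- (ℤ.+ (suc m ℕ.* n)) ⟧ᶻ             ≡⟨ neg-homo (ℤ.+ (suc m ℕ.* n)) ⟩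
      - ((suc m ℕ.* n) ×ᵒ 1#)                ≡⟨ cong -_ (×1-homo-* (suc m) n) ⟩
      - (suc m ×ᵒ 1# * n ×ᵒ 1#)              ≡⟨ -‿distribˡ-* _ _ ⟩
      - (suc m ×ᵒ 1#) * n ×ᵒ 1#              ∎
    *-homo -[1+ m ] -[1+ n ] = begin
      (suc m ℕ.* suc n) ×ᵒ 1#                ≡⟨ ×1-homo-* (suc m) (suc n) ⟩
      suc m ×ᵒ 1# * suc n ×ᵒ 1#              ≡⟨ -‿involutive _ ⟨
      - - (suc m ×ᵒ 1# * suc n ×ᵒ 1#)        ≡⟨ cong -_ (-‿distribˡ-* _ _) ⟩
      - (- (suc m ×ᵒ 1#) * suc n ×ᵒ 1#)      ≡⟨ -‿distribʳ-* _ _ ⟩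
      - (suc m ×ᵒ 1#) * - (suc n ×ᵒ 1#)      ∎

    ℤ⟶ℝ : ℤ.+-*-rawRing -Raw-AlmostCommutative⟶ ACR
    ℤ⟶ℝ = record
      { ⟦_⟧ = ⟦_⟧ᶻ ; +-homo = +-homo ; *-homo = *-homo ; -‿homo = neg-homo
      ; 0-homo = refl ; 1-homo = refl }

    coeff≟ : ∀ i j → Maybe (⟦ i ⟧ᶻ ≡ ⟦ j ⟧ᶻ)
    coeff≟ i j with i ℤ.≟ j
    ... | yes i≡j = just (cong ⟦_⟧ᶻ i≡j)
    ... | no  _   = nothing

  open RingSolver ℤ.+-*-rawRing ACR ℤ⟶ℝ coeff≟ public
    using (solve; con; _:=_; _:+_; _:*_; _:-_; :-_)

  pattern 𝟘 = con (ℤ.+ 0)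
  pattern 𝟙 = con (ℤ.+ 1)

  -- Many inequalities below take this shape: a nonnegative certificate `z`, and an identity left to
  -- the ring solver.
  ≤-by : ∀ {x y z} → 0# ≤ z → y ≡ x + z → x ≤ y
  ≤-by {x} {y} {z} 0≤z y≡x+z =
    subst₂ _≤_ (+-identityˡ x) (trans (+-comm z x) (sym y≡x+z)) (+-monoˡ-≤ x 0≤z)

  ≤⇒0≤- : ∀ {x y} → x ≤ y → 0# ≤ y - x
  ≤⇒0≤- {x} {y} x≤y = subst (_≤ y - x) (-‿inverseʳ x) (+-monoˡ-≤ (- x) x≤y)

  0≤-⇒≤ : ∀ {x y} → 0# ≤ y - x → x ≤ y
  0≤-⇒≤ {x} {y} h = ≤-by h (solve 2 (λ x y → y := x :+ (y :- x)) refl x y)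

  +-mono-≤ : ∀ {a b c d} → a ≤ b → c ≤ d → a + c ≤ b + d
  +-mono-≤ {a} {b} {c} {d} a≤b c≤d = ≤-trans (+-monoˡ-≤ c a≤b)
    (subst₂ _≤_ (+-comm c b) (+-comm d b) (+-monoˡ-≤ b c≤d))

  0≤+ : ∀ {a b} → 0# ≤ a → 0# ≤ b → 0# ≤ a + b
  0≤+ {a} {b} p q = subst (_≤ a + b) (+-identityʳ 0#) (+-mono-≤ p q)

  neg-nonneg : ∀ {x} → x ≤ 0# → 0# ≤ - x
  neg-nonneg {x} x≤0 = subst (0# ≤_) (+-identityˡ (- x)) (≤⇒0≤- x≤0)

  ≰⇒> : ∀ {x y} → ¬ (x ≤ y) → y < x
  ≰⇒> {x} {y} x≰y with total x y
  ... | inj₁ x≤y = contradiction x≤y x≰y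
  ... | inj₂ y≤x = y≤x , λ y≡x → x≰y (≤-reflexive (sym y≡x))

  <⇒≱ : ∀ {x y} → x < y → ¬ (y ≤ x)
  <⇒≱ (x≤y , x≢y) y≤x = x≢y (antisym x≤y y≤x)

  <-≤-trans : ∀ {x y z} → x < y → y ≤ z → x < z
  <-≤-trans {x} x<y y≤z = ≤-trans (proj₁ x<y) y≤z , λ x≡z → <⇒≱ x<y (subst (_ ≤_) (sym x≡z) y≤z)

  ≤-<-trans : ∀ {x y z} → x ≤ y → y < z → x < z
  ≤-<-trans x≤y y<z = ≤-trans x≤y (proj₁ y<z) , λ x≡z → <⇒≱ y<z (subst (_≤ _) x≡z x≤y)

  <-by : ∀ {x y z} → 0# < z → y ≡ x + z → x < y
  <-by {x} {y} {z} (0≤z , 0≢z) y≡x+z = ≤-by 0≤z y≡x+z , λ x≡y → 0≢z (begin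
    0#           ≡⟨ -‿inverseʳ x ⟨
    x - x        ≡⟨ cong (_- x) (trans x≡y y≡x+z) ⟩
    x + z - x    ≡⟨ solve 2 (λ x z → x :+ z :- x := z) refl x z ⟩
    z            ∎)

  <⇒0<- : ∀ {x y} → x < y → 0# < y - x
  <⇒0<- {x} {y} (x≤y , x≢y) = ≤⇒0≤- x≤y , λ 0≡y-x → x≢y (begin
    x              ≡⟨ +-identityʳ x ⟨
    x + 0#         ≡⟨ cong (x +_) 0≡y-x ⟩
    x + (y - x)    ≡⟨ solve 2 (λ x y → x :+ (y :- x) := y) refl x y ⟩
    y              ∎)

  square-nonneg : ∀ x → 0# ≤ x * x
  square-nonneg x with total 0# x
  ... | inj₁ 0≤x = *-nonneg 0≤x 0≤x
  ... | inj₂ x≤0 = subst (0# ≤_) (solve 1 (λ x → :- x :* :- x := x :* x) refl x)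
                     (*-nonneg (neg-nonneg x≤0) (neg-nonneg x≤0))

  0≤1 : 0# ≤ 1#
  0≤1 = subst (0# ≤_) (*-identityˡ 1#) (square-nonneg 1#)

  0<1 : 0# < 1#
  0<1 = 0≤1 , 0≢1

  >⇒≢ : ∀ {x} → 0# < x → x ≢ 0#
  >⇒≢ (_ , 0≢x) x≡0 = 0≢x (sym x≡0)

  *-inverseˡ : ∀ x → x ≢ 0# → x ⁻¹ * x ≡ 1#
  *-inverseˡ x x≢0 = trans (*-comm _ _) (*-inverseʳ x x≢0)

  *-cancel-0 : ∀ {x y} → x ≢ 0# → x * y ≡ 0# → y ≡ 0#
  *-cancel-0 {x} {y} x≢0 xy≡0 = begin
    y                ≡⟨ *-identityˡ y ⟨
    1# * y           ≡⟨ cong (_* y) (*-inverseˡ x x≢0) ⟨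
    x ⁻¹ * x * y     ≡⟨ *-assoc _ _ _ ⟩
    x ⁻¹ * (x * y)   ≡⟨ cong (x ⁻¹ *_) xy≡0 ⟩
    x ⁻¹ * 0#        ≡⟨ zeroʳ _ ⟩
    0#               ∎

  square-zero : ∀ {x} → x * x ≡ 0# → x ≡ 0#
  square-zero {x} xx≡0 with x ≟ 0#
  ... | yes x≡0 = x≡0
  ... | no  x≢0 = *-cancel-0 x≢0 xx≡0

  *-pos : ∀ {x y} → 0# < x → 0# < y → 0# < x * y
  *-pos 0<x 0<y = *-nonneg (proj₁ 0<x) (proj₁ 0<y) ,
    λ 0≡xy → >⇒≢ 0<y (*-cancel-0 (>⇒≢ 0<x) (sym 0≡xy))

  ⁻¹-pos : ∀ {x} → 0# < x → 0# < x ⁻¹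
  ⁻¹-pos {x} 0<x = 0≤x⁻¹ , λ 0≡x⁻¹ → 0≢1 (begin
    0#         ≡⟨ zeroʳ x ⟨
    x * 0#     ≡⟨ cong (x *_) 0≡x⁻¹ ⟩
    x * x ⁻¹   ≡⟨ *-inverseʳ x (>⇒≢ 0<x) ⟩
    1#         ∎)
    where
    0≤x⁻¹ : 0# ≤ x ⁻¹
    -- The inverse equals `x` times its own square, a product of nonnegative factors.
    0≤x⁻¹ = subst (0# ≤_)
      (trans (solve 2 (λ x i → x :* (i :* i) := x :* i :* i) refl x (x ⁻¹))
        (trans (cong (_* x ⁻¹) (*-inverseʳ x (>⇒≢ 0<x))) (*-identityˡ _)))
      (*-nonneg (proj₁ 0<x) (square-nonneg (x ⁻¹)))

  *-monoˡ-≤ : ∀ {a b c} → 0# ≤ a → b ≤ c → a * b ≤ a * c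
  *-monoˡ-≤ {a} {b} {c} 0≤a b≤c = 0≤-⇒≤ (subst (0# ≤_)
    (solve 3 (λ a b c → a :* (c :- b) := a :* c :- a :* b) refl a b c)
    (*-nonneg 0≤a (≤⇒0≤- b≤c)))

  *-monoʳ-≤ : ∀ {a b c} → 0# ≤ a → b ≤ c → b * a ≤ c * a
  *-monoʳ-≤ {a} {b} {c} 0≤a b≤c = subst₂ _≤_ (*-comm a b) (*-comm a c) (*-monoˡ-≤ 0≤a b≤c)

  *-cancelˡ-≤ : ∀ {a b c} → 0# < a → a * b ≤ a * c → b ≤ c
  *-cancelˡ-≤ {a} {b} {c} 0<a ab≤ac =
    subst₂ _≤_ (cancel b) (cancel c) (*-monoˡ-≤ (proj₁ (⁻¹-pos 0<a)) ab≤ac)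
    where
    cancel : ∀ x → a ⁻¹ * (a * x) ≡ x
    cancel x = trans (sym (*-assoc _ _ _))
      (trans (cong (_* x) (*-inverseˡ a (>⇒≢ 0<a))) (*-identityˡ x))

  *-mono-≤ : ∀ {a b c d} → 0# ≤ a → 0# ≤ d → a ≤ b → c ≤ d → a * c ≤ b * d
  *-mono-≤ 0≤a 0≤d a≤b c≤d = ≤-trans (*-monoˡ-≤ 0≤a c≤d) (*-monoʳ-≤ 0≤d a≤b)

  fromℕ-+ : ∀ a b → fromℕ (a ℕ.+ b) ≡ fromℕ a + fromℕ b
  fromℕ-+ a b = Mult.×-homo-+ semiring 1# a b

  fromℕ-* : ∀ a b → fromℕ (a ℕ.* b) ≡ fromℕ a * fromℕ b
  fromℕ-* a b = Mult.×1-homo-* semiring a b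

  fromℕ-nonneg : ∀ k → 0# ≤ fromℕ k
  fromℕ-nonneg zero    = ≤-refl
  fromℕ-nonneg (suc k) = 0≤+ 0≤1 (fromℕ-nonneg k)

  fromℕ-mono : ∀ {j k} → j ℕ.≤ k → fromℕ j ≤ fromℕ k
  fromℕ-mono {j} {k} j≤k = ≤-by (fromℕ-nonneg (k ℕ.∸ j))
    (trans (cong fromℕ (sym (ℕ.m+[n∸m]≡n j≤k))) (fromℕ-+ j (k ℕ.∸ j)))

  fromℕ-cancel-< : ∀ {j k} → fromℕ j < fromℕ k → j ℕ.< k
  fromℕ-cancel-< {j} {k} j<k with j ℕ.<? k
  ... | yes p = p
  ... | no ¬p = contradiction (fromℕ-mono (ℕ.≮⇒≥ ¬p)) (<⇒≱ j<k)

  fromℕ-pos : ∀ k → 0# < fromℕ (suc k)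
  fromℕ-pos k = <-≤-trans 0<1 (≤-by (fromℕ-nonneg k) refl)

-- Finite sums, averaging, and the Kronecker delta.

module Summation (ℝ : Reals) where

  open Reals ℝ
  open OrderedField ℝ

  -- The top index comes off first, as in the evaluation of `natrec` and in a list whose positions
  -- are counted from its end.
  ∑< : ℕ → (ℕ → Carrier) → Carrier
  ∑< zero    f = 0#
  ∑< (suc m) f = f m + ∑< m f

  ∑-cong : ∀ m {f g} → (∀ {i} → i ℕ.< m → f i ≡ g i) → ∑< m f ≡ ∑< m g
  ∑-cong zero    f≡g = refl
  ∑-cong (suc m) f≡g = cong₂ _+_ (f≡g ℕ.≤-refl) (∑-cong m λ i<m → f≡g (ℕ.m<n⇒m<1+n i<m))

  ∑-+ : ∀ m f g → ∑< m (λ i → f i + g i) ≡ ∑< m f + ∑< m g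
  ∑-+ zero    f g = sym (+-identityʳ 0#)
  ∑-+ (suc m) f g = trans (cong (f m + g m +_) (∑-+ m f g))
    (solve 4 (λ a b s t → a :+ b :+ (s :+ t) := a :+ s :+ (b :+ t)) refl (f m) (g m) _ _)

  ∑-* : ∀ m a f → ∑< m (λ i → a * f i) ≡ a * ∑< m f
  ∑-* zero    a f = sym (zeroʳ a)
  ∑-* (suc m) a f = trans (cong (a * f m +_) (∑-* m a f)) (sym (distribˡ a (f m) _))

  ∑-0 : ∀ m → ∑< m (λ _ → 0#) ≡ 0#
  ∑-0 zero    = refl
  ∑-0 (suc m) = trans (+-identityˡ _) (∑-0 m)

  ∑-swap : ∀ m n (f : ℕ → ℕ → Carrier) →
           ∑< m (λ i → ∑< n (f i)) ≡ ∑< n (λ j → ∑< m (λ i → f i j))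
  ∑-swap zero    n f = sym (∑-0 n)
  ∑-swap (suc m) n f = trans (cong (∑< n (f m) +_) (∑-swap m n f))
    (sym (∑-+ n (f m) (λ j → ∑< m (λ i → f i j))))

  ∑-nonneg : ∀ m {f} → (∀ {i} → i ℕ.< m → 0# ≤ f i) → 0# ≤ ∑< m f
  ∑-nonneg zero    h = ≤-refl
  ∑-nonneg (suc m) h = 0≤+ (h ℕ.≤-refl) (∑-nonneg m λ i<m → h (ℕ.m<n⇒m<1+n i<m))

  ∑-mono : ∀ m {f g} → (∀ {i} → i ℕ.< m → f i ≤ g i) → ∑< m f ≤ ∑< m g
  ∑-mono zero    h = ≤-refl
  ∑-mono (suc m) h = +-mono-≤ (h ℕ.≤-refl) (∑-mono m λ i<m → h (ℕ.m<n⇒m<1+n i<m))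

  term≤∑ : ∀ m {f} → (∀ {i} → i ℕ.< m → 0# ≤ f i) → ∀ {i} → i ℕ.< m → f i ≤ ∑< m f
  term≤∑ (suc m) {f} h {i} (ℕ.s≤s i≤m) with ℕ.m≤n⇒m<n∨m≡n i≤m
  ... | inj₂ refl = ≤-by (∑-nonneg m λ j<m → h (ℕ.m<n⇒m<1+n j<m)) refl
  ... | inj₁ i<m  = ≤-trans (term≤∑ m (λ j<m → h (ℕ.m<n⇒m<1+n j<m)) i<m)
                      (≤-by (h ℕ.≤-refl) (+-comm (f m) _))

  -- The averaging principle. If the top term violates the inequality, removing it from both sums
  -- keeps the inequality of the sums, so the search continues below; a single remaining term cannot
  -- fail.
  ∑≤∑⇒∃ : ∀ m {f g} → 0 ℕ.< m → ∑< m f ≤ ∑< m g → ∃ λ i → i ℕ.< m × f i ≤ g i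
  ∑≤∑⇒∃ (suc m) {f} {g} _ h with f m ≤? g m
  ... | yes p = m , ℕ.≤-refl , p
  ∑≤∑⇒∃ (suc zero) {f} {g} _ h | no ¬p =
    contradiction (subst₂ _≤_ (+-identityʳ (f 0)) (+-identityʳ (g 0)) h) ¬p
  ∑≤∑⇒∃ (suc (suc m)) {f} {g} _ h | no ¬p with ∑≤∑⇒∃ (suc m) {f} {g} (ℕ.s≤s ℕ.z≤n)
    (0≤-⇒≤ (≤-trans (0≤+ (≤⇒0≤- h) (≤⇒0≤- (proj₁ (≰⇒> ¬p))))
      (≤-reflexive (solve 4 (λ a b s t → b :+ t :- (a :+ s) :+ (a :- b) := t :- s) refl
        (f (suc m)) (g (suc m)) (∑< (suc m) f) (∑< (suc m) g)))))
  ... | i , i<m , p = i , ℕ.m<n⇒m<1+n i<m , p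

  δ : ℕ → ℕ → Carrier
  δ zero    zero    = 1#
  δ zero    (suc j) = 0#
  δ (suc i) zero    = 0#
  δ (suc i) (suc j) = δ i j

  δ-refl : ∀ i → δ i i ≡ 1#
  δ-refl zero    = refl
  δ-refl (suc i) = δ-refl i

  δ-≢ : ∀ {i j} → i ≢ j → δ i j ≡ 0#
  δ-≢ {zero}  {zero}  i≢j = contradiction refl i≢j
  δ-≢ {zero}  {suc j} i≢j = refl
  δ-≢ {suc i} {zero}  i≢j = refl
  δ-≢ {suc i} {suc j} i≢j = δ-≢ λ i≡j → i≢j (cong suc i≡j)

  δ-nonneg : ∀ i j → 0# ≤ δ i j
  δ-nonneg zero    zero    = 0≤1
  δ-nonneg zero    (suc j) = ≤-refl
  δ-nonneg (suc i) zero    = ≤-refl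
  δ-nonneg (suc i) (suc j) = δ-nonneg i j

  ∑-δ≡0 : ∀ m g (f : ℕ → Carrier) → m ℕ.≤ g → ∑< m (λ e → δ g e * f e) ≡ 0#
  ∑-δ≡0 zero    g f m≤g = refl
  ∑-δ≡0 (suc m) g f m<g = trans
    (cong₂ _+_ (trans (cong (_* f m) (δ-≢ (ℕ.>⇒≢ m<g))) (zeroˡ _)) (∑-δ≡0 m g f (ℕ.<⇒≤ m<g)))
    (+-identityˡ 0#)

  ∑-δ : ∀ m {g} (f : ℕ → Carrier) → g ℕ.< m → ∑< m (λ e → δ g e * f e) ≡ f g
  ∑-δ (suc m) {g} f (ℕ.s≤s g≤m) with ℕ.m≤n⇒m<n∨m≡n g≤m
  ... | inj₂ refl = trans (cong₂ _+_ (trans (cong (_* f m) (δ-refl m)) (*-identityˡ _))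
                      (∑-δ≡0 m m f ℕ.≤-refl)) (+-identityʳ _)
  ... | inj₁ g<m  = trans (cong₂ _+_ (trans (cong (_* f m) (δ-≢ (ℕ.<⇒≢ g<m))) (zeroˡ _))
                      (∑-δ m f g<m)) (+-identityˡ _)

  -- A space W of functions on {0, …, m-1}; values at larger indices are junk.
  record Space : Set₁ where
    field
      m       : ℕ
      W       : (ℕ → Carrier) → Set
      W-comb  : ∀ a b {h k} → W h → W k → W (λ e → a * h e + b * k e)
      W-≗     : ∀ {h k} → (∀ e → h e ≡ k e) → W h → W k
      W-ample : ∀ {e} → e ℕ.< m → ∃ λ h → W h × h e ≡ 1#
      w       : ℕ → Carrier
      w-pos   : ∀ {e} → e ℕ.< m → 0# < w e

-- Reproducing kernels of definite forms and their rank-one updates.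

module Kernels (ℝ : Reals) (S : Summation.Space ℝ) where

  open Reals ℝ
  open OrderedField ℝ
  open Summation ℝ
  open Space S public
  open ≡-Reasoning

  form : (ℕ → Carrier) → (ℕ → Carrier) → (ℕ → Carrier) → Carrier
  form c h k = ∑< m λ e → c e * (h e * k e)

  form-cong : ∀ {c c′} → (∀ {e} → e ℕ.< m → c e ≡ c′ e) → ∀ h k → form c h k ≡ form c′ h k
  form-cong c≡c′ h k = ∑-cong m λ e<m → cong (_* _) (c≡c′ e<m)

  form-comb : ∀ c a b h k → form c (λ e → a * h e + b * k e) (λ e → a * h e + b * k e)
              ≡ a * a * form c h h + (a * b + a * b) * form c h k + b * b * form c k k
  form-comb c a b h k = go m
    where
    go : ∀ n → ∑< n (λ e → c e * ((a * h e + b * k e) * (a * h e + b * k e)))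
         ≡ a * a * ∑< n (λ e → c e * (h e * h e)) + (a * b + a * b) * ∑< n (λ e → c e * (h e * k e))
           + b * b * ∑< n (λ e → c e * (k e * k e))
    go zero    = solve 2 (λ a b → 𝟘 := a :* a :* 𝟘 :+ (a :* b :+ a :* b) :* 𝟘 :+ b :* b :* 𝟘) refl a b
    go (suc n) = trans (cong (c n * ((a * h n + b * k n) * (a * h n + b * k n)) +_) (go n))
      (solve 8 (λ a b c h k s t u →
          c :* ((a :* h :+ b :* k) :* (a :* h :+ b :* k))
            :+ (a :* a :* s :+ (a :* b :+ a :* b) :* t :+ b :* b :* u)
          := a :* a :* (c :* (h :* h) :+ s) :+ (a :* b :+ a :* b) :* (c :* (h :* k) :+ t)
            :+ b :* b :* (c :* (k :* k) :+ u)) refl a b (c n) (h n) (k n) _ _ _)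

  form-shift : ∀ {c c′ v} a → (∀ {e} → e ℕ.< m → c′ e ≡ c e + a * v e) → ∀ h k →
               form c′ h k ≡ form c h k + a * form v h k
  form-shift {c} {c′} {v} a c′≡ h k = begin
    form c′ h k
      ≡⟨ ∑-cong m (λ {e} e<m → trans (cong (_* _) (c′≡ e<m))
           (solve 4 (λ c a v x → (c :+ a :* v) :* x := c :* x :+ a :* (v :* x)) refl (c e) a (v e) (h e * k e))) ⟩
    ∑< m (λ e → c e * (h e * k e) + a * (v e * (h e * k e)))
      ≡⟨ ∑-+ m _ _ ⟩
    form c h k + ∑< m (λ e → a * (v e * (h e * k e)))
      ≡⟨ cong (form c h k +_) (∑-* m a _) ⟩
    form c h k + a * form v h k ∎

  record PosDef (c : ℕ → Carrier) : Set where
    field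
      nonneg   : ∀ {h} → W h → 0# ≤ form c h h
      definite : ∀ {h} → W h → form c h h ≡ 0# → ∀ {e} → e ℕ.< m → h e ≡ 0#

  open PosDef public

  -- The reproducing kernel of W for form c: with c = u w - s and W the space of potential
  -- differences, K e f is b_eᵀ (u L_G - A)⁺ b_f, where A = Σ s_e b_e b_eᵀ.
  record Kernel (c : ℕ → Carrier) (K : ℕ → ℕ → Carrier) : Set where
    field
      section : ∀ {f} → f ℕ.< m → W (λ e → K e f)
      symm    : ∀ {e f} → e ℕ.< m → f ℕ.< m → K e f ≡ K f e
      repro   : ∀ {h} → W h → ∀ {f} → f ℕ.< m → form c h (λ e → K e f) ≡ h f

  open Kernel public

  kernel-cong : ∀ {c c′ K} → (∀ {e} → e ℕ.< m → c e ≡ c′ e) → Kernel c K → Kernel c′ K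
  kernel-cong c≡c′ κ = record
    { section = section κ
    ; symm = symm κ
    ; repro = λ wh f<m → trans (sym (form-cong c≡c′ _ _)) (repro κ wh f<m) }

  -- Changes of weights keep definiteness through this domination, which stands in for a lower bound
  -- on the smallest eigenvalue.
  posDef-≥ : ∀ {c c′ a} → 0# < a → (∀ {h} → W h → a * form c h h ≤ form c′ h h) →
             PosDef c → PosDef c′
  posDef-≥ {c} {c′} {a} 0<a dom pd = record
    { nonneg = λ wh → ≤-trans (*-nonneg (proj₁ 0<a) (nonneg pd wh)) (dom wh)
    ; definite = λ {h} wh f≡0 → definite pd wh (*-cancel-0 (>⇒≢ 0<a) (antisym
        (subst (a * form c h h ≤_) f≡0 (dom wh)) (*-nonneg (proj₁ 0<a) (nonneg pd wh)))) }

  posDef-mono : ∀ {c c′} → (∀ {e} → e ℕ.< m → c e ≤ c′ e) → PosDef c → PosDef c′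
  posDef-mono c≤c′ = posDef-≥ 0<1 λ {h} _ → subst (_≤ _) (sym (*-identityˡ _))
    (∑-mono m λ {e} e<m → *-monoʳ-≤ (square-nonneg (h e)) (c≤c′ e<m))

  module _ {c K} (κ : Kernel c K) where

    form-diag : ∀ {f} → f ℕ.< m → form c (λ e → K e f) (λ e → K e f) ≡ K f f
    form-diag f<m = repro κ (section κ f<m) f<m

    module _ (pd : PosDef c) where

      -- If `K e e` were zero, the section at `e` would have norm zero and vanish on all edges; by
      -- reproduction every `h` in `W` would vanish at `e`, against `W-ample`.
      diag-pos : ∀ {e} → e ℕ.< m → 0# < K e e
      diag-pos {e} e<m = subst (0# ≤_) (form-diag e<m) (nonneg pd (section κ e<m)) , λ 0≡K →
        0≢1 (begin
          0#                                 ≡⟨ ∑-0 m ⟨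
          ∑< m (λ _ → 0#)
            ≡⟨ ∑-cong m (λ {f} f<m → sym (trans (cong (λ x → c f * (h f * x))
                 (definite pd (section κ e<m) (trans (form-diag e<m) (sym 0≡K)) f<m))
                 (solve 2 (λ c h → c :* (h :* 𝟘) := 𝟘) refl (c f) (h f)))) ⟩
          form c h (λ f → K f e)             ≡⟨ repro κ wh e<m ⟩
          h e                                ≡⟨ he≡1 ⟩
          1#                                 ∎)
        where
        h    = proj₁ (W-ample e<m)
        wh   = proj₁ (proj₂ (W-ample e<m))
        he≡1 = proj₂ (proj₂ (W-ample e<m))

      -- Since `h e` is the product of `h` with the section K_e, this is Cauchy-Schwarz for that
      -- pair. It comes from the nonnegative value of the form at K_ee h - h_e K_e, after cancelling
      -- K_ee.
      cauchySchwarz : ∀ {h} → W h → ∀ {e} → e ℕ.< m → h e * h e ≤ K e e * form c h h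
      cauchySchwarz {h} wh {e} e<m = *-cancelˡ-≤ (diag-pos e<m) (0≤-⇒≤ (subst (0# ≤_)
        (begin
          form c (λ f → K e e * h f + - h e * K f e) (λ f → K e e * h f + - h e * K f e)
            ≡⟨ form-comb c (K e e) (- h e) h (λ f → K f e) ⟩
          K e e * K e e * form c h h + (K e e * - h e + K e e * - h e) * form c h (λ f → K f e)
            + - h e * - h e * form c (λ f → K f e) (λ f → K f e)
            ≡⟨ cong₂ (λ x y → K e e * K e e * form c h h + (K e e * - h e + K e e * - h e) * x
                 + - h e * - h e * y) (repro κ wh e<m) (form-diag e<m) ⟩
          K e e * K e e * form c h h + (K e e * - h e + K e e * - h e) * h e + - h e * - h e * K e e
            ≡⟨ solve 3 (λ k h s → k :* k :* s :+ (k :* :- h :+ k :* :- h) :* h :+ :- h :* :- h :* k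
                 := k :* (k :* s) :- k :* (h :* h)) refl (K e e) (h e) (form c h h) ⟩
          K e e * (K e e * form c h h) - K e e * (h e * h e) ∎)
        (nonneg pd (W-comb (K e e) (- h e) wh (section κ e<m)))))

  bump : (ℕ → Carrier) → ℕ → Carrier → ℕ → Carrier
  bump c g t e = c e + t * δ g e

  form-bump : ∀ c {g} t → g ℕ.< m → ∀ h k → form (bump c g t) h k ≡ form c h k + t * (h g * k g)
  form-bump c {g} t g<m h k =
    trans (form-shift t (λ _ → refl) h k) (cong (λ x → form c h k + t * x) (∑-δ m (λ e → h e * k e) g<m))

  rank1 : (ℕ → ℕ → Carrier) → ℕ → Carrier → ℕ → ℕ → Carrier
  rank1 K g t e f = K e f - t / (1# + t * K g g) * (K e g * K f g)

  module _ {c K} (κ : Kernel c K) {g t} (g<m : g ℕ.< m) (pd : PosDef (bump c g t)) where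

    private
      form-g : form (bump c g t) (λ e → K e g) (λ e → K e g) ≡ K g g * (1# + t * K g g)
      form-g = trans (form-bump c t g<m _ _) (trans (cong (_+ t * (K g g * K g g)) (form-diag κ g<m))
        (solve 2 (λ k t → k :+ t :* (k :* k) := k :* (𝟙 :+ t :* k)) refl (K g g) t))

    -- The new form takes the value K_gg (1 + t K_gg) at the section K_g. If the second factor were
    -- zero, definiteness would give K_gg = 0, and the factor would be 1.
    rank1-denominator : 1# + t * K g g ≢ 0#
    rank1-denominator den≡0 = 0≢1 (sym (begin
      1#                ≡⟨ solve 2 (λ t k → 𝟙 := 𝟙 :+ t :* 𝟘) refl t (K g g) ⟩
      1# + t * 0#       ≡⟨ cong (λ x → 1# + t * x) (definite pd (section κ g<m)
                             (trans form-g (trans (cong (K g g *_) den≡0) (zeroʳ _))) g<m) ⟨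
      1# + t * K g g    ≡⟨ den≡0 ⟩
      0#                ∎))

    -- Sherman–Morrison
    rank1-kernel : Kernel (bump c g t) (rank1 K g t)
    rank1-kernel = record { section = sec ; symm = sy ; repro = re }
      where
      r = (1# + t * K g g) ⁻¹
      den*r : (1# + t * K g g) * r ≡ 1#
      den*r = *-inverseʳ _ rank1-denominator

      eq : ∀ e f → rank1 K g t e f ≡ 1# * K e f + - (t * r * K f g) * K e g
      eq e f = solve 5 (λ k t r x y → k :- t :* r :* (x :* y) := 𝟙 :* k :+ :- (t :* r :* y) :* x) refl
                 (K e f) t r (K e g) (K f g)

      sec : ∀ {f} → f ℕ.< m → W (λ e → rank1 K g t e f)
      sec {f} f<m = W-≗ (λ e → sym (eq e f)) (W-comb 1# (- (t * r * K f g)) (section κ f<m) (section κ g<m))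

      sy : ∀ {e f} → e ℕ.< m → f ℕ.< m → rank1 K g t e f ≡ rank1 K g t f e
      sy {e} {f} e<m f<m = cong₂ (λ x y → x - t * r * y) (symm κ e<m f<m) (*-comm _ _)

      re : ∀ {h} → W h → ∀ {f} → f ℕ.< m → form (bump c g t) h (λ e → rank1 K g t e f) ≡ h f
      re {h} wh {f} f<m = begin
        form (bump c g t) h (λ e → rank1 K g t e f)
          ≡⟨ form-bump c t g<m h _ ⟩
        form c h (λ e → rank1 K g t e f) + t * (h g * rank1 K g t g f)
          ≡⟨ cong (_+ t * (h g * rank1 K g t g f)) linʳ ⟩
        form c h (λ e → K e f) + - (t * r * K f g) * form c h (λ e → K e g) + t * (h g * rank1 K g t g f)
          ≡⟨ cong₂ (λ x y → x + - (t * r * K f g) * y + t * (h g * rank1 K g t g f))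
               (repro κ wh f<m) (repro κ wh g<m) ⟩
        h f + - (t * r * K f g) * h g + t * (h g * (K g f - t * r * (K g g * K f g)))
          ≡⟨ cong (λ x → h f + - (t * r * K f g) * h g + t * (h g * (x - t * r * (K g g * K f g))))
               (symm κ g<m f<m) ⟩
        h f + - (t * r * K f g) * h g + t * (h g * (K f g - t * r * (K g g * K f g)))
          ≡⟨ solve 6 (λ x t r k y d → x :+ :- (t :* r :* k) :* y :+ t :* (y :* (k :- t :* r :* (d :* k)))
               := x :+ t :* k :* y :* (𝟙 :- (𝟙 :+ t :* d) :* r)) refl (h f) t r (K f g) (h g) (K g g) ⟩
        h f + t * K f g * h g * (1# - (1# + t * K g g) * r)
          ≡⟨ cong (λ x → h f + t * K f g * h g * (1# - x)) den*r ⟩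
        h f + t * K f g * h g * (1# - 1#)
          ≡⟨ solve 2 (λ x y → x :+ y :* (𝟙 :- 𝟙) := x) refl (h f) (t * K f g * h g) ⟩
        h f ∎
        where
        linʳ : form c h (λ e → rank1 K g t e f)
               ≡ form c h (λ e → K e f) + - (t * r * K f g) * form c h (λ e → K e g)
        linʳ = trans (∑-cong m λ {e} _ → solve 7 (λ c h k t r x y →
            c :* (h :* (k :- t :* r :* (x :* y))) := c :* (h :* k) :+ :- (t :* r :* y) :* (c :* (h :* x))) refl
            (c e) (h e) (K e f) t r (K e g) (K f g))
          (trans (∑-+ m _ _) (cong (form c h (λ e → K e f) +_) (∑-* m _ _)))

  -- For the kernel of u w - s this is the trace of M L_G, where M = (u L_G - A)⁺.
  Φ : (ℕ → ℕ → Carrier) → Carrier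
  Φ K = ∑< m λ e → w e * K e e

  -- In the same notation this is b_gᵀ M L_G M b_g. Its weighted sum `T` is the trace of (M L_G)²,
  -- minus the derivative of the potential in u.
  S² : (ℕ → ℕ → Carrier) → ℕ → Carrier
  S² K g = ∑< m λ e → w e * (K e g * K e g)

  T : (ℕ → ℕ → Carrier) → Carrier
  T K = ∑< m λ g → w g * S² K g

  Φ-rank1 : ∀ K g t → Φ (rank1 K g t) ≡ Φ K - t / (1# + t * K g g) * S² K g
  Φ-rank1 K g t = begin
    ∑< m (λ e → w e * (K e e - a * (K e g * K e g)))
      ≡⟨ ∑-cong m (λ {e} _ → solve 4 (λ w k a x → w :* (k :- a :* x) := w :* k :+ :- a :* (w :* x)) refl
           (w e) (K e e) a (K e g * K e g)) ⟩
    ∑< m (λ e → w e * K e e + - a * (w e * (K e g * K e g)))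
      ≡⟨ trans (∑-+ m _ _) (cong (Φ K +_) (∑-* m _ _)) ⟩
    Φ K + - a * S² K g
      ≡⟨ solve 3 (λ p a s → p :+ :- a :* s := p :- a :* s) refl (Φ K) a (S² K g) ⟩
    Φ K - a * S² K g ∎
    where a = t / (1# + t * K g g)

  S²-pos : ∀ {c K} → Kernel c K → PosDef c → ∀ {g} → g ℕ.< m → 0# < S² K g
  S²-pos {c} {K} κ pd {g} g<m = <-≤-trans
    (*-pos (w-pos g<m) (*-pos (diag-pos κ pd g<m) (diag-pos κ pd g<m)))
    (term≤∑ m (λ {e} e<m → *-nonneg (proj₁ (w-pos e<m)) (square-nonneg (K e g))) g<m)

  T-pos : ∀ {c K} → Kernel c K → PosDef c → 0 ℕ.< m → 0# < T K
  T-pos κ pd 0<m = <-≤-trans (*-pos (w-pos 0<m) (S²-pos κ pd 0<m))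
    (term≤∑ m (λ e<m → proj₁ (*-pos (w-pos e<m) (S²-pos κ pd e<m))) 0<m)

-- Raising the barriers and choosing an edge.

module Barriers (ℝ : Reals) (S : Summation.Space ℝ) where

  open Reals ℝ
  open OrderedField ℝ
  open Summation ℝ
  open Kernels ℝ S
  open ≡-Reasoning

  -- Expand the nonnegative value of form c at K′_f + b K_f, and sum over f with weights w.
  gap : ∀ {c c′ K K′ a} → Kernel c K → PosDef c → Kernel c′ K′ →
        (∀ {e} → e ℕ.< m → c′ e ≡ c e + a * w e) →
        ∀ b → 0# ≤ (1# + b + b) * Φ K′ - a * T K′ + b * b * Φ K
  gap {c} {c′} {K} {K′} {a} κ pd κ′ c′≡ b = subst (0# ≤_) total-eq
      (∑-nonneg m λ f<m → *-nonneg (proj₁ (w-pos f<m))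
        (nonneg pd (W-comb 1# b (section κ′ f<m) (section κ f<m))))
    where
    Q : ℕ → Carrier
    Q f = form c (λ e → 1# * K′ e f + b * K e f) (λ e → 1# * K′ e f + b * K e f)

    Q-eq : ∀ {f} → f ℕ.< m → Q f ≡ (1# + b + b) * K′ f f - a * S² K′ f + b * b * K f f
    Q-eq {f} f<m = begin
      Q f
        ≡⟨ form-comb c 1# b (λ e → K′ e f) (λ e → K e f) ⟩
      1# * 1# * F + (1# * b + 1# * b) * form c (λ e → K′ e f) (λ e → K e f)
        + b * b * form c (λ e → K e f) (λ e → K e f)
        ≡⟨ cong₂ (λ x y → 1# * 1# * F + (1# * b + 1# * b) * x + b * b * y)
             (repro κ (section κ′ f<m) f<m) (form-diag κ f<m) ⟩
      1# * 1# * F + (1# * b + 1# * b) * K′ f f + b * b * K f f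
        ≡⟨ solve 6 (λ F b k′ k a s → 𝟙 :* 𝟙 :* F :+ (𝟙 :* b :+ 𝟙 :* b) :* k′ :+ b :* b :* k
             := (F :+ a :* s) :+ (b :+ b) :* k′ :- a :* s :+ b :* b :* k) refl
             F b (K′ f f) (K f f) a (S² K′ f) ⟩
      (F + a * S² K′ f) + (b + b) * K′ f f - a * S² K′ f + b * b * K f f
        -- By `form-shift`, `F + a * S² K′ f` is the value of `form c′` at its own section K′_f,
        -- which is K′_ff.
        ≡⟨ cong (λ x → x + (b + b) * K′ f f - a * S² K′ f + b * b * K f f)
             (trans (sym (form-shift a c′≡ _ _)) (form-diag κ′ f<m)) ⟩
      K′ f f + (b + b) * K′ f f - a * S² K′ f + b * b * K f f
        ≡⟨ solve 4 (λ b k′ y z → k′ :+ (b :+ b) :* k′ :- y :+ z := (𝟙 :+ b :+ b) :* k′ :- y :+ z) refl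
             b (K′ f f) (a * S² K′ f) (b * b * K f f) ⟩
      (1# + b + b) * K′ f f - a * S² K′ f + b * b * K f f ∎
      where F = form c (λ e → K′ e f) (λ e → K′ e f)

    total-eq : ∑< m (λ f → w f * Q f) ≡ (1# + b + b) * Φ K′ - a * T K′ + b * b * Φ K
    total-eq = begin
      ∑< m (λ f → w f * Q f)
        ≡⟨ ∑-cong m (λ {f} f<m → trans (cong (w f *_) (Q-eq f<m))
             (solve 7 (λ w p k′ a s q k → w :* (p :* k′ :- a :* s :+ q :* k)
               := p :* (w :* k′) :+ (:- a :* (w :* s) :+ q :* (w :* k))) refl
               (w f) (1# + b + b) (K′ f f) a (S² K′ f) (b * b) (K f f))) ⟩
      ∑< m (λ f → (1# + b + b) * (w f * K′ f f) + (- a * (w f * S² K′ f) + b * b * (w f * K f f)))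
        ≡⟨ trans (∑-+ m _ _) (cong₂ _+_ (∑-* m _ _)
             (trans (∑-+ m _ _) (cong₂ _+_ (∑-* m _ _) (∑-* m _ _)))) ⟩
      (1# + b + b) * Φ K′ + (- a * T K′ + b * b * Φ K)
        ≡⟨ solve 4 (λ x a t z → x :+ (:- a :* t :+ z) := x :- a :* t :+ z) refl
             ((1# + b + b) * Φ K′) a (T K′) (b * b * Φ K) ⟩
      (1# + b + b) * Φ K′ - a * T K′ + b * b * Φ K ∎

  -- The case b = -1 of `gap`. It plays the part of convexity: a tangent inequality for the
  -- potential, whose derivative at the new barrier is `- T K′`.
  Φ-decrease : ∀ {c c′ K K′ a} → Kernel c K → PosDef c → Kernel c′ K′ →
               (∀ {e} → e ℕ.< m → c′ e ≡ c e + a * w e) → a * T K′ ≤ Φ K - Φ K′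
  Φ-decrease {K = K} {K′} {a} κ pd κ′ c′≡ = 0≤-⇒≤ (subst (0# ≤_)
    (solve 4 (λ a p p′ t → (𝟙 :+ :- 𝟙 :+ :- 𝟙) :* p′ :- a :* t :+ :- 𝟙 :* :- 𝟙 :* p := p :- p′ :- a :* t)
      refl a (Φ K) (Φ K′) (T K′))
    (gap κ pd κ′ c′≡ (- 1#)))

  -- The case b = -(1 + Δ) of `gap`, where Δ = Φ K′ - Φ K; this is the minimiser of the quadratic in
  -- b when Φ K = 1. For smaller Φ K the slack is Δ² (1 - Φ K), which is added back.
  T-lower : ∀ {c c′ K K′} → Kernel c K → PosDef c → Kernel c′ K′ →
            (∀ {e} → e ℕ.< m → c′ e ≡ c e + - 1# * w e) → Φ K ≤ 1# →
            (Φ K′ - Φ K) * (1# + (Φ K′ - Φ K)) ≤ T K′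
  T-lower {K = K} {K′} κ pd κ′ c′≡ Φ≤1 = 0≤-⇒≤ (subst (0# ≤_)
    (solve 3 (λ p p′ t → let Δ = p′ :- p; b = :- (𝟙 :+ Δ) in
        (𝟙 :+ b :+ b) :* p′ :- :- 𝟙 :* t :+ b :* b :* p :+ Δ :* Δ :* (𝟙 :- p)
        := t :- Δ :* (𝟙 :+ Δ)) refl (Φ K) (Φ K′) (T K′))
    (0≤+ (gap κ pd κ′ c′≡ (- (1# + Δ))) (*-nonneg (square-nonneg Δ) (≤⇒0≤- Φ≤1))))
    where Δ = Φ K′ - Φ K

  -- Summing `cauchySchwarz` over the edges bounds `form w` by `Φ K` times `form c`. Hence a
  -- potential below 1 leaves room for the lower barrier to rise by a whole unit.
  posDef-lower : ∀ {c c′ K} → Kernel c K → PosDef c →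
                 (∀ {e} → e ℕ.< m → c′ e ≡ c e + - 1# * w e) → Φ K < 1# → PosDef c′
  posDef-lower {c} {c′} {K} κ pd c′≡ Φ<1 = posDef-≥ (<⇒0<- Φ<1) dom pd
    where
    dom : ∀ {h} → W h → (1# - Φ K) * form c h h ≤ form c′ h h
    dom {h} wh = ≤-by (≤⇒0≤- bound) (trans (form-shift (- 1#) c′≡ h h)
      (solve 3 (λ x p y → x :+ :- 𝟙 :* y := (𝟙 :- p) :* x :+ (p :* x :- y)) refl
        (form c h h) (Φ K) (form w h h)))
      where
      bound : form w h h ≤ Φ K * form c h h
      bound = subst (form w h h ≤_)
        (trans (∑-cong m λ {e} _ → solve 3 (λ w k f → w :* (k :* f) := f :* (w :* k)) refl
                 (w e) (K e e) (form c h h))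
          (trans (∑-* m _ _) (*-comm _ _)))
        (∑-mono m λ e<m → *-monoˡ-≤ (proj₁ (w-pos e<m)) (cauchySchwarz κ pd wh e<m))

  private
    1+neg*k : ∀ {t s k} → t * (s + k) ≡ 1# → 1# + (0# - t) * k ≡ t * s
    1+neg*k {t} {s} {k} eq = trans (cong (_+ (0# - t) * k) (sym eq))
      (solve 3 (λ t s k → t :* (s :+ k) :+ (𝟘 :- t) :* k := t :* s) refl t s k)

    exchange : ∀ {f t x k} → f + (0# - t) * x ≡ (1# + (0# - t) * k) * f + t * (k * f - x)
    exchange {f} {t} {x} {k} = solve 4 (λ f t x k →
      f :+ (𝟘 :- t) :* x := (𝟙 :+ (𝟘 :- t) :* k) :* f :+ t :* (k :* f :- x)) refl f t x k

    -- With t the reciprocal of s / f + k the denominator becomes t s / f, so the rank-one change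
    -- adds exactly f, all that was gained by raising u.
    upper-step : ∀ {p q t s k r} → let f = q - p in
                 f ≢ 0# → 1# + (0# - t) * k ≡ t * (s / f) → (1# + (0# - t) * k) * r ≡ 1# →
                 p - (0# - t) * r * s ≡ q
    upper-step {p} {q} {t} {s} {k} {r} f≢0 den≡ den*r≡1 = begin
      p - (0# - t) * r * s
        ≡⟨ solve 4 (λ p t r s → p :- (𝟘 :- t) :* r :* s := p :+ t :* s :* r :* 𝟙) refl p t r s ⟩
      p + t * s * r * 1#                   ≡⟨ cong (λ x → p + t * s * r * x) (*-inverseʳ f f≢0) ⟨
      p + t * s * r * (f * f ⁻¹)
        ≡⟨ solve 6 (λ p t s f i r → p :+ t :* s :* r :* (f :* i) := p :+ f :* (t :* (s :* i) :* r)) refl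
             p t s f (f ⁻¹) r ⟩
      p + f * (t * (s / f) * r)            ≡⟨ cong (λ x → p + f * (x * r)) den≡ ⟨
      p + f * ((1# + (0# - t) * k) * r)    ≡⟨ cong (λ x → p + f * x) den*r≡1 ⟩
      p + f * 1#                           ≡⟨ solve 2 (λ p q → p :+ (q :- p) :* 𝟙 := q) refl p q ⟩
      q                                    ∎
      where f = q - p

    -- The decrease t s / (1 + t k) makes up for f as soon as 1/t + k ≤ s / f, and 1/t is `u`.
    lower-step : ∀ {p q t s k} → let f = p - q in
                 0# < f → 0# < t → 0# < 1# + t * k →
                 ∀ {u} → t * u ≡ 1# → u ≤ s / f - k → p - t / (1# + t * k) * s ≤ q
    lower-step {p} {q} {t} {s} {k} 0<f 0<t 0<den {u} tu≡1 u≤ =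
      ≤-by (≤⇒0≤- f≤) (solve 3 (λ p q x → q := p :- x :+ (x :- (p :- q))) refl p q (t / den * s))
      where
      f   = p - q
      den = 1# + t * k
      den≤ : den ≤ t * (s / f)
      den≤ = ≤-by (*-nonneg (proj₁ 0<t) (≤⇒0≤- u≤))
        (trans (solve 4 (λ t x k u → t :* x := t :* u :+ t :* k :+ t :* (x :- k :- u)) refl t (s / f) k u)
          (cong (λ x → x + t * k + t * (s / f - k - u)) tu≡1))
      cancel : ∀ {x y} → x ≢ 0# → x * x ⁻¹ * y ≡ y
      cancel x≢0 = trans (cong (_* _) (*-inverseʳ _ x≢0)) (*-identityˡ _)
      f≤ : f ≤ t / den * s
      f≤ = subst₂ _≤_
        (trans (solve 3 (λ d f r → d :* (f :* r) := d :* r :* f) refl den f (den ⁻¹)) (cancel (>⇒≢ 0<den)))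
        (trans (solve 5 (λ t s i f r → t :* (s :* i) :* (f :* r) := f :* i :* (t :* r :* s)) refl
          t s (f ⁻¹) f (den ⁻¹)) (cancel (>⇒≢ 0<f)))
        (*-monoʳ-≤ (proj₁ (*-pos 0<f (⁻¹-pos 0<den))) den≤)

  -- The subscript 0 marks the state before raising. In `budget` the left side bounds the weighted
  -- sum of `U` from above, and the right side bounds that of `L` from below.
  record Shifted (K₀ K J₀ J : ℕ → ℕ → Carrier) : Set where
    field
      {a}           : Carrier
      {c₀ c b₀ b}   : ℕ → Carrier
      c≡            : ∀ {e} → e ℕ.< m → c e ≡ c₀ e + a * w e
      b≡            : ∀ {e} → e ℕ.< m → b e ≡ b₀ e + - 1# * w e
      κ₀            : Kernel c₀ K₀
      κ             : Kernel c K
      ι₀            : Kernel b₀ J₀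
      ι             : Kernel b J
      pd-c₀         : PosDef c₀
      pd-c          : PosDef c
      pd-b₀         : PosDef b₀
      pd-b          : PosDef b
      0<m           : 0 ℕ.< m
      0<a           : 0# < a
      ΦJ₀≤1         : Φ J₀ ≤ 1#
      budget        : a ⁻¹ + Φ K₀ ≤ 1# - Φ J₀

  module Choice {K₀ K J₀ J} (sh : Shifted K₀ K J₀ J) where

    open Shifted sh

    fu fl : Carrier
    fu = Φ K₀ - Φ K
    fl = Φ J - Φ J₀

    -- Thresholds for 1/t when weight t goes onto g: the upper potential is restored if 1/t is at
    -- least `U g`, the lower one if 1/t is at most `L g`.
    U L : ℕ → Carrier
    U g = S² K g / fu + K g g
    L g = S² J g / fl - J g g

    aT≤fu : a * T K ≤ fu
    aT≤fu = Φ-decrease κ₀ pd-c₀ κ c≡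

    fu-pos : 0# < fu
    fu-pos = <-≤-trans (*-pos 0<a (T-pos κ pd-c 0<m)) aT≤fu

    fl-pos : 0# < fl
    -- `Φ-decrease` is applied backwards: `J₀` arises from `J` by adding `w`, so `fl` is at least
    -- `T J₀`.
    fl-pos = <-≤-trans (*-pos 0<1 (T-pos ι₀ pd-b₀ 0<m)) (Φ-decrease {a = 1#} ι pd-b ι₀ λ {e} e<m →
      trans (solve 2 (λ b w → b := b :+ :- 𝟙 :* w :+ 𝟙 :* w) refl (b₀ e) (w e))
        (cong (_+ 1# * w e) (sym (b≡ e<m))))

    sum-U : ∑< m (λ g → w g * U g) ≡ T K * fu ⁻¹ + Φ K
    sum-U = trans (∑-cong m λ {g} _ → solve 4 (λ w s i k → w :* (s :* i :+ k) := i :* (w :* s) :+ w :* k) refl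
        (w g) (S² K g) (fu ⁻¹) (K g g))
      (trans (∑-+ m _ _) (cong (_+ Φ K) (trans (∑-* m _ _) (*-comm _ _))))

    sum-L : ∑< m (λ g → w g * L g) ≡ T J * fl ⁻¹ - Φ J
    sum-L = trans (∑-cong m λ {g} _ → solve 4 (λ w s i k → w :* (s :* i :- k) := i :* (w :* s) :+ :- 𝟙 :* (w :* k)) refl
        (w g) (S² J g) (fl ⁻¹) (J g g))
      (trans (∑-+ m _ _) (trans (cong₂ _+_ (trans (∑-* m _ _) (*-comm _ _)) (∑-* m _ _))
        (solve 2 (λ x y → x :+ :- 𝟙 :* y := x :- y) refl (T J * fl ⁻¹) (Φ J))))

    -- On the upper side `aT≤fu` turns the quotient into at most `a ⁻¹`. On the lower side `T-lower`
    -- turns it into at least 1 + fl, and this `fl` cancels the growth of `Φ J` over `Φ J₀`.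
    averaging : ∑< m (λ g → w g * U g) ≤ ∑< m (λ g → w g * L g)
    averaging = subst₂ _≤_ (sym sum-U) (sym sum-L) (≤-trans upper (≤-trans budget lower))
      where
      Tfu⁻¹≤a⁻¹ : T K * fu ⁻¹ ≤ a ⁻¹
      Tfu⁻¹≤a⁻¹ = *-cancelˡ-≤ 0<a (subst₂ _≤_ (*-assoc _ _ _)
        (trans (*-inverseʳ fu (>⇒≢ fu-pos)) (sym (*-inverseʳ a (>⇒≢ 0<a))))
        (*-monoʳ-≤ (proj₁ (⁻¹-pos fu-pos)) aT≤fu))
      upper : T K * fu ⁻¹ + Φ K ≤ a ⁻¹ + Φ K₀
      upper = +-mono-≤ Tfu⁻¹≤a⁻¹ (≤-by (proj₁ fu-pos)
        (solve 2 (λ x y → x := y :+ (x :- y)) refl (Φ K₀) (Φ K)))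
      1+fl≤ : 1# + fl ≤ T J * fl ⁻¹
      1+fl≤ = subst (_≤ T J * fl ⁻¹)
        (trans (solve 2 (λ f i → f :* (𝟙 :+ f) :* i := f :* i :* (𝟙 :+ f)) refl fl (fl ⁻¹))
          (trans (cong (_* (1# + fl)) (*-inverseʳ fl (>⇒≢ fl-pos))) (*-identityˡ _)))
        (*-monoʳ-≤ (proj₁ (⁻¹-pos fl-pos)) (T-lower ι₀ pd-b₀ ι b≡ ΦJ₀≤1))
      lower : 1# - Φ J₀ ≤ T J * fl ⁻¹ - Φ J
      lower = subst (_≤ T J * fl ⁻¹ - Φ J)
        (solve 2 (λ x y → 𝟙 :+ (x :- y) :- x := 𝟙 :- y) refl (Φ J) (Φ J₀))
        (+-monoˡ-≤ (- Φ J) 1+fl≤)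

    good-exists : ∃ λ g → g ℕ.< m × U g ≤ L g
    good-exists = proj₁ found , proj₁ (proj₂ found) , *-cancelˡ-≤ (w-pos (proj₁ (proj₂ found))) (proj₂ (proj₂ found))
      where
      found : ∃ λ g → g ℕ.< m × w g * U g ≤ w g * L g
      found = ∑≤∑⇒∃ m 0<m averaging

    module Good {g} (g<m : g ℕ.< m) (U≤L : U g ≤ L g) where

      S/fu-pos : 0# < S² K g / fu
      S/fu-pos = *-pos (S²-pos κ pd-c g<m) (⁻¹-pos fu-pos)

      U-pos : 0# < U g
      U-pos = <-≤-trans S/fu-pos (≤-by (proj₁ (diag-pos κ pd-c g<m)) refl)

      -- Any 1/t between `U g` and `L g` would serve; the end `U g` brings the upper potential back
      -- to exactly `Φ K₀`.
      t : Carrier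
      t = 1# / U g

      t-pos : 0# < t
      t-pos = subst (0# <_) (sym (*-identityˡ _)) (⁻¹-pos U-pos)

      tU≡1 : t * U g ≡ 1#
      tU≡1 = trans (cong (_* U g) (*-identityˡ _)) (*-inverseˡ _ (>⇒≢ U-pos))

      1-tK : 1# + (0# - t) * K g g ≡ t * (S² K g / fu)
      1-tK = 1+neg*k tU≡1

      1-tK-pos : 0# < 1# + (0# - t) * K g g
      1-tK-pos = subst (0# <_) (sym 1-tK) (*-pos t-pos S/fu-pos)

      -- By `cauchySchwarz`, removing t at g costs at most the share t K_gg of the form, and 1 - t
      -- K_gg is positive by `1-tK`.
      upper-posDef : PosDef (bump c g (0# - t))
      upper-posDef = posDef-≥ 1-tK-pos (λ {h} wh →
        ≤-by (*-nonneg (proj₁ t-pos) (≤⇒0≤- (cauchySchwarz κ pd-c wh g<m)))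
          (trans (form-bump c (0# - t) g<m h h) exchange)) pd-c

      lower-posDef : PosDef (bump b g t)
      lower-posDef = posDef-≥ 0<1 (λ {h} wh →
        ≤-by (*-nonneg (proj₁ t-pos) (square-nonneg (h g)))
          (trans (form-bump b t g<m h h) (cong (_+ t * (h g * h g)) (sym (*-identityˡ _))))) pd-b

      upper-Φ : Φ (rank1 K g (0# - t)) ≤ Φ K₀
      upper-Φ = ≤-reflexive (trans (Φ-rank1 K g (0# - t))
        (upper-step (>⇒≢ fu-pos) 1-tK (*-inverseʳ _ (>⇒≢ 1-tK-pos))))

      lower-Φ : Φ (rank1 J g t) ≤ Φ J₀
      lower-Φ = subst (_≤ Φ J₀) (sym (Φ-rank1 J g t))
        (lower-step fl-pos t-pos
          (<-≤-trans 0<1 (≤-by (*-nonneg (proj₁ t-pos) (proj₁ (diag-pos ι pd-b g<m))) refl)) tU≡1 U≤L)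

-- The program.

module Program where

  private
    variable
      Γ : Ctx
      σ τ α β γ θ : Ty

  -- A superscript b marks the body of a function, a superscript t the function itself.

  v0 : τ ∷ Γ ⊢ τ
  v0 = var (here refl)
  v1 : α ∷ τ ∷ Γ ⊢ τ
  v1 = var (there (here refl))
  v2 : α ∷ β ∷ τ ∷ Γ ⊢ τ
  v2 = var (there (there (here refl)))
  v3 : α ∷ β ∷ γ ∷ τ ∷ Γ ⊢ τ
  v3 = var (there (there (there (here refl))))
  v4 : ∀ {a b c d} → a ∷ b ∷ c ∷ d ∷ τ ∷ Γ ⊢ τ
  v4 = var (there (there (there (there (here refl)))))
  v5 : ∀ {a b c d e} → a ∷ b ∷ c ∷ d ∷ e ∷ τ ∷ Γ ⊢ τ
  v5 = var (there (there (there (there (there (here refl))))))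
  v6 : ∀ {a b c d e f} → a ∷ b ∷ c ∷ d ∷ e ∷ f ∷ τ ∷ Γ ⊢ τ
  v6 = var (there (there (there (there (there (there (here refl)))))))
  v7 : ∀ {a b c d e f g} → a ∷ b ∷ c ∷ d ∷ e ∷ f ∷ g ∷ τ ∷ Γ ⊢ τ
  v7 = var (there (there (there (there (there (there (there (here refl))))))))
  v8 : ∀ {a b c d e f g h} → a ∷ b ∷ c ∷ d ∷ e ∷ f ∷ g ∷ h ∷ τ ∷ Γ ⊢ τ
  v8 = var (there (there (there (there (there (there (there (there (here refl)))))))))
  v9 : ∀ {a b c d e f g h i} → a ∷ b ∷ c ∷ d ∷ e ∷ f ∷ g ∷ h ∷ i ∷ τ ∷ Γ ⊢ τ
  v9 = var (there (there (there (there (there (there (there (there (there (here refl))))))))))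

  vec mat state : Ty
  vec   = list real
  mat   = list vec
  state = mat ⊗ mat ⊗ vec

  app₂ : Γ ⊢ α ⇒ β ⇒ τ → Γ ⊢ α → Γ ⊢ β → Γ ⊢ τ
  app₂ t a b = app (app t a) b
  app₃ : Γ ⊢ α ⇒ β ⇒ γ ⇒ τ → Γ ⊢ α → Γ ⊢ β → Γ ⊢ γ → Γ ⊢ τ
  app₃ t a b c = app (app₂ t a b) c
  app₄ : Γ ⊢ α ⇒ β ⇒ γ ⇒ θ ⇒ τ → Γ ⊢ α → Γ ⊢ β → Γ ⊢ γ → Γ ⊢ θ → Γ ⊢ τ
  app₄ t a b c d = app (app₃ t a b c) d

  lengthᵗ : Γ ⊢ list σ → Γ ⊢ nat
  lengthᵗ = listrec zero (suc v0)

  -- Positions in a list are counted from its end, so that consing leaves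
  -- them unchanged.
  atᵇ : nat ∷ list σ ∷ σ ∷ Γ ⊢ σ
  atᵇ = listrec v2 (if (leqℕ (lengthᵗ v2) v3) v1 v0) v1

  nth : Γ ⊢ σ → Γ ⊢ list σ → Γ ⊢ nat → Γ ⊢ σ
  nth = app₃ (lam (lam (lam atᵇ)))

  entry : Γ ⊢ mat → Γ ⊢ nat → Γ ⊢ nat → Γ ⊢ real
  entry X i j = nth zeroᴿ (nth nil X i) j

  edgeᵗ : Γ ⊢ list edgeTy → Γ ⊢ nat → Γ ⊢ edgeTy
  edgeᵗ = nth (pair (pair zero zero) zeroᴿ)

  tail head : Γ ⊢ edgeTy → Γ ⊢ nat
  tail e = fst (fst e)
  head e = snd (fst e)

  weight : Γ ⊢ edgeTy → Γ ⊢ real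
  weight = snd

  -- The largest index is consed last, so with positions counted from the end, position k holds the
  -- value of `b` at k.
  tab : Γ ⊢ nat → list σ ∷ nat ∷ Γ ⊢ σ → Γ ⊢ list σ
  tab n b = natrec nil (cons b v0) n

  sumᵗ : Γ ⊢ nat → real ∷ nat ∷ Γ ⊢ real → Γ ⊢ real
  sumᵗ n b = natrec zeroᴿ (add b v0) n

  deltaᵇ : nat ∷ nat ∷ Γ ⊢ real
  deltaᵇ = if (leqℕ v1 v0) (if (leqℕ v0 v1) one zeroᴿ) zeroᴿ

  delta : Γ ⊢ nat → Γ ⊢ nat → Γ ⊢ real
  delta = app₂ (lam (lam deltaᵇ))

  realᵗ : Γ ⊢ nat → Γ ⊢ real
  realᵗ = natrec zeroᴿ (add one v0)

  -- b_eᵀ X b_f, where b_e is the signed indicator of the edge e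
  kerᵇ : edgeTy ∷ edgeTy ∷ mat ∷ Γ ⊢ real
  kerᵇ = sub (sub (entry v2 (tail v1) (tail v0)) (entry v2 (tail v1) (head v0)))
             (sub (entry v2 (head v1) (tail v0)) (entry v2 (head v1) (head v0)))

  kerᵗ : Γ ⊢ mat → Γ ⊢ edgeTy → Γ ⊢ edgeTy → Γ ⊢ real
  kerᵗ = app₃ (lam (lam (lam kerᵇ)))

  -- The vector X b_e and the scalar coefficient are shared through `let′`, so each of the n²
  -- entries costs a constant.
  rank1ᵇ : edgeTy ∷ real ∷ mat ∷ nat ∷ Γ ⊢ mat
  rank1ᵇ =
    let′ (tab v3 (sub (entry v4 v1 (tail v2)) (entry v4 v1 (head v2))))
    (let′ (div v2 (add one (mul v2 (sub (nth zeroᴿ v0 (tail v1)) (nth zeroᴿ v0 (head v1))))))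
    (tab v5 (tab v7 (sub (entry v8 v3 v1) (mul v4 (mul (nth zeroᴿ v5 v3) (nth zeroᴿ v5 v1)))))))

  rank1ᵗ : Γ ⊢ nat → Γ ⊢ mat → Γ ⊢ real → Γ ⊢ edgeTy → Γ ⊢ mat
  rank1ᵗ = app₄ (lam (lam (lam (lam rank1ᵇ))))

  shiftᵇ : mat ∷ real ∷ list edgeTy ∷ nat ∷ Γ ⊢ mat
  shiftᵇ = natrec v0 (rank1ᵗ v5 v0 (mul v3 (weight (edgeᵗ v4 v1))) (edgeᵗ v4 v1)) (lengthᵗ v2)

  shiftᵗ : Γ ⊢ nat → Γ ⊢ list edgeTy → Γ ⊢ real → Γ ⊢ mat → Γ ⊢ mat
  shiftᵗ = app₄ (lam (lam (lam (lam shiftᵇ))))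

  Φᵇ : mat ∷ list edgeTy ∷ Γ ⊢ real
  Φᵇ = sumᵗ (lengthᵗ v1) (mul (weight (edgeᵗ v3 v1)) (kerᵗ v2 (edgeᵗ v3 v1) (edgeᵗ v3 v1)))

  Φᵗ : Γ ⊢ list edgeTy → Γ ⊢ mat → Γ ⊢ real
  Φᵗ = app₂ (lam (lam Φᵇ))

  S²ᵇ : edgeTy ∷ mat ∷ list edgeTy ∷ Γ ⊢ real
  S²ᵇ = sumᵗ (lengthᵗ v2) (mul (weight (edgeᵗ v4 v1))
          (mul (kerᵗ v3 (edgeᵗ v4 v1) v2) (kerᵗ v3 (edgeᵗ v4 v1) v2)))

  S²ᵗ : Γ ⊢ list edgeTy → Γ ⊢ mat → Γ ⊢ edgeTy → Γ ⊢ real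
  S²ᵗ = app₃ (lam (lam (lam S²ᵇ)))

  Uᵇ Lᵇ : edgeTy ∷ real ∷ mat ∷ list edgeTy ∷ Γ ⊢ real
  Uᵇ = add (div (S²ᵗ v3 v2 v0) v1) (kerᵗ v2 v0 v0)
  Lᵇ = sub (div (S²ᵗ v3 v2 v0) v1) (kerᵗ v2 v0 v0)

  Uᵗ Lᵗ : Γ ⊢ list edgeTy → Γ ⊢ mat → Γ ⊢ real → Γ ⊢ edgeTy → Γ ⊢ real
  Uᵗ = app₄ (lam (lam (lam (lam Uᵇ))))
  Lᵗ = app₄ (lam (lam (lam (lam Lᵇ))))

  chooseᵇ : real ∷ real ∷ mat ∷ mat ∷ state ∷ real ∷ list edgeTy ∷ nat ∷ Γ ⊢ nat
  chooseᵇ = natrec zero (if (leq (Uᵗ v8 v5 v3 (edgeᵗ v8 v1)) (Lᵗ v8 v4 v2 (edgeᵗ v8 v1))) v1 v0) (lengthᵗ v6)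

  bumpᵇ : real ∷ nat ∷ real ∷ real ∷ mat ∷ mat ∷ state ∷ real ∷ list edgeTy ∷ nat ∷ Γ ⊢ vec
  bumpᵇ = tab (lengthᵗ v8) (add (nth zeroᴿ (snd (snd v8)) v1) (mul v2 (delta v3 v1)))

  moveᵇ : real ∷ nat ∷ real ∷ real ∷ mat ∷ mat ∷ state ∷ real ∷ list edgeTy ∷ nat ∷ Γ ⊢ state
  moveᵇ =
    pair (rank1ᵗ v9 v5 (sub zeroᴿ v0) (edgeᵗ v8 v1))
    (pair (rank1ᵗ v9 v4 v0 (edgeᵗ v8 v1))
          bumpᵇ)

  -- The state holds the matrices of the two kernels and the weights chosen so far.
  raisedᵇ : state ∷ real ∷ list edgeTy ∷ nat ∷ Γ ⊢ mat
  raisedᵇ = shiftᵗ v3 v2 v1 (fst v0)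

  loweredᵇ : mat ∷ state ∷ real ∷ list edgeTy ∷ nat ∷ Γ ⊢ mat
  loweredᵇ = shiftᵗ v4 v3 (sub zeroᴿ one) (fst (snd v1))

  upperGapᵇ : mat ∷ mat ∷ state ∷ real ∷ list edgeTy ∷ nat ∷ Γ ⊢ real
  upperGapᵇ = sub (Φᵗ v4 (fst v2)) (Φᵗ v4 v1)

  lowerGapᵇ : real ∷ mat ∷ mat ∷ state ∷ real ∷ list edgeTy ∷ nat ∷ Γ ⊢ real
  lowerGapᵇ = sub (Φᵗ v5 v1) (Φᵗ v5 (fst (snd v3)))

  amountᵇ : nat ∷ real ∷ real ∷ mat ∷ mat ∷ state ∷ real ∷ list edgeTy ∷ nat ∷ Γ ⊢ real
  amountᵇ = div one (Uᵗ v7 v4 v2 (edgeᵗ v7 v0))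

  stepᵇ : state ∷ real ∷ list edgeTy ∷ nat ∷ Γ ⊢ state
  stepᵇ = let′ raisedᵇ (let′ loweredᵇ (let′ upperGapᵇ (let′ lowerGapᵇ (let′ chooseᵇ (let′ amountᵇ moveᵇ)))))

  stepᵗ : Γ ⊢ nat → Γ ⊢ list edgeTy → Γ ⊢ real → Γ ⊢ state → Γ ⊢ state
  stepᵗ = app₄ (lam (lam (lam (lam stepᵇ))))

  -- The vector e_k - X L_G e_k, the part of the k-th unit vector orthogonal to the range of the
  -- projection X L_G.
  residualᵇ : mat ∷ nat ∷ list edgeTy ∷ nat ∷ Γ ⊢ vec
  residualᵇ = tab v3 (sub (delta v3 v1) (sumᵗ (lengthᵗ v4) (mul (weight (edgeᵗ v6 v1))
    (mul (sub (delta v5 (tail (edgeᵗ v6 v1))) (delta v5 (head (edgeᵗ v6 v1))))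
         (sub (entry v4 v3 (tail (edgeᵗ v6 v1))) (entry v4 v3 (head (edgeᵗ v6 v1))))))))

  normᵇ : vec ∷ mat ∷ nat ∷ list edgeTy ∷ nat ∷ Γ ⊢ real
  normᵇ = sumᵗ (lengthᵗ v3) (mul (weight (edgeᵗ v5 v1))
    (mul (sub (nth zeroᴿ v2 (tail (edgeᵗ v5 v1))) (nth zeroᴿ v2 (head (edgeᵗ v5 v1))))
         (sub (nth zeroᴿ v2 (tail (edgeᵗ v5 v1))) (nth zeroᴿ v2 (head (edgeᵗ v5 v1))))))

  -- The norm is nonnegative, so the test detects zero. In that case the unit vector already lies in
  -- the span up to a vector constant on components, and X is kept.
  extendᵇ : real ∷ vec ∷ mat ∷ nat ∷ list edgeTy ∷ nat ∷ Γ ⊢ mat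
  extendᵇ = if (leq v0 zeroᴿ) v2
    (tab v5 (tab v7 (add (entry v6 v3 v1) (div (mul (nth zeroᴿ v5 v3) (nth zeroᴿ v5 v1)) v4))))

  -- One step of Gram–Schmidt on the unit vectors, for the Laplacian form.
  orthoᵇ : mat ∷ nat ∷ list edgeTy ∷ nat ∷ Γ ⊢ mat
  orthoᵇ = let′ residualᵇ (let′ normᵇ extendᵇ)

  gramᵇ : list edgeTy ∷ nat ∷ Γ ⊢ mat
  -- The last `natrec` returns its index and so computes the predecessor of n. Constants have no
  -- potential differences, hence one unit vector can be left out; this is the origin of n - 1.
  gramᵇ = natrec (tab v1 (tab v3 zeroᴿ)) (app₄ (lam (lam (lam (lam orthoᵇ)))) v3 v2 v1 v0) (natrec zero v1 v1)

  scaleᵇ : mat ∷ real ∷ nat ∷ Γ ⊢ mat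
  scaleᵇ = tab v2 (tab v4 (mul v5 (entry v4 v3 v1)))

  scaleᵗ : Γ ⊢ nat → Γ ⊢ real → Γ ⊢ mat → Γ ⊢ mat
  scaleᵗ = app₃ (lam (lam (lam scaleᵇ)))

  -- min(m, ⌈D⌉), carried together with its image in the reals
  ceilᵇ : list edgeTy ∷ real ∷ Γ ⊢ nat
  ceilᵇ = fst (natrec (pair zero zeroᴿ) (if (leq v3 (snd v0)) v0 (pair (suc (fst v0)) (add one (snd v0)))) (lengthᵗ v0))

  -- The length of the remaining list is the position of the current edge, as positions are counted
  -- from the end.
  pickᵇ : list edgeTy ∷ vec ∷ real ∷ Γ ⊢ list edgeTy
  pickᵇ = listrec nil (if (leq (nth zeroᴿ v4 (lengthᵗ v2)) zeroᴿ) v0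
                         (cons (pair (fst v1) (div (nth zeroᴿ v4 (lengthᵗ v2)) v5)) v0)) v0

  -- The initial kernels are those of N s a w and N s w, for the barriers u = N s a and l = - N s
  -- with no weight chosen yet.
  runᵇ : mat ∷ nat ∷ real ∷ real ∷ real ∷ real ∷ real ∷ nat ∷ list edgeTy ∷ Γ ⊢ state
  runᵇ = natrec
    (pair (scaleᵗ v7 (div one (mul v5 (mul v3 v2))) v0)
    (pair (scaleᵗ v7 (div one (mul v5 v3)) v0)
          (tab (lengthᵗ v8) zeroᴿ)))
    (stepᵗ v9 (var (there (there (there (there (there (there (there (there (there (there (here refl)))))))))))) v4 v0)
    v1

  searchᵇ : real ∷ real ∷ real ∷ nat ∷ list edgeTy ∷ Γ ⊢ list edgeTy
  searchᵇ =
    let′ (sqrt v2)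
    (let′ (div (add v0 one) (sub v0 one))
    (let′ (app₂ (lam (lam ceilᵇ)) v2 v6)
    (let′ (app₂ (lam (lam gramᵇ)) v6 v7)
    (let′ runᵇ
    (app₃ (lam (lam (lam pickᵇ))) (sub (realᵗ v2) (mul v6 v4)) (snd (snd v0)) v9)))))

  -- The test leaves d (n - 1) < m for the search, so a count that stops at m still reaches the
  -- ceiling.
  sparsify : Algorithm
  sparsify =
    let′ (sub (realᵗ v1) one)
    (let′ (mul v1 v0)
    (if (leq (realᵗ (lengthᵗ v4)) v0) v4 searchᵇ))

-- Lists as arrays.

module ListArrays where

  private
    variable
      A : Set

  at : A → List A → ℕ → A
  at d []       i = d
  at d (x ∷ xs) i = if length xs ℕ.≤ᵇ i then x else at d xs i

  natfold : A → (ℕ → A → A) → ℕ → A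
  natfold z s zero    = z
  natfold z s (suc k) = s k (natfold z s k)

  tabulate : (ℕ → A) → ℕ → List A
  tabulate f = natfold [] (λ k xs → f k ∷ xs)

  ≤⇒≤ᵇ≡true : ∀ {i j} → i ℕ.≤ j → (i ℕ.≤ᵇ j) ≡ true
  ≤⇒≤ᵇ≡true {i} {j} i≤j with i ℕ.≤ᵇ j | ℕ.≤⇒≤ᵇ i≤j
  ... | true | _ = refl

  >⇒≤ᵇ≡false : ∀ {i j} → j ℕ.< i → (i ℕ.≤ᵇ j) ≡ false
  >⇒≤ᵇ≡false {i} {j} j<i with i ℕ.≤ᵇ j in eq
  ... | false = refl
  ... | true  = contradiction (ℕ.≤ᵇ⇒≤ i j (subst Bool.T (sym eq) tt)) (ℕ.<⇒≱ j<i)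

  at-here : ∀ (d x : A) xs {i} → i ≡ length xs → at d (x ∷ xs) i ≡ x
  at-here d x xs refl = cong (λ b → if b then x else at d xs (length xs)) (≤⇒≤ᵇ≡true (ℕ.≤-refl {length xs}))

  at-there : ∀ (d x : A) xs {i} → i ℕ.< length xs → at d (x ∷ xs) i ≡ at d xs i
  at-there d x xs {i} i< = cong (λ b → if b then x else at d xs i) (>⇒≤ᵇ≡false i<)

  at-All : ∀ {P : A → Set} d {xs} → All P xs → ∀ {i} → i ℕ.< length xs → P (at d xs i)
  at-All {P = P} d {x ∷ xs} (p ∷ ps) {i} (ℕ.s≤s i≤m) with ℕ.m≤n⇒m<n∨m≡n i≤m
  ... | inj₁ i<m  = subst P (sym (at-there d x xs i<m)) (at-All d ps i<m)
  ... | inj₂ i≡m  = subst P (sym (at-here d x xs i≡m)) p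

  length-tabulate : ∀ (f : ℕ → A) n → length (tabulate f n) ≡ n
  length-tabulate f zero    = refl
  length-tabulate f (suc n) = cong suc (length-tabulate f n)

  at-tabulate : ∀ d (f : ℕ → A) n {i} → i ℕ.< n → at d (tabulate f n) i ≡ f i
  at-tabulate d f (suc n) {i} (ℕ.s≤s i≤n) with ℕ.m≤n⇒m<n∨m≡n i≤n
  ... | inj₁ i<n  = trans (at-there d (f n) (tabulate f n) (subst (i ℕ.<_) (sym (length-tabulate f n)) i<n))
    (at-tabulate d f n i<n)
  ... | inj₂ refl = at-here d (f n) (tabulate f n) (sym (length-tabulate f n))

  natfold-ind : ∀ (P : ℕ → A → Set) {z s} n → P 0 z →
                (∀ {k x} → k ℕ.< n → P k x → P (suc k) (s k x)) → P n (natfold z s n)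
  natfold-ind P zero    p step = p
  natfold-ind P (suc n) p step = step ℕ.≤-refl (natfold-ind P n p λ k<n → step (ℕ.m<n⇒m<1+n k<n))

-- The functions computed by the program.

module Semantics (ℝ : Reals) where

  open Reals ℝ
  open OrderedField ℝ
  open Summation ℝ
  open Program
  open Execution ℝ
  open ListArrays

  private
    variable
      Γ : Ctx
      σ τ α β γ θ : Ty
      ρ : Env Γ

  -- As a record rather than a bare equation it is injective in the term, so unification follows the
  -- syntax without evaluating it.
  record Val (t : Γ ⊢ τ) (ρ : Env Γ) (x : ⟦ τ ⟧) : Set where
    constructor val
    field value : proj₁ (eval t ρ) ≡ x

  open Val public

  val-≡ : ∀ {t : Γ ⊢ τ} {x y} → x ≡ y → Val t ρ x → Val t ρ y
  val-≡ refl p = p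

  val-var : {i : τ ∈ Γ} → Val (var i) ρ (All.lookup ρ i)
  val-var = val refl

  val-let : ∀ {t : Γ ⊢ σ} {u : σ ∷ Γ ⊢ τ} {x y} → Val t ρ x → Val u (x ∷ ρ) y → Val (let′ t u) ρ y
  val-let (val refl) (val refl) = val refl

  val-app₂ : ∀ {t : β ∷ α ∷ Γ ⊢ τ} {u v x y z} → Val u ρ x → Val v ρ y → Val t (y ∷ x ∷ ρ) z →
             Val (app₂ (lam (lam t)) u v) ρ z
  val-app₂ (val refl) (val refl) (val refl) = val refl

  val-app₃ : ∀ {t : γ ∷ β ∷ α ∷ Γ ⊢ τ} {u v w x y z r} → Val u ρ x → Val v ρ y → Val w ρ z →
             Val t (z ∷ y ∷ x ∷ ρ) r → Val (app₃ (lam (lam (lam t))) u v w) ρ r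
  val-app₃ (val refl) (val refl) (val refl) (val refl) = val refl

  val-app₄ : ∀ {t : θ ∷ γ ∷ β ∷ α ∷ Γ ⊢ τ} {u v w q x y z p r} → Val u ρ x → Val v ρ y → Val w ρ z → Val q ρ p →
             Val t (p ∷ z ∷ y ∷ x ∷ ρ) r → Val (app₄ (lam (lam (lam (lam t)))) u v w q) ρ r
  val-app₄ (val refl) (val refl) (val refl) (val refl) (val refl) = val refl

  val-pair : ∀ {t : Γ ⊢ σ} {u : Γ ⊢ τ} {x y} → Val t ρ x → Val u ρ y → Val (pair t u) ρ (x , y)
  val-pair (val refl) (val refl) = val refl

  val-fst : ∀ {t : Γ ⊢ σ ⊗ τ} {x} → Val t ρ x → Val (fst t) ρ (proj₁ x)
  val-fst (val refl) = val refl

  val-snd : ∀ {t : Γ ⊢ σ ⊗ τ} {x} → Val t ρ x → Val (snd t) ρ (proj₂ x)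
  val-snd (val refl) = val refl

  val-zero : Val zero ρ 0
  val-zero = val refl

  val-suc : ∀ {t : Γ ⊢ nat} {x} → Val t ρ x → Val (suc t) ρ (suc x)
  val-suc (val refl) = val refl

  val-leqℕ : ∀ {t u : Γ ⊢ nat} {x y} → Val t ρ x → Val u ρ y → Val (leqℕ t u) ρ (x ℕ.≤ᵇ y)
  val-leqℕ (val refl) (val refl) = val refl

  val-if : ∀ {b} {t u : Γ ⊢ τ} {c x y} → Val b ρ c → Val t ρ x → Val u ρ y → Val (if b t u) ρ (if c then x else y)
  val-if {ρ = ρ} {b = b} {t} {u} (val refl) (val refl) (val refl) = val (branch (proj₁ (eval b ρ)))
    where
    branch : ∀ c → proj₁ (if c then eval t ρ else eval u ρ) ≡ (if c then proj₁ (eval t ρ) else proj₁ (eval u ρ))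
    branch true  = refl
    branch false = refl

  val-nil : Val (nil {σ = σ}) ρ []
  val-nil = val refl

  val-cons : ∀ {t : Γ ⊢ σ} {u : Γ ⊢ list σ} {x y} → Val t ρ x → Val u ρ y → Val (cons t u) ρ (x ∷ y)
  val-cons (val refl) (val refl) = val refl

  val-zeroᴿ : Val zeroᴿ ρ 0#
  val-zeroᴿ = val refl

  val-one : Val one ρ 1#
  val-one = val refl

  module _ {t u : Γ ⊢ real} {x y : Carrier} where

    val-add : Val t ρ x → Val u ρ y → Val (add t u) ρ (x + y)
    val-add (val refl) (val refl) = val refl
    val-sub : Val t ρ x → Val u ρ y → Val (sub t u) ρ (x - y)
    val-sub (val refl) (val refl) = val refl
    val-mul : Val t ρ x → Val u ρ y → Val (mul t u) ρ (x * y)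
    val-mul (val refl) (val refl) = val refl
    val-div : Val t ρ x → Val u ρ y → Val (div t u) ρ (x / y)
    val-div (val refl) (val refl) = val refl
    val-leq : Val t ρ x → Val u ρ y → Val (leq t u) ρ (does (x ≤? y))
    val-leq (val refl) (val refl) = val refl

  val-sqrt : ∀ {t : Γ ⊢ real} {x} → Val t ρ x → Val (sqrt t) ρ (√ x)
  val-sqrt (val refl) = val refl

  val-natrec : ∀ {z : Γ ⊢ τ} {s : τ ∷ nat ∷ Γ ⊢ τ} {n N x} {f : ℕ → ⟦ τ ⟧ → ⟦ τ ⟧} → Val n ρ N → Val z ρ x → (∀ {k y} → Val s (y ∷ k ∷ ρ) (f k y)) →
               Val (natrec z s n) ρ (natfold x f N)
  val-natrec {ρ = ρ} {z = z} {s} {n} {f = f} (val refl) (val refl) p = val (loop (proj₁ (eval n ρ)))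
    where
    loop : ∀ k → proj₁ (natrecᵀ (eval z ρ) (λ k y → eval s (y ∷ k ∷ ρ)) k) ≡ natfold (proj₁ (eval z ρ)) f k
    loop zero    = refl
    loop (suc k) = trans (value p) (cong (f k) (loop k))

  val-tab : ∀ {s : list σ ∷ nat ∷ Γ ⊢ σ} {n N} {f : ℕ → ⟦ σ ⟧} → Val n ρ N → (∀ {k y} → Val s (y ∷ k ∷ ρ) (f k)) → Val (tab n s) ρ (tabulate f N)
  val-tab p q = val-natrec p val-nil (val-cons q val-var)

  val-sum : ∀ {s : real ∷ nat ∷ Γ ⊢ real} {n N} {f : ℕ → Carrier} → Val n ρ N → (∀ {k y} → Val s (y ∷ k ∷ ρ) (f k)) → Val (sumᵗ n s) ρ (∑< N f)
  val-sum {N = N} {f} p q = val-≡ (fold≡ N) (val-natrec p val-zeroᴿ (val-add q val-var))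
    where
    fold≡ : ∀ k → natfold 0# (λ i x → f i + x) k ≡ ∑< k f
    fold≡ zero    = refl
    fold≡ (suc k) = cong (f k +_) (fold≡ k)

  val-length : ∀ {l : Γ ⊢ list σ} {xs} → Val l ρ xs → Val (lengthᵗ l) ρ (length xs)
  val-length {σ = σ} {ρ = ρ} {l = l} (val refl) = val (loop (proj₁ (eval l ρ)))
    where
    loop : ∀ (xs : List ⟦ σ ⟧) → proj₁ (listrecᵀ (return 0) (λ _ _ k → return (suc k)) xs) ≡ length xs
    loop []       = refl
    loop (x ∷ xs) = cong suc (loop xs)

  val-at : ∀ {i xs} {d : ⟦ σ ⟧} → Val (atᵇ {σ}) (i ∷ xs ∷ d ∷ ρ) (at d xs i)
  val-at {σ = σ} {Γ} {ρ} {i} {xs} {d} = val (loop xs)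
    where
    Δ : Ctx
    Δ = σ ∷ σ ∷ list σ ∷ nat ∷ list σ ∷ σ ∷ Γ
    step : ∀ {y ys} b → Val {Δ} {σ} (if (leqℕ (lengthᵗ {σ = σ} v2) v3) v1 v0) (b ∷ y ∷ ys ∷ i ∷ xs ∷ d ∷ ρ)
             (if length ys ℕ.≤ᵇ i then y else b)
    step {y} {ys} b = val-if {c = length ys ℕ.≤ᵇ i} (val-leqℕ (val-length {xs = ys} (val refl)) (val refl)) (val refl) (val refl)
    loop : ∀ ys → proj₁ (listrecᵀ (return d) (λ a as b →
             eval {Δ} {σ} (if (leqℕ (lengthᵗ {σ = σ} v2) v3) v1 v0) (b ∷ a ∷ as ∷ i ∷ xs ∷ d ∷ ρ)) ys) ≡ at d ys i
    loop []       = refl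
    loop (y ∷ ys) = trans (value (step {y} {ys} _)) (cong (λ z → if length ys ℕ.≤ᵇ i then y else z) (loop ys))

  val-nth : ∀ {d : Γ ⊢ σ} {l i x xs k} → Val d ρ x → Val l ρ xs → Val i ρ k → Val (nth d l i) ρ (at x xs k)
  val-nth {σ = σ} p q r = val-app₃ p q r (val-at {σ = σ})

  -- The suffix # marks the functions computed by the programs. They are opaque because the
  -- conversion checker would otherwise unfold nested evaluations.

  Edge Mat State : Set
  Edge  = ⟦ edgeTy ⟧
  Mat   = ⟦ mat ⟧
  State = ⟦ state ⟧

  entry# : Mat → ℕ → ℕ → Carrier
  entry# X i j = at 0# (at [] X i) j

  edge# : List Edge → ℕ → Edge
  edge# = at ((0 , 0) , 0#)

  src tgt : Edge → ℕ
  src e = proj₁ (proj₁ e)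
  tgt e = proj₂ (proj₁ e)

  wt : Edge → Carrier
  wt = proj₂

  δ# : ℕ → ℕ → Carrier
  δ# i j = if i ℕ.≤ᵇ j then (if j ℕ.≤ᵇ i then 1# else 0#) else 0#

  column# : Mat → Edge → ℕ → Carrier
  column# X e i = entry# X i (src e) - entry# X i (tgt e)

  opaque
    ker# : Mat → Edge → Edge → Carrier
    ker# X e f = column# X f (src e) - column# X f (tgt e)

  matrix# : ℕ → (ℕ → ℕ → Carrier) → Mat
  matrix# n f = tabulate (λ i → tabulate (f i) n) n

  update# : ℕ → Mat → Carrier → Edge → List Carrier → Mat
  update# n X c e p = matrix# n λ i j →
    entry# X i j - c / (1# + c * (at 0# p (src e) - at 0# p (tgt e))) * (at 0# p i * at 0# p j)

  opaque
    rank1# : ℕ → Mat → Carrier → Edge → Mat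
    rank1# n X c e = update# n X c e (tabulate (column# X e) n)

  opaque
    shift# : ℕ → List Edge → Carrier → Mat → Mat
    shift# n es a X = natfold X (λ k Z → rank1# n Z (a * wt (edge# es k)) (edge# es k)) (length es)

  opaque
    Φ# : List Edge → Mat → Carrier
    Φ# es X = ∑< (length es) λ k → wt (edge# es k) * ker# X (edge# es k) (edge# es k)

  opaque
    S²# : List Edge → Mat → Edge → Carrier
    S²# es X g = ∑< (length es) λ k → wt (edge# es k) * (ker# X (edge# es k) g * ker# X (edge# es k) g)

  U# L# : List Edge → Mat → Carrier → Edge → Carrier
  U# es X f g = S²# es X g / f + ker# X g g
  L# es X f g = S²# es X g / f - ker# X g g

  opaque
    choose# : List Edge → Mat → Mat → Carrier → Carrier → ℕ
    choose# es X Y fu fl = natfold 0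
      (λ k r → if does (U# es X fu (edge# es k) ≤? L# es Y fl (edge# es k)) then k else r) (length es)

  opaque
    bump# : List Edge → List Carrier → ℕ → Carrier → List Carrier
    bump# es s g t = tabulate (λ k → at 0# s k + t * δ# g k) (length es)

  chosen# : List Edge → Mat → Mat → Mat → Mat → ℕ
  chosen# es X Y X′ Y′ = choose# es X′ Y′ (Φ# es X - Φ# es X′) (Φ# es Y′ - Φ# es Y)

  amount# : List Edge → Mat → Mat → ℕ → Carrier
  amount# es X X′ g = 1# / U# es X′ (Φ# es X - Φ# es X′) (edge# es g)

  move# : ℕ → List Edge → Mat → Mat → List Carrier → ℕ → Carrier → State
  move# n es X′ Y′ s g t =
    rank1# n X′ (0# - t) (edge# es g) , rank1# n Y′ t (edge# es g) , bump# es s g t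

  opaque
    step# : ℕ → List Edge → Carrier → State → State
    step# n es d (X , Y , s) = move# n es X′ Y′ s g (amount# es X X′ g)
      where
      X′ Y′ : Mat
      X′ = shift# n es d X
      Y′ = shift# n es (0# - 1#) Y
      g : ℕ
      g = chosen# es X Y X′ Y′

  opaque
    residual# : ℕ → List Edge → ℕ → Mat → List Carrier
    residual# n es k X = tabulate (λ i → δ# k i - ∑< (length es) λ f →
      wt (edge# es f) * ((δ# k (src (edge# es f)) - δ# k (tgt (edge# es f))) * column# X (edge# es f) i)) n

  opaque
    norm# : List Edge → List Carrier → Carrier
    norm# es y = ∑< (length es) λ f →
      wt (edge# es f) * ((at 0# y (src (edge# es f)) - at 0# y (tgt (edge# es f)))
                       * (at 0# y (src (edge# es f)) - at 0# y (tgt (edge# es f))))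

  extend# : ℕ → Mat → List Carrier → Carrier → Mat
  extend# n X y c = if does (c ≤? 0#) then X else
    matrix# n λ i j → entry# X i j + at 0# y i * at 0# y j / c

  opaque
    ortho# : ℕ → List Edge → ℕ → Mat → Mat
    ortho# n es k X = extend# n X (residual# n es k X) (norm# es (residual# n es k X))

  opaque
    gram# : ℕ → List Edge → Mat
    gram# n es = natfold (matrix# n λ _ _ → 0#) (ortho# n es) (ℕ.pred n)

  opaque
    scale# : ℕ → Carrier → Mat → Mat
    scale# n a X = matrix# n λ i j → a * entry# X i j

  opaque
    ceil# : Carrier → ℕ → ℕ × Carrier
    ceil# D = natfold (0 , 0#) λ _ p → if does (D ≤? proj₂ p) then p else (suc (proj₁ p) , 1# + proj₂ p)

  pick# : {A : Set} → Carrier → List Carrier → List (A × Carrier) → List (A × Carrier)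
  pick# l s []       = []
  pick# l s (e ∷ es) = if does (at 0# s (length es) ≤? 0#) then pick# l s es
                       else (proj₁ e , at 0# s (length es) / l) ∷ pick# l s es

  opaque
    run# : ℕ → List Edge → Carrier → Carrier → Carrier → ℕ → State
    run# n es N s a = natfold
      (scale# n (1# / (N * (s * a))) (gram# n es) , scale# n (1# / (N * s)) (gram# n es) , tabulate (λ _ → 0#) (length es))
      (λ _ → step# n es a)

  steps# : List Edge → Carrier → ℕ
  steps# es D = proj₁ (ceil# D (length es))

  growth# : Carrier → Carrier
  growth# s = (s + 1#) / (s - 1#)

  search# : ℕ → List Edge → Carrier → Carrier → Carrier → List Edge
  search# n es d N D = pick# (fromℕ (steps# es D) - N * √ d)
    (proj₂ (proj₂ (run# n es N (√ d) (growth# (√ d)) (steps# es D)))) es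

  sparsify# : Carrier → ℕ → List Edge → List Edge
  sparsify# d n es = if does (fromℕ (length es) ≤? D) then es else search# n es d N D
    where
    N D : Carrier
    N = fromℕ n - 1#
    D = d * N

  val-entry : ∀ {X : Γ ⊢ mat} {i j x a b} → Val X ρ x → Val i ρ a → Val j ρ b → Val (entry X i j) ρ (entry# x a b)
  val-entry p q r = val-nth val-zeroᴿ (val-nth val-nil p q) r

  val-edge : ∀ {l : Γ ⊢ list edgeTy} {i es k} → Val l ρ es → Val i ρ k → Val (edgeᵗ l i) ρ (edge# es k)
  val-edge = val-nth (val-pair (val-pair val-zero val-zero) val-zeroᴿ)

  val-src : ∀ {t : Γ ⊢ edgeTy} {e} → Val t ρ e → Val (tail t) ρ (src e)
  val-src p = val-fst (val-fst p)

  val-tgt : ∀ {t : Γ ⊢ edgeTy} {e} → Val t ρ e → Val (head t) ρ (tgt e)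
  val-tgt p = val-snd (val-fst p)

  val-delta : ∀ {t u : Γ ⊢ nat} {i j} → Val t ρ i → Val u ρ j → Val (delta t u) ρ (δ# i j)
  val-delta p q = val-app₂ p q (val-if (val-leqℕ val-var val-var) (val-if (val-leqℕ val-var val-var) val-one val-zeroᴿ) val-zeroᴿ)

  val-real : ∀ {t : Γ ⊢ nat} {k} → Val t ρ k → Val (realᵗ t) ρ (fromℕ k)
  val-real {k = k} p = val-≡ (fold≡ k) (val-natrec p val-zeroᴿ (val-add val-one val-var))
    where
    fold≡ : ∀ k → natfold 0# (λ _ x → 1# + x) k ≡ fromℕ k
    fold≡ zero    = refl
    fold≡ (suc k) = cong (1# +_) (fold≡ k)

  opaque
    unfolding ker#

    val-ker : ∀ {t : Γ ⊢ mat} {u v X e f} → Val t ρ X → Val u ρ e → Val v ρ f → Val (kerᵗ t u v) ρ (ker# X e f)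
    val-ker p q r = val-app₃ p q r (val-sub
      (val-sub (val-entry val-var (val-src val-var) (val-src val-var)) (val-entry val-var (val-src val-var) (val-tgt val-var)))
      (val-sub (val-entry val-var (val-tgt val-var) (val-src val-var)) (val-entry val-var (val-tgt val-var) (val-tgt val-var))))

  val-matrix : ∀ {t : Γ ⊢ nat} {t′ s n} {f : ℕ → ℕ → Carrier} → Val t ρ n →
               (∀ {x : List ⟦ vec ⟧} {i} → Val t′ (x ∷ i ∷ ρ) n) →
               (∀ {x : List ⟦ vec ⟧} {i} {y : List Carrier} {j} → Val s (y ∷ j ∷ x ∷ i ∷ ρ) (f i j)) →
               Val (tab t (tab t′ s)) ρ (matrix# n f)
  val-matrix p q r = val-tab p (val-tab q r)

  opaque
    unfolding rank1#

    val-rank1 : ∀ {X c e n} → Val rank1ᵇ (e ∷ c ∷ X ∷ n ∷ ρ) (rank1# n X c e)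
    val-rank1 = val-let (val-tab val-var (val-sub (val-entry val-var val-var (val-src val-var)) (val-entry val-var val-var (val-tgt val-var))))
      (val-let (val-div val-var (val-add val-one (val-mul val-var (val-sub (val-nth val-zeroᴿ val-var (val-src val-var)) (val-nth val-zeroᴿ val-var (val-tgt val-var))))))
      (val-matrix val-var val-var (val-sub (val-entry val-var val-var val-var)
        (val-mul val-var (val-mul (val-nth val-zeroᴿ val-var val-var) (val-nth val-zeroᴿ val-var val-var))))))

  opaque
    unfolding shift#

    val-shift : ∀ {X a es n} → Val shiftᵇ (X ∷ a ∷ es ∷ n ∷ ρ) (shift# n es a X)
    val-shift = val-natrec (val-length val-var) val-var
      (val-app₄ val-var val-var (val-mul val-var (val-snd (val-edge val-var val-var))) (val-edge val-var val-var) val-rank1)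

  opaque
    unfolding Φ#

    val-Φ : ∀ {X es} → Val Φᵇ (X ∷ es ∷ ρ) (Φ# es X)
    val-Φ = val-sum (val-length val-var) (val-mul (val-snd (val-edge val-var val-var))
      (val-ker val-var (val-edge val-var val-var) (val-edge val-var val-var)))

  opaque
    unfolding S²#

    val-S² : ∀ {g X es} → Val S²ᵇ (g ∷ X ∷ es ∷ ρ) (S²# es X g)
    val-S² = val-sum (val-length val-var) (val-mul (val-snd (val-edge val-var val-var))
      (val-mul (val-ker val-var (val-edge val-var val-var) val-var) (val-ker val-var (val-edge val-var val-var) val-var)))

  val-U : ∀ {g f X es} → Val Uᵇ (g ∷ f ∷ X ∷ es ∷ ρ) (U# es X f g)
  val-U = val-add (val-div (val-app₃ val-var val-var val-var val-S²) val-var) (val-ker val-var val-var val-var)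

  val-L : ∀ {g f X es} → Val Lᵇ (g ∷ f ∷ X ∷ es ∷ ρ) (L# es X f g)
  val-L = val-sub (val-div (val-app₃ val-var val-var val-var val-S²) val-var) (val-ker val-var val-var val-var)

  opaque
    unfolding choose#

    val-choose : ∀ {fl fu Y X st d es n} → Val chooseᵇ (fl ∷ fu ∷ Y ∷ X ∷ st ∷ d ∷ es ∷ n ∷ ρ) (choose# es X Y fu fl)
    val-choose = val-natrec (val-length val-var) val-zero (val-if (val-leq
      (val-app₄ val-var val-var val-var (val-edge val-var val-var) val-U)
      (val-app₄ val-var val-var val-var (val-edge val-var val-var) val-L)) val-var val-var)

  opaque
    unfolding bump#

    val-bump : ∀ {t g fl fu Y X st d es n} →
      Val bumpᵇ (t ∷ g ∷ fl ∷ fu ∷ Y ∷ X ∷ st ∷ d ∷ es ∷ n ∷ ρ) (bump# es (proj₂ (proj₂ st)) g t)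
    val-bump = val-tab (val-length val-var) (val-add (val-nth val-zeroᴿ (val-snd (val-snd val-var)) val-var)
      (val-mul val-var (val-delta val-var val-var)))

  private
    module _ {d : Carrier} {n : ℕ} {es : List Edge} {st : State} where

      ρ₀ : Env Γ → Env (state ∷ real ∷ list edgeTy ∷ nat ∷ Γ)
      ρ₀ ρ = st ∷ d ∷ es ∷ n ∷ ρ

      val-X′ : Val raisedᵇ (ρ₀ ρ) (shift# n es d (proj₁ st))
      val-X′ = val-app₄ val-var val-var val-var (val-fst val-var) val-shift

      val-Y′ : ∀ {x : Mat} → Val loweredᵇ (x ∷ ρ₀ ρ) (shift# n es (0# - 1#) (proj₁ (proj₂ st)))
      val-Y′ = val-app₄ val-var val-var (val-sub val-zeroᴿ val-one) (val-fst (val-snd val-var)) val-shift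

      val-fu : ∀ {x y : Mat} → Val upperGapᵇ (y ∷ x ∷ ρ₀ ρ) (Φ# es (proj₁ st) - Φ# es x)
      val-fu = val-sub (val-app₂ val-var (val-fst val-var) val-Φ) (val-app₂ val-var val-var val-Φ)

      val-fl : ∀ {x y : Mat} {f : Carrier} → Val lowerGapᵇ (f ∷ y ∷ x ∷ ρ₀ ρ) (Φ# es y - Φ# es (proj₁ (proj₂ st)))
      val-fl = val-sub (val-app₂ val-var val-var val-Φ) (val-app₂ val-var (val-fst (val-snd val-var)) val-Φ)

      val-t : ∀ {x y : Mat} {f f′ : Carrier} {g : ℕ} → Val amountᵇ (g ∷ f′ ∷ f ∷ y ∷ x ∷ ρ₀ ρ) (1# / U# es x f (edge# es g))
      val-t = val-div val-one (val-app₄ val-var val-var val-var (val-edge val-var val-var) val-U)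

      val-move : ∀ {x y f f′ g t} → Val moveᵇ (t ∷ g ∷ f′ ∷ f ∷ y ∷ x ∷ ρ₀ ρ) (move# n es x y (proj₂ (proj₂ st)) g t)
      val-move = val-pair (val-app₄ val-var val-var (val-sub val-zeroᴿ val-var) (val-edge val-var val-var) val-rank1)
        (val-pair (val-app₄ val-var val-var val-var (val-edge val-var val-var) val-rank1) val-bump)

  opaque
    unfolding step#

    val-step : ∀ {st d es n} → Val stepᵇ (st ∷ d ∷ es ∷ n ∷ ρ) (step# n es d st)
    val-step = val-let val-X′ (val-let val-Y′ (val-let val-fu (val-let val-fl (val-let val-choose (val-let val-t val-move)))))

  opaque
    unfolding residual#

    val-residual : ∀ {X k es n} → Val residualᵇ (X ∷ k ∷ es ∷ n ∷ ρ) (residual# n es k X)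
    val-residual = val-tab val-var (val-sub (val-delta val-var val-var) (val-sum (val-length val-var) (val-mul (val-snd (val-edge val-var val-var))
      (val-mul (val-sub (val-delta val-var (val-src (val-edge val-var val-var))) (val-delta val-var (val-tgt (val-edge val-var val-var))))
        (val-sub (val-entry val-var val-var (val-src (val-edge val-var val-var)))
          (val-entry val-var val-var (val-tgt (val-edge val-var val-var))))))))

  opaque
    unfolding norm#

    val-norm : ∀ {y X k es n} → Val normᵇ (y ∷ X ∷ k ∷ es ∷ n ∷ ρ) (norm# es y)
    val-norm = val-sum (val-length val-var) (val-mul (val-snd (val-edge val-var val-var)) (val-mul
        (val-sub (val-nth val-zeroᴿ val-var (val-src (val-edge val-var val-var))) (val-nth val-zeroᴿ val-var (val-tgt (val-edge val-var val-var))))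
        (val-sub (val-nth val-zeroᴿ val-var (val-src (val-edge val-var val-var))) (val-nth val-zeroᴿ val-var (val-tgt (val-edge val-var val-var))))))

  val-extend : ∀ {c y X k es n} → Val extendᵇ (c ∷ y ∷ X ∷ k ∷ es ∷ n ∷ ρ) (extend# n X y c)
  val-extend = val-if (val-leq val-var val-zeroᴿ) val-var (val-matrix val-var val-var (val-add (val-entry val-var val-var val-var)
      (val-div (val-mul (val-nth val-zeroᴿ val-var val-var) (val-nth val-zeroᴿ val-var val-var)) val-var)))

  opaque
    unfolding ortho#

    val-ortho : ∀ {X k es n} → Val orthoᵇ (X ∷ k ∷ es ∷ n ∷ ρ) (ortho# n es k X)
    val-ortho = val-let val-residual (val-let val-norm val-extend)

  val-pred : ∀ {t : Γ ⊢ nat} {n} → Val t ρ n → Val (natrec zero v1 t) ρ (ℕ.pred n)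
  val-pred {n = n} p = val-≡ (pred≡ n) (val-natrec p val-zero val-var)
    where
    pred≡ : ∀ n → natfold 0 (λ k _ → k) n ≡ ℕ.pred n
    pred≡ zero    = refl
    pred≡ (suc n) = refl

  opaque
    unfolding gram#

    val-gram : ∀ {es n} → Val gramᵇ (es ∷ n ∷ ρ) (gram# n es)
    val-gram = val-natrec (val-pred val-var) (val-matrix val-var val-var val-zeroᴿ)
      (val-app₄ val-var val-var val-var val-var val-ortho)

  opaque
    unfolding scale#

    val-scale : ∀ {X a n} → Val scaleᵇ (X ∷ a ∷ n ∷ ρ) (scale# n a X)
    val-scale = val-matrix val-var val-var (val-mul val-var (val-entry val-var val-var val-var))

  opaque
    unfolding ceil#

    val-ceil : ∀ {es D} → Val ceilᵇ (es ∷ D ∷ ρ) (proj₁ (ceil# D (length es)))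
    val-ceil = val-fst (val-natrec (val-length val-var) (val-pair val-zero val-zeroᴿ)
      (val-if (val-leq val-var (val-snd val-var)) val-var
        (val-pair (val-suc (val-fst val-var)) (val-add val-one (val-snd val-var)))))

  val-pick : ∀ {es s l} → Val pickᵇ (es ∷ s ∷ l ∷ ρ) (pick# l s es)
  val-pick {Γ} {ρ} {es₀} {s} {l} = val (loop es₀)
    where
    pickˢ : ∀ {Δ} → list edgeTy ∷ edgeTy ∷ list edgeTy ∷ list edgeTy ∷ vec ∷ real ∷ Δ ⊢ list edgeTy
    pickˢ = if (leq (nth zeroᴿ v4 (lengthᵗ v2)) zeroᴿ) v0
              (cons (pair (fst v1) (div (nth zeroᴿ v4 (lengthᵗ v2)) v5)) v0)
    step : ∀ {e es} r → Val (pickˢ {Γ}) (r ∷ e ∷ es ∷ es₀ ∷ s ∷ l ∷ ρ)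
             (if does (at 0# s (length es) ≤? 0#) then r else (proj₁ e , at 0# s (length es) / l) ∷ r)
    step r = val-if (val-leq (val-nth val-zeroᴿ val-var (val-length val-var)) val-zeroᴿ) val-var
      (val-cons (val-pair (val-fst val-var) (val-div (val-nth val-zeroᴿ val-var (val-length val-var)) val-var)) val-var)
    loop : ∀ es → proj₁ (listrecᵀ (return []) (λ a as b → eval (pickˢ {Γ}) (b ∷ a ∷ as ∷ es₀ ∷ s ∷ l ∷ ρ)) es) ≡ pick# l s es
    loop []       = refl
    loop (e ∷ es) = trans (value (step {e} {es} _))
      (cong (λ r → if does (at 0# s (length es) ≤? 0#) then r else (proj₁ e , at 0# s (length es) / l) ∷ r) (loop es))

  opaque
    unfolding run#

    val-run : ∀ {X q a s D N d n es} → X ≡ gram# n es → Val runᵇ (X ∷ q ∷ a ∷ s ∷ D ∷ N ∷ d ∷ n ∷ es ∷ ρ) (run# n es N s a q)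
    val-run refl = val-natrec val-var
        (val-pair (val-app₃ val-var (val-div val-one (val-mul val-var (val-mul val-var val-var))) val-var val-scale)
        (val-pair (val-app₃ val-var (val-div val-one (val-mul val-var val-var)) val-var val-scale)
          (val-tab (val-length val-var) val-zeroᴿ)))
        (val-app₄ val-var val-var val-var val-var val-step)

  val-search : ∀ {D N d n es} → Val searchᵇ (D ∷ N ∷ d ∷ n ∷ es ∷ ρ) (search# n es d N D)
  val-search = val-let (val-sqrt val-var) (val-let (val-div (val-add val-var val-one) (val-sub val-var val-one))
    (val-let (val-app₂ val-var val-var val-ceil) (val-let (val-app₂ val-var val-var val-gram)
    (val-let (val-run refl)
    (val-app₃ (val-sub (val-real val-var) (val-mul val-var val-var)) (val-snd (val-snd val-var)) val-var val-pick)))))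

  val-sparsify : ∀ {d n es} → Val sparsify (d ∷ n ∷ es ∷ []) (sparsify# d n es)
  val-sparsify = val-let (val-sub (val-real val-var) val-one) (val-let (val-mul val-var val-var)
    (val-if (val-leq (val-real (val-length val-var)) val-var) val-var val-search))

-- Counting operations.

module Costs (ℝ : Reals) where

  open Program
  open Execution ℝ
  open Reals ℝ using (Carrier; _*_; _-_; 1#; fromℕ)
  open Semantics ℝ

  private
    variable
      Γ : Ctx
      σ τ α β γ θ : Ty
      B a b c d e : ℕ

  -- Times are bounded by multiples k * B of a common unit B: the numerals k then add up by computation.
  record Cost (B : ℕ) (t : Γ ⊢ τ) (ρ : Env Γ) (k : ℕ) : Set where
    constructor cost
    field bound : proj₂ (eval t ρ) ℕ.≤ k ℕ.* B

  open Cost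

  add-≤ : ∀ {x y} B a b → x ℕ.≤ a ℕ.* B → y ℕ.≤ b ℕ.* B → x ℕ.+ y ℕ.≤ (a ℕ.+ b) ℕ.* B
  add-≤ B a b p q = ℕ.≤-trans (ℕ.+-mono-≤ p q) (ℕ.≤-reflexive (sym (ℕ.*-distribʳ-+ B a b)))

  0≤ : ∀ {x} B a → x ℕ.≤ a ℕ.* B → x ℕ.+ 0 ℕ.≤ a ℕ.* B
  0≤ B a p = ℕ.≤-trans (ℕ.≤-reflexive (ℕ.+-identityʳ _)) p

  module _ {ρ : Env Γ} where

    weaken : ∀ {t : Γ ⊢ τ} {B} → Cost B t ρ a → ∀ B′ → B ℕ.≤ B′ → Cost B′ t ρ a
    weaken {a = a} (cost p) B′ B≤B′ = cost (ℕ.≤-trans p (ℕ.*-monoʳ-≤ a B≤B′))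

    c-fst : {t : Γ ⊢ σ ⊗ τ} → Cost B t ρ a → Cost B (fst t) ρ a
    c-fst {B = B} {a = a} (cost p) = cost (0≤ B a p)

    c-snd : {t : Γ ⊢ σ ⊗ τ} → Cost B t ρ a → Cost B (snd t) ρ a
    c-snd {B = B} {a = a} (cost p) = cost (0≤ B a p)

    c-suc : {t : Γ ⊢ nat} → Cost B t ρ a → Cost B (suc t) ρ a
    c-suc {B = B} {a = a} (cost p) = cost (0≤ B a p)

    c-pair : {t : Γ ⊢ σ} {u : Γ ⊢ τ} → Cost B t ρ a → Cost B u ρ b → Cost B (pair t u) ρ (a ℕ.+ b)
    c-pair {B = B} {a = a} {b = b} (cost p) (cost q) = cost (add-≤ B a b p (0≤ B b q))

    c-cons : {t : Γ ⊢ σ} {u : Γ ⊢ list σ} → Cost B t ρ a → Cost B u ρ b → Cost B (cons t u) ρ (a ℕ.+ b)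
    c-cons {B = B} {a = a} {b = b} (cost p) (cost q) = cost (add-≤ B a b p (0≤ B b q))

    c-leqℕ : {t : Γ ⊢ nat} {u : Γ ⊢ nat} → Cost B t ρ a → Cost B u ρ b → Cost B (leqℕ t u) ρ (a ℕ.+ b)
    c-leqℕ {B = B} {a = a} {b = b} (cost p) (cost q) = cost (add-≤ B a b p (0≤ B b q))

    c-let : {t : Γ ⊢ σ} {u : σ ∷ Γ ⊢ τ} → Cost B t ρ a → (∀ {x} → Cost B u (x ∷ ρ) b) →
            Cost B (let′ t u) ρ (a ℕ.+ b)
    c-let {B = B} {a = a} {b = b} (cost p) q = cost (add-≤ B a b p (bound q))

    -- Unlike `c-let` this remembers the bound value, for bounds of the body that depend on it, such
    -- as those in the number of steps.
    c-let= : {t : Γ ⊢ σ} {u : σ ∷ Γ ⊢ τ} {x : ⟦ σ ⟧} → Val t ρ x → Cost B t ρ a → Cost B u (x ∷ ρ) b →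
             Cost B (let′ t u) ρ (a ℕ.+ b)
    c-let= {B = B} {a = a} {b = b} (val refl) (cost p) (cost q) = cost (add-≤ B a b p q)

    c-if : {t : Γ ⊢ bool} {u v : Γ ⊢ τ} → Cost B t ρ a → Cost B u ρ b → Cost B v ρ c →
           Cost B (if t u v) ρ (a ℕ.+ (b ℕ.+ c))
    c-if {B = B} {a = a} {b = b} {c = c} {t = t} {u} {v} (cost p) (cost q) (cost r) =
      cost (add-≤ B a (b ℕ.+ c) p (branch (proj₁ (eval t ρ))))
      where
      branch : ∀ x → proj₂ (if x then eval u ρ else eval v ρ) ℕ.≤ (b ℕ.+ c) ℕ.* B
      branch true  = ℕ.≤-trans q (ℕ.*-monoˡ-≤ B (ℕ.m≤m+n b c))
      branch false = ℕ.≤-trans r (ℕ.*-monoˡ-≤ B (ℕ.m≤n+m c b))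

    c-app₂ : {t : β ∷ α ∷ Γ ⊢ τ} {u : Γ ⊢ α} {v : Γ ⊢ β} → Cost B u ρ a → Cost B v ρ b →
             Cost B t (proj₁ (eval v ρ) ∷ proj₁ (eval u ρ) ∷ ρ) c → Cost B (app₂ (lam (lam t)) u v) ρ (a ℕ.+ (b ℕ.+ c))
    c-app₂ {B = B} {a = a} {b = b} {c = c} (cost p) (cost q) r =
      cost (add-≤ B a (b ℕ.+ c) (0≤ B a p) (add-≤ B b c q (bound r)))

    c-app₃ : {t : γ ∷ β ∷ α ∷ Γ ⊢ τ} {u : Γ ⊢ α} {v : Γ ⊢ β} {w : Γ ⊢ γ} →
             Cost B u ρ a → Cost B v ρ b → Cost B w ρ c →
             Cost B t (proj₁ (eval w ρ) ∷ proj₁ (eval v ρ) ∷ proj₁ (eval u ρ) ∷ ρ) d →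
             Cost B (app₃ (lam (lam (lam t))) u v w) ρ (a ℕ.+ b ℕ.+ (c ℕ.+ d))
    c-app₃ {B = B} {a = a} {b = b} {c = c} {d = d} (cost p) (cost q) (cost r) s =
      cost (add-≤ B (a ℕ.+ b) (c ℕ.+ d) (add-≤ B a b (0≤ B a p) (0≤ B b q)) (add-≤ B c d r (bound s)))

    c-app₄ : {t : θ ∷ γ ∷ β ∷ α ∷ Γ ⊢ τ} {u : Γ ⊢ α} {v : Γ ⊢ β} {w : Γ ⊢ γ} {z : Γ ⊢ θ} →
             Cost B u ρ a → Cost B v ρ b → Cost B w ρ c → Cost B z ρ d →
             Cost B t (proj₁ (eval z ρ) ∷ proj₁ (eval w ρ) ∷ proj₁ (eval v ρ) ∷ proj₁ (eval u ρ) ∷ ρ) e →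
             Cost B (app₄ (lam (lam (lam (lam t)))) u v w z) ρ (a ℕ.+ b ℕ.+ c ℕ.+ (d ℕ.+ e))
    c-app₄ {B = B} {a = a} {b = b} {c = c} {d = d} {e = e} (cost p) (cost q) (cost r) (cost s) z =
      cost (add-≤ B (a ℕ.+ b ℕ.+ c) (d ℕ.+ e)
        (add-≤ B (a ℕ.+ b) c (add-≤ B a b (0≤ B a p) (0≤ B b q)) (0≤ B c r)) (add-≤ B d e s (bound z)))

    -- This is where the unit changes: N rounds at c units of `B′` fit into c units of `B`, so loop
    -- lengths go into the unit and the numerals stay constant.
    c-natrec : ∀ {z : Γ ⊢ τ} {s : τ ∷ nat ∷ Γ ⊢ τ} {n N} → Val n ρ N → ∀ B′ → N ℕ.* B′ ℕ.≤ B →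
               Cost B n ρ a → Cost B z ρ b → (∀ {i x} → Cost B′ s (x ∷ i ∷ ρ) c) →
               Cost B (natrec z s n) ρ (a ℕ.+ (b ℕ.+ c))
    c-natrec {B = B} {a = a} {b = b} {c = c} {z = z} {s} {n} (val refl) B′ NB′≤B (cost p) (cost q) r =
      cost (add-≤ B a (b ℕ.+ c) p (ℕ.≤-trans (loop (proj₁ (eval n ρ)))
        (add-≤ B b c q (ℕ.≤-trans (ℕ.≤-reflexive swap) (ℕ.*-monoʳ-≤ c NB′≤B)))))
      where
      N = proj₁ (eval n ρ)
      swap : N ℕ.* (c ℕ.* B′) ≡ c ℕ.* (N ℕ.* B′)
      swap = trans (sym (ℕ.*-assoc N c B′)) (trans (cong (ℕ._* B′) (ℕ.*-comm N c)) (ℕ.*-assoc c N B′))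
      loop : ∀ k → proj₂ (natrecᵀ (eval z ρ) (λ i x → eval s (x ∷ i ∷ ρ)) k)
             ℕ.≤ proj₂ (eval z ρ) ℕ.+ k ℕ.* (c ℕ.* B′)
      loop zero    = ℕ.m≤m+n _ _
      loop (suc k) = ℕ.≤-trans (ℕ.+-mono-≤ (loop k) (bound r)) (ℕ.≤-reflexive
        (trans (ℕ.+-assoc (proj₂ (eval z ρ)) _ _) (cong (proj₂ (eval z ρ) ℕ.+_) (ℕ.+-comm (k ℕ.* (c ℕ.* B′)) _))))

    c-listrec : ∀ {z : Γ ⊢ τ} {s : τ ∷ σ ∷ list σ ∷ Γ ⊢ τ} {l xs} → Val l ρ xs → ∀ B′ → length xs ℕ.* B′ ℕ.≤ B →
                Cost B l ρ a → Cost B z ρ b → (∀ {x y ys} → Cost B′ s (x ∷ y ∷ ys ∷ ρ) c) →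
                Cost B (listrec z s l) ρ (a ℕ.+ (b ℕ.+ c))
    c-listrec {B = B} {a = a} {b = b} {c = c} {z = z} {s} {l} (val refl) B′ NB′≤B (cost p) (cost q) r =
      cost (add-≤ B a (b ℕ.+ c) p (ℕ.≤-trans (loop (proj₁ (eval l ρ)))
        (add-≤ B b c q (ℕ.≤-trans (ℕ.≤-reflexive swap) (ℕ.*-monoʳ-≤ c NB′≤B)))))
      where
      N = length (proj₁ (eval l ρ))
      swap : N ℕ.* (c ℕ.* B′) ≡ c ℕ.* (N ℕ.* B′)
      swap = trans (sym (ℕ.*-assoc N c B′)) (trans (cong (ℕ._* B′) (ℕ.*-comm N c)) (ℕ.*-assoc c N B′))
      loop : ∀ xs → proj₂ (listrecᵀ (eval z ρ) (λ y ys x → eval s (x ∷ y ∷ ys ∷ ρ)) xs)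
             ℕ.≤ proj₂ (eval z ρ) ℕ.+ length xs ℕ.* (c ℕ.* B′)
      loop []       = ℕ.m≤m+n _ _
      loop (y ∷ ys) = ℕ.≤-trans (ℕ.+-mono-≤ (loop ys) (bound r)) (ℕ.≤-reflexive
        (trans (ℕ.+-assoc (proj₂ (eval z ρ)) _ _) (cong (proj₂ (eval z ρ) ℕ.+_) (ℕ.+-comm (length ys ℕ.* (c ℕ.* B′)) _))))

    module _ (1≤B : 1 ℕ.≤ B) {t u : Γ ⊢ real} (p : Cost B t ρ a) (q : Cost B u ρ b) where

      private
        op : proj₂ (eval t ρ) ℕ.+ (proj₂ (eval u ρ) ℕ.+ 1) ℕ.≤ (a ℕ.+ (b ℕ.+ 1)) ℕ.* B
        op = add-≤ B a (b ℕ.+ 1) (bound p) (add-≤ B b 1 (bound q) (ℕ.≤-trans 1≤B (ℕ.m≤m+n B 0)))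

      c-add : Cost B (add t u) ρ (a ℕ.+ (b ℕ.+ 1))
      c-add = cost op
      c-sub : Cost B (sub t u) ρ (a ℕ.+ (b ℕ.+ 1))
      c-sub = cost op
      c-mul : Cost B (mul t u) ρ (a ℕ.+ (b ℕ.+ 1))
      c-mul = cost op
      c-div : Cost B (div t u) ρ (a ℕ.+ (b ℕ.+ 1))
      c-div = cost op
      c-leq : Cost B (leq t u) ρ (a ℕ.+ (b ℕ.+ 1))
      c-leq = cost op

    c-sqrt : 1 ℕ.≤ B → {t : Γ ⊢ real} → Cost B t ρ a → Cost B (sqrt t) ρ (a ℕ.+ 1)
    c-sqrt {B = B} {a = a} 1≤B (cost p) = cost (add-≤ B a 1 p (ℕ.≤-trans 1≤B (ℕ.m≤m+n B 0)))

    -- The body runs no real instruction, so its unit may be 0 and the loop is free whatever its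
    -- length.
    c-length : {l : Γ ⊢ list σ} → Cost B l ρ a → Cost B (lengthᵗ l) ρ (a ℕ.+ 0)
    c-length {B = B} {a = a} {l = l} p = c-listrec {b = 0} {c = 0} (val refl) 0 (ℕ.≤-trans (ℕ.≤-reflexive (ℕ.*-zeroʳ (length (proj₁ (eval l ρ))))) ℕ.z≤n) p (cost ℕ.z≤n) (cost ℕ.z≤n)

    c-var : ∀ {i} → Cost {τ = τ} B (var i) ρ 0
    c-var = cost ℕ.z≤n

    c-zero : Cost B zero ρ 0
    c-zero = cost ℕ.z≤n

    c-zeroᴿ : Cost B zeroᴿ ρ 0
    c-zeroᴿ = cost ℕ.z≤n

    c-one : Cost B one ρ 0
    c-one = cost ℕ.z≤n

    c-nil : Cost {τ = list σ} B nil ρ 0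
    c-nil = cost ℕ.z≤n

  private
    variable
      ρ : Env Γ

  c-nth : {t : Γ ⊢ σ} {l : Γ ⊢ list σ} {i : Γ ⊢ nat} →
          Cost B t ρ 0 → Cost B l ρ 0 → Cost B i ρ 0 → Cost B (nth t l i) ρ 0
  c-nth {ρ = ρ} {l = l} p q r = c-app₃ {a = 0} {0} {0} {0} p q r (
    c-listrec {a = 0} {0} {0} (val refl) 0 (ℕ.≤-trans (ℕ.≤-reflexive (ℕ.*-zeroʳ (length (proj₁ (eval l ρ))))) ℕ.z≤n) c-var c-var
      (c-if {a = 0} {0} {0} (c-leqℕ {a = 0} {0} (c-length {a = 0} c-var) c-var) c-var c-var))

  c-entry : {X : Γ ⊢ mat} {i j : Γ ⊢ nat} →
            Cost B X ρ 0 → Cost B i ρ 0 → Cost B j ρ 0 → Cost B (entry X i j) ρ 0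
  c-entry p q r = c-nth c-zeroᴿ (c-nth c-nil p q) r

  c-edge : {l : Γ ⊢ list edgeTy} {i : Γ ⊢ nat} → Cost B l ρ 0 → Cost B i ρ 0 → Cost B (edgeᵗ l i) ρ 0
  c-edge = c-nth (c-pair {a = 0} {0} (c-pair {a = 0} {0} c-zero c-zero) c-zeroᴿ)

  c-tail : {e : Γ ⊢ edgeTy} → Cost B e ρ 0 → Cost B (tail e) ρ 0
  c-tail p = c-fst {a = 0} (c-fst {a = 0} p)

  c-head : {e : Γ ⊢ edgeTy} → Cost B e ρ 0 → Cost B (head e) ρ 0
  c-head p = c-snd {a = 0} (c-fst {a = 0} p)

  c-weight : {e : Γ ⊢ edgeTy} → Cost B e ρ 0 → Cost B (weight e) ρ 0
  c-weight p = c-snd {a = 0} p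

  c-delta : {i j : Γ ⊢ nat} → Cost B i ρ 0 → Cost B j ρ 0 → Cost B (delta i j) ρ 0
  c-delta p q = c-app₂ {a = 0} {0} {0} p q
    (c-if {a = 0} {0} {0} (c-leqℕ {a = 0} {0} c-var c-var)
      (c-if {a = 0} {0} {0} (c-leqℕ {a = 0} {0} c-var c-var) c-one c-zeroᴿ) c-zeroᴿ)

  c-tab : ∀ {s : list σ ∷ nat ∷ Γ ⊢ σ} {n N} → Val n ρ N → ∀ B′ → N ℕ.* B′ ℕ.≤ B → Cost B n ρ 0 →
          (∀ {i x} → Cost B′ s (x ∷ i ∷ ρ) c) → Cost B (tab n s) ρ (c ℕ.+ 0)
  c-tab {c = c} v B′ h p q = c-natrec {a = 0} {0} {c ℕ.+ 0} v B′ h p c-nil (c-cons {a = c} {0} q c-var)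

  c-sum : ∀ {s : real ∷ nat ∷ Γ ⊢ real} {n N} → Val n ρ N → ∀ B′ → 1 ℕ.≤ B′ → N ℕ.* B′ ℕ.≤ B → Cost B n ρ 0 →
          (∀ {i x} → Cost B′ s (x ∷ i ∷ ρ) c) → Cost B (sumᵗ n s) ρ (c ℕ.+ 1)
  c-sum {c = c} v B′ 1≤B′ h p q = c-natrec {a = 0} {0} {c ℕ.+ 1} v B′ h p c-zeroᴿ (c-add 1≤B′ q c-var)

  c-ker : 1 ℕ.≤ B → {X : Γ ⊢ mat} {e f : Γ ⊢ edgeTy} →
          Cost B X ρ 0 → Cost B e ρ 0 → Cost B f ρ 0 → Cost B (kerᵗ X e f) ρ 3
  c-ker 1≤B p q r = c-app₃ {a = 0} {0} {0} {3} p q r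
    (c-sub {a = 1} {1} 1≤B
      (c-sub {a = 0} {0} 1≤B (c-entry c-var (c-tail c-var) (c-tail c-var)) (c-entry c-var (c-tail c-var) (c-head c-var)))
      (c-sub {a = 0} {0} 1≤B (c-entry c-var (c-head c-var) (c-tail c-var)) (c-entry c-var (c-head c-var) (c-head c-var))))

  private
    1≤1 : 1 ℕ.≤ 1
    1≤1 = ℕ.≤-refl

    n*1≤ : ∀ {n} → n ℕ.* 1 ℕ.≤ n
    n*1≤ = ℕ.≤-reflexive (ℕ.*-identityʳ _)

    1≤* : ∀ {m n} → 1 ℕ.≤ m → 1 ℕ.≤ n → 1 ℕ.≤ m ℕ.* n
    1≤* = ℕ.*-mono-≤

    ≤*ˡ : ∀ {m} n → 1 ℕ.≤ m → n ℕ.≤ m ℕ.* n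
    ≤*ˡ n 1≤m = ℕ.≤-trans (ℕ.≤-reflexive (sym (ℕ.*-identityˡ n))) (ℕ.*-monoˡ-≤ n 1≤m)

    ≤*ʳ : ∀ m {n} → 1 ℕ.≤ n → m ℕ.≤ m ℕ.* n
    ≤*ʳ m 1≤n = ℕ.≤-trans (ℕ.≤-reflexive (sym (ℕ.*-identityʳ m))) (ℕ.*-monoʳ-≤ m 1≤n)

  c-tab² : {n : Γ ⊢ nat} {n′ : list vec ∷ nat ∷ Γ ⊢ nat} {s : vec ∷ nat ∷ list vec ∷ nat ∷ Γ ⊢ real} {N : ℕ} →
           Val n ρ N → (∀ {x i} → Val n′ (x ∷ i ∷ ρ) N) →
           Cost (N ℕ.* N) n ρ 0 → (∀ {x i} → Cost N n′ (x ∷ i ∷ ρ) 0) →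
           (∀ {x i y j} → Cost 1 s (y ∷ j ∷ x ∷ i ∷ ρ) c) →
           Cost (N ℕ.* N) (tab n (tab n′ s)) ρ (c ℕ.+ 0 ℕ.+ 0)
  c-tab² {N = N} u v p q r = c-tab u N ℕ.≤-refl p (c-tab v 1 n*1≤ q r)

  module _ {n : ℕ} (1≤n : 1 ℕ.≤ n) where

    c-rank1ᵇ : ∀ {X c e} → Cost (n ℕ.* n) rank1ᵇ (e ∷ c ∷ X ∷ n ∷ ρ) 8
    c-rank1ᵇ = c-let {a = 1} {7} (weaken (c-tab {c = 1} val-var 1 n*1≤ c-var
          (c-sub {a = 0} {0} 1≤1 (c-entry c-var c-var (c-tail c-var)) (c-entry c-var c-var (c-head c-var))))
          (n ℕ.* n) (≤*ˡ n 1≤n))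
      (c-let {a = 4} {3} (c-div {a = 0} {3} 1≤nn c-var (c-add {a = 0} {2} 1≤nn c-one (c-mul {a = 0} {1} 1≤nn c-var
          (c-sub {a = 0} {0} 1≤nn (c-nth c-zeroᴿ c-var (c-tail c-var)) (c-nth c-zeroᴿ c-var (c-head c-var))))))
        (c-tab² {c = 3} val-var val-var c-var c-var (c-sub {a = 0} {2} 1≤1 (c-entry c-var c-var c-var)
          (c-mul {a = 0} {1} 1≤1 c-var (c-mul {a = 0} {0} 1≤1 (c-nth c-zeroᴿ c-var c-var) (c-nth c-zeroᴿ c-var c-var))))))
      where
      1≤nn : 1 ℕ.≤ n ℕ.* n
      1≤nn = 1≤* 1≤n 1≤n

    c-shiftᵇ : ∀ {X a es} → Cost (length es ℕ.* (n ℕ.* n)) shiftᵇ (X ∷ a ∷ es ∷ n ∷ ρ) 9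
    c-shiftᵇ = c-natrec {a = 0} {0} {9} (val-length val-var) (n ℕ.* n) ℕ.≤-refl (c-length {a = 0} c-var) c-var
      (c-app₄ {a = 0} {0} {1} {0} {8} c-var c-var
        (c-mul {a = 0} {0} (1≤* 1≤n 1≤n) c-var (c-weight (c-edge c-var c-var))) (c-edge c-var c-var) c-rank1ᵇ)

    c-scaleᵇ : ∀ {X a} → Cost (n ℕ.* n) scaleᵇ (X ∷ a ∷ n ∷ ρ) 1
    c-scaleᵇ = c-tab² {c = 1} val-var val-var c-var c-var (c-mul {a = 0} {0} 1≤1 c-var (c-entry c-var c-var c-var))

    -- The actual order is n m + n². The coarser n² m is harmless, as n rounds of it amount to n
    -- steps of the main loop.
    c-orthoᵇ : ∀ {X k es} → 1 ℕ.≤ length es → Cost (n ℕ.* n ℕ.* length es) orthoᵇ (X ∷ k ∷ es ∷ n ∷ ρ) 15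
    c-orthoᵇ {es = es} 1≤m =
      c-let {a = 6} {9} (weaken (c-tab {c = 6} val-var (length es) ℕ.≤-refl c-var
          (c-sub {a = 0} {5} 1≤m (c-delta c-var c-var) (c-sum {c = 4} (val-length val-var) 1 1≤1 n*1≤ (c-length {a = 0} c-var)
            (c-mul {a = 0} {3} 1≤1 (c-weight (c-edge c-var c-var)) (c-mul {a = 1} {1} 1≤1
              (c-sub {a = 0} {0} 1≤1 (c-delta c-var (c-tail (c-edge c-var c-var))) (c-delta c-var (c-head (c-edge c-var c-var))))
              (c-sub {a = 0} {0} 1≤1 (c-entry c-var c-var (c-tail (c-edge c-var c-var)))
                (c-entry c-var c-var (c-head (c-edge c-var c-var)))))))))
          B₀ (ℕ.*-monoˡ-≤ (length es) (≤*ˡ n 1≤n)))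
      (c-let {a = 5} {4} (weaken (c-sum {c = 4} (val-length val-var) 1 1≤1 n*1≤ (c-length {a = 0} c-var)
          (c-mul {a = 0} {3} 1≤1 (c-weight (c-edge c-var c-var)) (c-mul {a = 1} {1} 1≤1 (diff c-var c-var c-var) (diff c-var c-var c-var)))) B₀ (≤*ˡ (length es) (1≤* 1≤n 1≤n)))
        (c-if {a = 1} {0} {3} (c-leq {a = 0} {0} (1≤* (1≤* 1≤n 1≤n) 1≤m) c-var c-zeroᴿ) c-var
          (weaken (c-tab² {c = 3} val-var val-var c-var c-var (c-add {a = 0} {2} 1≤1 (c-entry c-var c-var c-var)
            (c-div {a = 1} {0} 1≤1 (c-mul {a = 0} {0} 1≤1 (c-nth c-zeroᴿ c-var c-var) (c-nth c-zeroᴿ c-var c-var)) c-var)))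
            B₀ (≤*ʳ (n ℕ.* n) 1≤m))))
      where
      B₀ = n ℕ.* n ℕ.* length es
      diff : ∀ {Δ} {ρ : Env Δ} {y : Δ ⊢ vec} {l : Δ ⊢ list edgeTy} {i : Δ ⊢ nat} →
             Cost 1 y ρ 0 → Cost 1 l ρ 0 → Cost 1 i ρ 0 →
             Cost 1 (sub (nth zeroᴿ y (tail (edgeᵗ l i))) (nth zeroᴿ y (head (edgeᵗ l i)))) ρ 1
      diff p q r = c-sub {a = 0} {0} 1≤1 (c-nth c-zeroᴿ p (c-tail (c-edge q r))) (c-nth c-zeroᴿ p (c-head (c-edge q r)))

    c-gramᵇ : ∀ {es} → 1 ℕ.≤ length es → Cost (n ℕ.* (n ℕ.* n ℕ.* length es)) gramᵇ (es ∷ n ∷ ρ) 15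
    c-gramᵇ {es = es} 1≤m = c-natrec {a = 0} {0} {15} (val-pred val-var) (n ℕ.* n ℕ.* length es)
        (ℕ.*-monoˡ-≤ (n ℕ.* n ℕ.* length es) (ℕ.pred[n]≤n {n}))
        (c-natrec {a = 0} {0} {0} val-var 0 (ℕ.≤-trans (ℕ.≤-reflexive (ℕ.*-zeroʳ n)) ℕ.z≤n) c-var c-zero c-var)
        (weaken (c-tab² {c = 0} val-var val-var c-var c-var c-zeroᴿ) _ (ℕ.≤-trans (≤*ʳ (n ℕ.* n) 1≤m) (≤*ˡ _ 1≤n)))
        (c-app₄ {a = 0} {0} {0} {0} {15} c-var c-var c-var c-var (c-orthoᵇ 1≤m))

  c-Φᵇ : ∀ {X es} → Cost (length es) Φᵇ (X ∷ es ∷ ρ) 5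
  c-Φᵇ = c-sum {c = 4} (val-length val-var) 1 1≤1 n*1≤ (c-length {a = 0} c-var) (c-mul {a = 0} {3} 1≤1 (c-weight (c-edge c-var c-var))
    (c-ker 1≤1 c-var (c-edge c-var c-var) (c-edge c-var c-var)))

  c-S²ᵇ : ∀ {g X es} → Cost (length es) S²ᵇ (g ∷ X ∷ es ∷ ρ) 9
  c-S²ᵇ = c-sum {c = 8} (val-length val-var) 1 1≤1 n*1≤ (c-length {a = 0} c-var) (c-mul {a = 0} {7} 1≤1 (c-weight (c-edge c-var c-var))
    (c-mul {a = 3} {3} 1≤1 (c-ker 1≤1 c-var (c-edge c-var c-var) c-var) (c-ker 1≤1 c-var (c-edge c-var c-var) c-var)))

  c-Uᵇ : ∀ {g f X es} → 1 ℕ.≤ length es → Cost (length es) Uᵇ (g ∷ f ∷ X ∷ es ∷ ρ) 14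
  c-Uᵇ 1≤m = c-add {a = 10} {3} 1≤m (c-div {a = 9} {0} 1≤m (c-app₃ {a = 0} {0} {0} {9} c-var c-var c-var c-S²ᵇ) c-var)
    (c-ker 1≤m c-var c-var c-var)

  c-Lᵇ : ∀ {g f X es} → 1 ℕ.≤ length es → Cost (length es) Lᵇ (g ∷ f ∷ X ∷ es ∷ ρ) 14
  c-Lᵇ 1≤m = c-sub {a = 10} {3} 1≤m (c-div {a = 9} {0} 1≤m (c-app₃ {a = 0} {0} {0} {9} c-var c-var c-var c-S²ᵇ) c-var)
    (c-ker 1≤m c-var c-var c-var)

  c-ceilᵇ : ∀ {es D} → 1 ℕ.≤ length es → Cost (length es) ceilᵇ (es ∷ D ∷ ρ) 2
  c-ceilᵇ 1≤m = c-fst {a = 2} (c-natrec {a = 0} {0} {2} (val-length val-var) 1 n*1≤ (c-length {a = 0} c-var) (c-pair {a = 0} {0} c-zero c-zeroᴿ)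
    (c-if {a = 1} {0} {1} (c-leq {a = 0} {0} 1≤1 c-var (c-snd {a = 0} c-var)) c-var
      (c-pair {a = 0} {1} (c-suc {a = 0} (c-fst {a = 0} c-var)) (c-add {a = 0} {0} 1≤1 c-one (c-snd {a = 0} c-var)))))

  c-pickᵇ : ∀ {es s l} → Cost (length es) pickᵇ (es ∷ s ∷ l ∷ ρ) 2
  c-pickᵇ = c-listrec {a = 0} {0} {2} val-var 1 n*1≤ c-var c-nil
    (c-if {a = 1} {0} {1} (c-leq {a = 0} {0} 1≤1 (c-nth c-zeroᴿ c-var (c-length {a = 0} c-var)) c-zeroᴿ) c-var
      (c-cons {a = 1} {0} (c-pair {a = 0} {1} (c-fst {a = 0} c-var)
        (c-div {a = 0} {0} 1≤1 (c-nth c-zeroᴿ c-var (c-length {a = 0} c-var)) c-var)) c-var))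

  c-real : {t : Γ ⊢ nat} {k : ℕ} → Val t ρ k → Cost B t ρ 0 → k ℕ.≤ B → Cost B (realᵗ t) ρ 1
  c-real v p h = c-natrec {a = 0} {0} {1} v 1 (ℕ.≤-trans n*1≤ h) p c-zeroᴿ (c-add {a = 0} {0} 1≤1 c-one c-var)

  module _ {n : ℕ} {es : List ⟦ edgeTy ⟧} (1≤n : 1 ℕ.≤ n) (1≤m : 1 ℕ.≤ length es) (m≤n² : length es ℕ.≤ n ℕ.* n) where

    private
      m = length es
      M = m ℕ.* (n ℕ.* n)

      1≤nn : 1 ℕ.≤ n ℕ.* n
      1≤nn = 1≤* 1≤n 1≤n
      m≤M : m ℕ.≤ M
      m≤M = ≤*ʳ m 1≤nn
      nn≤M : n ℕ.* n ℕ.≤ M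
      nn≤M = ≤*ˡ (n ℕ.* n) 1≤m
      1≤M : 1 ℕ.≤ M
      1≤M = 1≤* 1≤m 1≤nn

    c-stepᵇ : ∀ {st δ} → Cost M stepᵇ (st ∷ δ ∷ es ∷ n ∷ ρ) 104
    c-stepᵇ =
      c-let {a = 9} {95} (c-app₄ {a = 0} {0} {0} {0} {9} c-var c-var c-var (c-fst {a = 0} c-var) (c-shiftᵇ 1≤n))
      (c-let {a = 10} {85} (c-app₄ {a = 0} {0} {1} {0} {9} c-var c-var (c-sub {a = 0} {0} 1≤M c-zeroᴿ c-one)
        (c-fst {a = 0} (c-snd {a = 0} c-var)) (c-shiftᵇ 1≤n))
      (c-let {a = 11} {74} (c-sub {a = 5} {5} 1≤M (c-app₂ {a = 0} {0} {5} c-var (c-fst {a = 0} c-var) (weaken c-Φᵇ M m≤M)) (c-app₂ {a = 0} {0} {5} c-var c-var (weaken c-Φᵇ M m≤M)))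
      (c-let {a = 11} {63} (c-sub {a = 5} {5} 1≤M (c-app₂ {a = 0} {0} {5} c-var c-var (weaken c-Φᵇ M m≤M)) (c-app₂ {a = 0} {0} {5} c-var (c-fst {a = 0} (c-snd {a = 0} c-var)) (weaken c-Φᵇ M m≤M)))
      -- Each of the m tests costs O(m). The total m² stays within m n² because of `m≤n²`.
      (c-let {a = 29} {34} (c-natrec {a = 0} {0} {29} (val-length val-var) m (ℕ.*-monoʳ-≤ m m≤n²) (c-length {a = 0} c-var) c-zero
        (c-if {a = 29} {0} {0} (c-leq {a = 14} {14} 1≤m
          (c-app₄ {a = 0} {0} {0} {0} {14} c-var c-var c-var (c-edge c-var c-var) (c-Uᵇ 1≤m))
          (c-app₄ {a = 0} {0} {0} {0} {14} c-var c-var c-var (c-edge c-var c-var) (c-Lᵇ 1≤m))) c-var c-var))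
      (c-let {a = 15} {19} (c-div {a = 0} {14} 1≤M c-one (c-app₄ {a = 0} {0} {0} {0} {14} c-var c-var c-var (c-edge c-var c-var)
        (weaken (c-Uᵇ 1≤m) M m≤M)))
      (c-pair {a = 9} {10} (c-app₄ {a = 0} {0} {1} {0} {8} c-var c-var (c-sub {a = 0} {0} 1≤M c-zeroᴿ c-var) (c-edge c-var c-var)
          (weaken (c-rank1ᵇ 1≤n) M nn≤M))
      (c-pair {a = 8} {2} (c-app₄ {a = 0} {0} {0} {0} {8} c-var c-var c-var (c-edge c-var c-var)
          (weaken (c-rank1ᵇ 1≤n) M nn≤M))
        (weaken (c-tab {c = 2} (val-length val-var) 1 n*1≤ (c-length {a = 0} c-var) (c-add {a = 0} {1} 1≤1
          (c-nth c-zeroᴿ (c-snd {a = 0} (c-snd {a = 0} c-var)) c-var) (c-mul {a = 0} {0} 1≤1 c-var (c-delta c-var c-var)))) M m≤M))))))))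

    c-runᵇ : ∀ {X q a s D N d} → Cost ((n ℕ.+ q) ℕ.* M) runᵇ (X ∷ q ∷ a ∷ s ∷ D ∷ N ∷ d ∷ n ∷ es ∷ ρ) 111
    c-runᵇ {q = q} = c-natrec {a = 0} {7} {104} val-var M (ℕ.*-monoˡ-≤ M (ℕ.m≤n+m q n)) c-var
        (c-pair {a = 4} {3} (c-app₃ {a = 0} {3} {0} {1} c-var (c-div {a = 0} {2} 1≤B₀ c-one (c-mul {a = 0} {1} 1≤B₀ c-var
          (c-mul {a = 0} {0} 1≤B₀ c-var c-var))) c-var scale-cost)
        (c-pair {a = 3} {0} (c-app₃ {a = 0} {2} {0} {1} c-var (c-div {a = 0} {1} 1≤B₀ c-one (c-mul {a = 0} {0} 1≤B₀ c-var c-var)) c-var scale-cost)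
          (weaken (c-tab {c = 0} (val-length val-var) 1 n*1≤ (c-length {a = 0} c-var) c-zeroᴿ) B₀ (ℕ.≤-trans m≤M M≤B₀))))
        (c-app₄ {a = 0} {0} {0} {0} {104} c-var c-var c-var c-var c-stepᵇ)
      where
      B₀ = (n ℕ.+ q) ℕ.* M
      M≤B₀ : M ℕ.≤ B₀
      M≤B₀ = ≤*ˡ M (ℕ.≤-trans 1≤n (ℕ.m≤m+n n q))
      1≤B₀ = ℕ.≤-trans 1≤M M≤B₀
      scale-cost : ∀ {Δ} {ρ : Env Δ} {X a} → Cost B₀ scaleᵇ (X ∷ a ∷ n ∷ ρ) 1
      scale-cost = weaken (c-scaleᵇ 1≤n) B₀ (ℕ.≤-trans nn≤M M≤B₀)

    -- In the unit (n + q) M, the share n M accommodates Gram-Schmidt and q M the q steps; n also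
    -- keeps the unit positive for q = 0.
    c-searchᵇ : ∀ {D N d} → Cost ((n ℕ.+ steps# es D) ℕ.* M) searchᵇ (D ∷ N ∷ d ∷ n ∷ es ∷ ρ) 137
    c-searchᵇ {D = D} =
      c-let {a = 1} {136} (c-sqrt {a = 0} 1≤B₀ c-var)
      (c-let {a = 3} {133} (c-div {a = 1} {1} 1≤B₀ (c-add {a = 0} {0} 1≤B₀ c-var c-one) (c-sub {a = 0} {0} 1≤B₀ c-var c-one))
      (c-let= {a = 2} {131} (val-app₂ val-var val-var val-ceil) (c-app₂ {a = 0} {0} {2} c-var c-var (weaken (c-ceilᵇ 1≤m) B₀ m≤B₀))
      (c-let {a = 15} {116} (c-app₂ {a = 0} {0} {15} c-var c-var (weaken (c-gramᵇ 1≤n 1≤m) B₀ gram≤B₀))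
      (c-let {a = 111} {5} c-runᵇ
      (c-app₃ {a = 3} {0} {0} {2} (c-sub {a = 1} {1} 1≤B₀ (c-real val-var c-var q≤B₀) (c-mul {a = 0} {0} 1≤B₀ c-var c-var))
        (c-snd {a = 0} (c-snd {a = 0} c-var)) c-var (weaken c-pickᵇ B₀ m≤B₀))))))
      where
      q = steps# es D
      B₀ = (n ℕ.+ q) ℕ.* M
      M≤B₀ : M ℕ.≤ B₀
      M≤B₀ = ≤*ˡ M (ℕ.≤-trans 1≤n (ℕ.m≤m+n n q))
      1≤B₀ = ℕ.≤-trans 1≤M M≤B₀
      m≤B₀ = ℕ.≤-trans m≤M M≤B₀
      q≤B₀ : q ℕ.≤ B₀
      q≤B₀ = ℕ.≤-trans (ℕ.m≤n+m q n) (≤*ʳ _ 1≤M)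
      gram≤B₀ : n ℕ.* (n ℕ.* n ℕ.* m) ℕ.≤ B₀
      gram≤B₀ = ℕ.*-mono-≤ (ℕ.m≤m+n n q) (ℕ.≤-reflexive (ℕ.*-comm (n ℕ.* n) m))

    c-sparsify : ∀ d → Cost ((n ℕ.+ steps# es (d * (fromℕ n - 1#))) ℕ.* M) sparsify (d ∷ n ∷ es ∷ []) 142
    c-sparsify d =
      c-let= {a = 2} {140} (val-sub (val-real val-var) val-one) (c-sub {a = 1} {0} 1≤B₀ (c-real val-var c-var n≤B₀) c-one)
      (c-let= {a = 1} {139} (val-mul val-var val-var) (c-mul {a = 0} {0} 1≤B₀ c-var c-var)
      (c-if {a = 2} {0} {137} (c-leq {a = 1} {0} 1≤B₀ (c-real (val-length val-var) (c-length {a = 0} c-var) (ℕ.≤-trans m≤M M≤B₀)) c-var)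
        c-var c-searchᵇ))
      where
      q = steps# es (d * (fromℕ n - 1#))
      B₀ = (n ℕ.+ q) ℕ.* M
      M≤B₀ : M ℕ.≤ B₀
      M≤B₀ = ≤*ˡ M (ℕ.≤-trans 1≤n (ℕ.m≤m+n n q))
      1≤B₀ = ℕ.≤-trans 1≤M M≤B₀
      n≤B₀ : n ℕ.≤ B₀
      n≤B₀ = ℕ.≤-trans (ℕ.m≤m+n n q) (≤*ʳ _ 1≤M)

-- The number of edges that carry weight.

module Support (ℝ : Reals) where

  open Reals ℝ

  -- The test is the one by which the output edges are picked, so this is the length of the output.
  support : ℕ → (ℕ → Carrier) → ℕ
  support zero    s = 0
  support (suc k) s = if does (s k ≤? 0#) then support k s else suc (support k s)

  support-cong : ∀ k {s s′} → (∀ {e} → e ℕ.< k → s′ e ≡ s e) → support k s′ ≡ support k s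
  support-cong zero    eq = refl
  support-cong (suc k) eq = cong₂ (λ x y → if does (x ≤? 0#) then y else suc y) (eq ℕ.≤-refl)
    (support-cong k λ e<k → eq (ℕ.m<n⇒m<1+n e<k))

  support-zero : ∀ k {s} → (∀ {e} → e ℕ.< k → s e ≡ 0#) → support k s ≡ 0
  support-zero zero        eq = refl
  support-zero (suc k) {s} eq with s k ≤? 0#
  ... | yes _ = support-zero k λ e<k → eq (ℕ.m<n⇒m<1+n e<k)
  ... | no ¬p = contradiction (≤-reflexive (eq ℕ.≤-refl)) ¬p

  -- Each step moves weight onto one edge, so this bounds the number of edges by the number of
  -- steps.
  support-change : ∀ k g {s s′} → (∀ {e} → e ℕ.< k → e ≢ g → s′ e ≡ s e) → support k s′ ℕ.≤ suc (support k s)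
  support-change zero    g eq = ℕ.z≤n
  support-change (suc k) g {s} {s′} eq with k ℕ.≟ g
  ... | yes refl = ℕ.≤-trans (upper (does (s′ k ≤? 0#)) (support k s′))
    (ℕ.s≤s (ℕ.≤-trans (ℕ.≤-reflexive (support-cong k λ e<k → eq (ℕ.m<n⇒m<1+n e<k) (ℕ.<⇒≢ e<k)))
      (lower (does (s k ≤? 0#)) (support k s))))
    where
    upper : ∀ b n → (if b then n else suc n) ℕ.≤ suc n
    upper true  n = ℕ.n≤1+n n
    upper false n = ℕ.≤-refl
    lower : ∀ b n → n ℕ.≤ (if b then n else suc n)
    lower true  n = ℕ.≤-refl
    lower false n = ℕ.n≤1+n n
  ... | no k≢g rewrite eq ℕ.≤-refl k≢g = mono (does (s k ≤? 0#)) (support-change k g λ e<k → eq (ℕ.m<n⇒m<1+n e<k))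
    where
    mono : ∀ b {x y} → x ℕ.≤ suc y → (if b then x else suc x) ℕ.≤ suc (if b then y else suc y)
    mono true  p = p
    mono false p = ℕ.s≤s p

-- Matrices as lists of rows, and the search for an edge.

module Matrices (ℝ : Reals) where

  open Reals ℝ
  open Summation ℝ
  open Semantics ℝ
  open ListArrays

  δ#≡δ : ∀ i j → δ# i j ≡ δ i j
  δ#≡δ i j with ℕ.<-cmp i j
  ... | tri≈ _ refl _ rewrite ≤⇒≤ᵇ≡true (ℕ.≤-refl {i}) = sym (δ-refl i)
  ... | tri< i<j i≢j _ rewrite ≤⇒≤ᵇ≡true (ℕ.<⇒≤ i<j) | >⇒≤ᵇ≡false i<j = sym (δ-≢ i≢j)
  ... | tri> _ i≢j j<i rewrite >⇒≤ᵇ≡false j<i = sym (δ-≢ i≢j)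

  entry-matrix : ∀ n f {i j} → i ℕ.< n → j ℕ.< n → entry# (matrix# n f) i j ≡ f i j
  entry-matrix n f {i} {j} i<n j<n = trans (cong (λ row → at 0# row j) (at-tabulate [] (λ i → tabulate (f i) n) n i<n))
    (at-tabulate 0# (f i) n j<n)

  -- The fold keeps the largest index that passes. The assumed witness ensures that the default 0 is
  -- never returned without having passed the test.
  choose-min : ∀ (f g : ℕ → Carrier) m → (∃ λ k → k ℕ.< m × f k ≤ g k) →
               let r = natfold 0 (λ k r → if does (f k ≤? g k) then k else r) m in r ℕ.< m × f r ≤ g r
  choose-min f g (suc m) (k , ℕ.s≤s k≤m , fk≤gk) with f m ≤? g m | ℕ.m≤n⇒m<n∨m≡n k≤m
  ... | yes p | _         = ℕ.≤-refl , p
  ... | no ¬p | inj₂ refl = contradiction fk≤gk ¬p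
  ... | no ¬p | inj₁ k<m  with choose-min f g m (k , k<m , fk≤gk)
  ...   | r<m , p = ℕ.m<n⇒m<1+n r<m , p

  Valid : ℕ → Edge → Set
  Valid n e = src e ℕ.< tgt e × tgt e ℕ.< n × 0# < wt e

-- Kernels stored as vertex matrices, and the invariant of a step.

module EdgeKernels (ℝ : Reals) (n : ℕ) (es : List (Semantics.Edge ℝ)) (valid : All (Matrices.Valid ℝ n) es) where

  open Reals ℝ
  open OrderedField ℝ
  open Summation ℝ
  open Semantics ℝ
  open ListArrays
  open Matrices ℝ
  open Support ℝ

  valid-edge : ∀ {e} → e ℕ.< length es → Valid n (edge# es e)
  valid-edge = at-All _ valid

  tgt<n : ∀ {e} → e ℕ.< length es → tgt (edge# es e) ℕ.< n
  tgt<n e<m = proj₁ (proj₂ (valid-edge e<m))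

  src<n : ∀ {e} → e ℕ.< length es → src (edge# es e) ℕ.< n
  src<n e<m = ℕ.<-trans (proj₁ (valid-edge e<m)) (tgt<n e<m)

  D : (ℕ → Carrier) → ℕ → Carrier
  D y e = y (src (edge# es e)) - y (tgt (edge# es e))

  space : Space
  space = record
    { m       = length es
    ; W       = λ h → ∃ λ y → ∀ {e} → e ℕ.< length es → h e ≡ D y e
    ; W-comb  = λ { a b (y , h≡) (z , k≡) → (λ i → a * y i + b * z i) , λ {e} e<m →
        trans (cong₂ (λ p q → a * p + b * q) (h≡ e<m) (k≡ e<m))
          (solve 6 (λ a b p q r s → a :* (p :- q) :+ b :* (r :- s) := a :* p :+ b :* r :- (a :* q :+ b :* s)) refl
            a b (y (src (edge# es e))) (y (tgt (edge# es e))) (z (src (edge# es e))) (z (tgt (edge# es e)))) }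
    ; W-≗     = λ { h≡k (y , h≡) → y , λ e<m → trans (sym (h≡k _)) (h≡ e<m) }
    -- The unit potential at the source has difference 1 along the edge because the endpoints are
    -- distinct.
    ; W-ample = λ {e} e<m → D (δ (src (edge# es e))) , (δ (src (edge# es e)) , λ _ → refl) ,
        trans (cong₂ _-_ (δ-refl (src (edge# es e))) (δ-≢ (ℕ.<⇒≢ (proj₁ (valid-edge e<m)))))
          (solve 0 (𝟙 :- 𝟘 := 𝟙) refl)
    ; w       = λ e → wt (edge# es e)
    ; w-pos   = λ e<m → proj₂ (proj₂ (valid-edge e<m))
    }

  open Kernels ℝ space public
  open Barriers ℝ space

  K : Mat → ℕ → ℕ → Carrier
  K X e f = ker# X (edge# es e) (edge# es f)

  opaque
    unfolding ker#

    K-section : ∀ X f → W (λ e → K X e f)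
    K-section X f = column# X (edge# es f) , λ _ → refl

    K-matrix : ∀ f {e g} → e ℕ.< m → g ℕ.< m → K (matrix# n f) e g
               ≡ D (λ i → f i (src (edge# es g)) - f i (tgt (edge# es g))) e
    K-matrix f e<m g<m = cong₂ _-_
      (cong₂ _-_ (entry-matrix n f (src<n e<m) (src<n g<m)) (entry-matrix n f (src<n e<m) (tgt<n g<m)))
      (cong₂ _-_ (entry-matrix n f (tgt<n e<m) (src<n g<m)) (entry-matrix n f (tgt<n e<m) (tgt<n g<m)))

    K-add : ∀ X (q : ℕ → Carrier) k {e f} → e ℕ.< m → f ℕ.< m →
            K (matrix# n λ i j → entry# X i j + q i * q j * k) e f ≡ K X e f + D q e * D q f * k
    K-add X q k {e} {f} e<m f<m = trans (K-matrix _ e<m f<m) (expand _ _ _ _ _ _ _ _ _)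
      where
      expand : ∀ a b c d k p q r s → ((a + p * r * k) - (b + p * s * k)) - ((c + q * r * k) - (d + q * s * k))
               ≡ ((a - b) - (c - d)) + (p - q) * (r - s) * k
      expand = solve 9 (λ a b c d k p q r s →
        ((a :+ p :* r :* k) :- (b :+ p :* s :* k)) :- ((c :+ q :* r :* k) :- (d :+ q :* s :* k))
        := ((a :- b) :- (c :- d)) :+ (p :- q) :* (r :- s) :* k) refl

    K-scale : ∀ a X {e f} → e ℕ.< m → f ℕ.< m → K (matrix# n λ i j → a * entry# X i j) e f ≡ a * K X e f
    K-scale a X e<m f<m = trans (K-matrix _ e<m f<m) (expand a _ _ _ _)
      where
      expand : ∀ k a b c d → (k * a - k * b) - (k * c - k * d) ≡ k * ((a - b) - (c - d))
      expand = solve 5 (λ k a b c d → (k :* a :- k :* b) :- (k :* c :- k :* d) := k :* ((a :- b) :- (c :- d))) refl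

  matrix-cong : ∀ {f g} → (∀ {i j} → i ℕ.< n → j ℕ.< n → f i j ≡ g i j) →
                ∀ {e e′} → e ℕ.< m → e′ ℕ.< m → K (matrix# n f) e e′ ≡ K (matrix# n g) e e′
  matrix-cong f≡g e<m e′<m = trans (K-matrix _ e<m e′<m) (trans (cong₂ _-_
    (cong₂ _-_ (f≡g (src<n e<m) (src<n e′<m)) (f≡g (src<n e<m) (tgt<n e′<m)))
    (cong₂ _-_ (f≡g (tgt<n e<m) (src<n e′<m)) (f≡g (tgt<n e<m) (tgt<n e′<m)))) (sym (K-matrix _ e<m e′<m)))

  kernel-≗ : ∀ {c L} X → (∀ {e f} → e ℕ.< m → f ℕ.< m → K X e f ≡ L e f) → Kernel c L → Kernel c (K X)
  kernel-≗ {c} X K≡L κ = record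
    { section = λ {f} _ → K-section X f
    ; symm    = λ e<m f<m → trans (K≡L e<m f<m) (trans (symm κ e<m f<m) (sym (K≡L f<m e<m)))
    ; repro   = λ {h} wh f<m → trans (∑-cong m λ {e} e<m → cong (λ x → c e * (h e * x)) (K≡L e<m f<m)) (repro κ wh f<m) }

  Φ-≗ : ∀ {L L′} → (∀ {e f} → e ℕ.< m → f ℕ.< m → L e f ≡ L′ e f) → Φ L ≡ Φ L′
  Φ-≗ L≡L′ = ∑-cong m λ {e} e<m → cong (w e *_) (L≡L′ e<m e<m)

  opaque
    unfolding ker# rank1#

    K-rank1 : ∀ X c {g} → g ℕ.< m → ∀ {e f} → e ℕ.< m → f ℕ.< m →
              K (rank1# n X c (edge# es g)) e f ≡ rank1 (K X) g c e f
    K-rank1 X c {g} g<m {e} {f} e<m f<m = trans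
      (matrix-cong {g = λ i j → entry# X i j + p i * p j * - k} (λ {i} {j} i<n j<n → trans
        (cong₂ (λ x y → entry# X i j - x * y)
          (cong (λ x → c / (1# + c * x)) (cong₂ _-_ (P-at (src<n g<m)) (P-at (tgt<n g<m))))
          (cong₂ _*_ (P-at i<n) (P-at j<n)))
        (solve 4 (λ x k p q → x :- k :* (p :* q) := x :+ p :* q :* :- k) refl (entry# X i j) k (p i) (p j))) e<m f<m)
      (trans (K-add X p (- k) e<m f<m)
        (solve 4 (λ x k p q → x :+ p :* q :* :- k := x :- k :* (p :* q)) refl (K X e f) k (D p e) (D p f)))
      where
      p : ℕ → Carrier
      p = column# X (edge# es g)
      k : Carrier
      k = c / (1# + c * K X g g)
      P-at : ∀ {i} → i ℕ.< n → at 0# (tabulate p n) i ≡ p i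
      P-at = at-tabulate 0# p n

  -- The weights after k of the m updates by which a barrier is raised. Sherman-Morrison needs
  -- definiteness at each of these intermediate stages.
  partial : (ℕ → Carrier) → Carrier → ℕ → ℕ → Carrier
  partial c a zero    = c
  partial c a (suc k) = bump (partial c a k) k (a * w k)

  bump-≢ : ∀ c {g t e} → e ≢ g → bump c g t e ≡ c e
  bump-≢ c {g} {t} {e} e≢g = trans (cong (λ d → c e + t * d) (δ-≢ λ g≡e → e≢g (sym g≡e)))
    (solve 2 (λ c t → c :+ t :* 𝟘 := c) refl (c e) t)

  partial-≥ : ∀ c a k {e} → k ℕ.≤ e → partial c a k e ≡ c e
  partial-≥ c a zero    k≤e = refl
  partial-≥ c a (suc k) k<e = trans (bump-≢ (partial c a k) (ℕ.>⇒≢ k<e)) (partial-≥ c a k (ℕ.<⇒≤ k<e))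

  partial-< : ∀ c a k {e} → e ℕ.< k → partial c a k e ≡ c e + a * w e
  partial-< c a (suc k) (ℕ.s≤s e≤k) with ℕ.m≤n⇒m<n∨m≡n e≤k
  ... | inj₁ e<k  = trans (bump-≢ (partial c a k) (ℕ.<⇒≢ e<k)) (partial-< c a k e<k)
  ... | inj₂ refl = cong₂ _+_ (partial-≥ c a k ℕ.≤-refl)
    (trans (cong (a * w k *_) (δ-refl k)) (*-identityʳ _))

  -- Every weight is either still old or already new, so a bound on these two values holds at all
  -- stages.
  partial-elim : ∀ c a (P : Carrier → Set) k {e} → P (c e) → P (c e + a * w e) → P (partial c a k e)
  partial-elim c a P k {e} p q with e ℕ.<? k
  ... | yes e<k = subst P (sym (partial-< c a k e<k)) q
  ... | no e≮k  = subst P (sym (partial-≥ c a k (ℕ.≮⇒≥ e≮k))) p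

  opaque
    unfolding shift#

    shift-kernel : ∀ {c} a X → (∀ k → PosDef (partial c a k)) → Kernel c (K X) →
                   Kernel (λ e → c e + a * w e) (K (shift# n es a X))
    shift-kernel {c} a X pd κ = kernel-cong (partial-< c a m)
      (natfold-ind (λ k Z → Kernel (partial c a k) (K Z)) m κ
        (λ {k} {Z} k<m κ′ → kernel-≗ (rank1# n Z (a * w k) (edge# es k)) (K-rank1 Z (a * w k) k<m)
          (rank1-kernel κ′ k<m (pd (suc k)))))

  raise-kernel : ∀ {c a X} → 0# ≤ a → PosDef c → Kernel c (K X) →
                 PosDef (λ e → c e + a * w e) × Kernel (λ e → c e + a * w e) (K (shift# n es a X))
  raise-kernel {c} {a} {X} 0≤a pd κ = posDef-mono up pd , shift-kernel a X
      (λ k → posDef-mono (λ {e} e<m → partial-elim c a (c e ≤_) k ≤-refl (up e<m)) pd) κ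
    where
    up : ∀ {e} → e ℕ.< m → c e ≤ c e + a * w e
    up e<m = ≤-by (*-nonneg 0≤a (proj₁ (w-pos e<m))) refl

  -- Here the weights decrease, so the last stage is the smallest form. Its definiteness follows
  -- from the potential being below 1 and passes up to the intermediate stages.
  lower-kernel : ∀ {c X} → Φ (K X) < 1# → PosDef c → Kernel c (K X) →
                 PosDef (λ e → c e + - 1# * w e) × Kernel (λ e → c e + - 1# * w e) (K (shift# n es (0# - 1#) X))
  lower-kernel {c} {X} Φ<1 pd κ = pd′ , kernel-cong (λ {e} _ → eq e) (shift-kernel (0# - 1#) X
      (λ k → posDef-mono (λ {e} e<m → partial-elim c (0# - 1#) (_ ≤_) k (down e<m) (≤-reflexive (sym (eq e)))) pd′) κ)
    where
    eq : ∀ e → c e + (0# - 1#) * w e ≡ c e + - 1# * w e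
    eq e = cong (λ x → c e + x * w e) (+-identityˡ (- 1#))
    pd′ : PosDef (λ e → c e + - 1# * w e)
    pd′ = posDef-lower κ pd (λ _ → refl) Φ<1
    down : ∀ {e} → e ℕ.< m → c e + - 1# * w e ≤ c e
    down {e} e<m = ≤-by (proj₁ (w-pos e<m)) (solve 2 (λ c w → c := c :+ :- 𝟙 :* w :+ w) refl (c e) (w e))

  opaque
    unfolding Φ#

    Φ-val : ∀ X → Φ# es X ≡ Φ (K X)
    Φ-val X = refl

  opaque
    unfolding S²#

    S²-val : ∀ X g → S²# es X (edge# es g) ≡ S² (K X) g
    S²-val X g = refl

  opaque
    unfolding choose#

    choose-val : ∀ X Y fu fl →
      (∃ λ k → k ℕ.< m × U# es X fu (edge# es k) ≤ L# es Y fl (edge# es k)) →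
      let g = choose# es X Y fu fl in g ℕ.< m × U# es X fu (edge# es g) ≤ L# es Y fl (edge# es g)
    choose-val X Y fu fl = choose-min (λ k → U# es X fu (edge# es k)) (λ k → L# es Y fl (edge# es k)) m

  opaque
    unfolding bump#

    bump-val : ∀ s g t {e} → e ℕ.< m → at 0# (bump# es s g t) e ≡ bump (at 0# s) g t e
    bump-val s g t {e} e<m = trans (at-tabulate 0# _ m e<m) (cong (λ d → at 0# s e + t * d) (δ#≡δ g e))

  -- The two barriers: l w < s < u w as quadratic forms on W.
  record Invariant (εᵤ εₗ u l : Carrier) (st : State) : Set where
    field
      upper    : Kernel (λ e → u * w e - at 0# (proj₂ (proj₂ st)) e) (K (proj₁ st))
      upper-pd : PosDef (λ e → u * w e - at 0# (proj₂ (proj₂ st)) e)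
      upper-Φ  : Φ (K (proj₁ st)) ≤ εᵤ
      lower    : Kernel (λ e → at 0# (proj₂ (proj₂ st)) e - l * w e) (K (proj₁ (proj₂ st)))
      lower-pd : PosDef (λ e → at 0# (proj₂ (proj₂ st)) e - l * w e)
      lower-Φ  : Φ (K (proj₁ (proj₂ st))) ≤ εₗ
      s-nonneg : ∀ {e} → e ℕ.< m → 0# ≤ at 0# (proj₂ (proj₂ st)) e

  module _ {d εᵤ εₗ : Carrier} (0<m : 0 ℕ.< m) (0<d : 0# < d) (εₗ<1 : εₗ < 1#)
           (budget : d ⁻¹ + εᵤ ≤ 1# - εₗ) {u l : Carrier} {X Y : Mat} {sₗ : List Carrier}
           (inv : Invariant εᵤ εₗ u l (X , Y , sₗ)) where

    private
      module I = Invariant inv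

      s : ℕ → Carrier
      s = at 0# sₗ

      X′ Y′ : Mat
      X′ = shift# n es d X
      Y′ = shift# n es (0# - 1#) Y

      raised : PosDef (λ e → u * w e - s e + d * w e) × Kernel (λ e → u * w e - s e + d * w e) (K X′)
      raised = raise-kernel (proj₁ 0<d) I.upper-pd I.upper

      lowered : PosDef (λ e → s e - l * w e + - 1# * w e) × Kernel (λ e → s e - l * w e + - 1# * w e) (K Y′)
      lowered = lower-kernel (≤-<-trans I.lower-Φ εₗ<1) I.lower-pd I.lower

      shifted : Shifted (K X) (K X′) (K Y) (K Y′)
      shifted = record
        { c≡ = λ _ → refl ; b≡ = λ _ → refl
        ; κ₀ = I.upper ; κ = proj₂ raised ; ι₀ = I.lower ; ι = proj₂ lowered
        ; pd-c₀ = I.upper-pd ; pd-c = proj₁ raised ; pd-b₀ = I.lower-pd ; pd-b = proj₁ lowered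
        ; 0<m = 0<m ; 0<a = 0<d ; ΦJ₀≤1 = ≤-trans I.lower-Φ (proj₁ εₗ<1)
        ; budget = ≤-trans (+-mono-≤ ≤-refl I.upper-Φ) (≤-trans budget
            (≤-by (≤⇒0≤- I.lower-Φ) (solve 2 (λ p e → 𝟙 :- p := 𝟙 :- e :+ (e :- p)) refl (Φ (K Y)) εₗ)))
        }

      module C = Choice shifted

      fu fl : Carrier
      fu = Φ# es X - Φ# es X′
      fl = Φ# es Y′ - Φ# es Y

      fu≡ : fu ≡ C.fu
      fu≡ = cong₂ _-_ (Φ-val X) (Φ-val X′)

      fl≡ : fl ≡ C.fl
      fl≡ = cong₂ _-_ (Φ-val Y′) (Φ-val Y)

      U≡ : ∀ g → U# es X′ fu (edge# es g) ≡ C.U g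
      U≡ g = cong₂ (λ x y → x / y + K X′ g g) (S²-val X′ g) fu≡

      L≡ : ∀ g → L# es Y′ fl (edge# es g) ≡ C.L g
      L≡ g = cong₂ (λ x y → x / y - K Y′ g g) (S²-val Y′ g) fl≡

      g : ℕ
      g = choose# es X′ Y′ fu fl

      good : g ℕ.< m × C.U g ≤ C.L g
      good = proj₁ chosen , subst₂ _≤_ (U≡ g) (L≡ g) (proj₂ chosen)
        where
        candidate = C.good-exists
        chosen = choose-val X′ Y′ fu fl (proj₁ candidate , proj₁ (proj₂ candidate) ,
          subst₂ _≤_ (sym (U≡ (proj₁ candidate))) (sym (L≡ (proj₁ candidate))) (proj₂ (proj₂ candidate)))

      g<m : g ℕ.< m
      g<m = proj₁ good

      module G = C.Good g<m (proj₂ good)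

      t : Carrier
      t = 1# / U# es X′ fu (edge# es g)

      t≡ : t ≡ G.t
      t≡ = cong (1# /_) (U≡ g)

      next : State
      next = move# n es X′ Y′ sₗ g t

      s′≡ : ∀ {e} → e ℕ.< m → at 0# (bump# es sₗ g t) e ≡ bump s g G.t e
      s′≡ {e} e<m = trans (bump-val sₗ g t e<m) (cong (λ x → bump s g x e) t≡)

      upper-weights : ∀ {e} → e ℕ.< m →
        bump (λ e → u * w e - s e + d * w e) g (0# - G.t) e ≡ (u + d) * w e - at 0# (bump# es sₗ g t) e
      upper-weights {e} e<m = trans
        (solve 6 (λ u w s d t x → u :* w :- s :+ d :* w :+ (𝟘 :- t) :* x := (u :+ d) :* w :- (s :+ t :* x)) refl
          u (w e) (s e) d G.t (δ g e))
        (cong (λ x → (u + d) * w e - x) (sym (s′≡ e<m)))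

      lower-weights : ∀ {e} → e ℕ.< m →
        bump (λ e → s e - l * w e + - 1# * w e) g G.t e ≡ at 0# (bump# es sₗ g t) e - (l + 1#) * w e
      lower-weights {e} e<m = trans
        (solve 5 (λ l w s t x → s :- l :* w :+ :- 𝟙 :* w :+ t :* x := s :+ t :* x :- (l :+ 𝟙) :* w) refl
          l (w e) (s e) G.t (δ g e))
        (cong (_- (l + 1#) * w e) (sym (s′≡ e<m)))

      X″≡ : ∀ {e f} → e ℕ.< m → f ℕ.< m → K (proj₁ next) e f ≡ rank1 (K X′) g (0# - G.t) e f
      X″≡ {e} {f} e<m f<m = trans (K-rank1 X′ (0# - t) g<m e<m f<m) (cong (λ x → rank1 (K X′) g (0# - x) e f) t≡)

      Y″≡ : ∀ {e f} → e ℕ.< m → f ℕ.< m → K (proj₁ (proj₂ next)) e f ≡ rank1 (K Y′) g G.t e f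
      Y″≡ {e} {f} e<m f<m = trans (K-rank1 Y′ t g<m e<m f<m) (cong (λ x → rank1 (K Y′) g x e f) t≡)

    opaque
      unfolding step#

      -- In this block `d` is the amount by which u is raised, later `growth#` of the root, and not
      -- the density parameter of the theorem.
      step-invariant : Invariant εᵤ εₗ (u + d) (l + 1#) (step# n es d (X , Y , sₗ))
      step-invariant = record
        { upper    = kernel-cong upper-weights (kernel-≗ (proj₁ next) X″≡ (rank1-kernel (proj₂ raised) g<m G.upper-posDef))
        ; upper-pd = posDef-mono (λ e<m → ≤-reflexive (upper-weights e<m)) G.upper-posDef
        ; upper-Φ  = ≤-trans (≤-reflexive (Φ-≗ X″≡)) (≤-trans G.upper-Φ I.upper-Φ)
        ; lower    = kernel-cong lower-weights (kernel-≗ (proj₁ (proj₂ next)) Y″≡ (rank1-kernel (proj₂ lowered) g<m G.lower-posDef))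
        ; lower-pd = posDef-mono (λ e<m → ≤-reflexive (lower-weights e<m)) G.lower-posDef
        ; lower-Φ  = ≤-trans (≤-reflexive (Φ-≗ Y″≡)) (≤-trans G.lower-Φ I.lower-Φ)
        ; s-nonneg = λ {e} e<m → subst (0# ≤_) (sym (s′≡ e<m))
            (0≤+ (I.s-nonneg e<m) (*-nonneg (proj₁ G.t-pos) (δ-nonneg g e)))
        }

  bump-support : ∀ s g t → support m (at 0# (bump# es s g t)) ℕ.≤ suc (support m (at 0# s))
  bump-support s g t = support-change m g λ e<m e≢g → trans (bump-val s g t e<m) (bump-≢ (at 0# s) e≢g)

  opaque
    unfolding step#

    step-support : ∀ d X Y s → support m (at 0# (proj₂ (proj₂ (step# n es d (X , Y , s))))) ℕ.≤ suc (support m (at 0# s))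
    step-support d X Y s = bump-support s _ _

-- Gram-Schmidt and the initial kernel.

module GramSchmidt (ℝ : Reals) (n : ℕ) (es : List (Semantics.Edge ℝ)) (valid : All (Matrices.Valid ℝ n) es) where

  open Reals ℝ
  open OrderedField ℝ
  open Summation ℝ
  open Semantics ℝ
  open ListArrays
  open Matrices ℝ
  open EdgeKernels ℝ n es valid
  open ≡-Reasoning

  form-comm : ∀ c h k → form c h k ≡ form c k h
  form-comm c h k = ∑-cong m λ {e} _ → cong (c e *_) (*-comm (h e) (k e))

  form-≗ : ∀ c h {k k′} → (∀ {e} → e ℕ.< m → k e ≡ k′ e) → form c h k ≡ form c h k′
  form-≗ c h k≡ = ∑-cong m λ {e} e<m → cong (λ x → c e * (h e * x)) (k≡ e<m)

  form-lin : ∀ c h a r b → form c h (λ e → a e + r * b e) ≡ form c h a + r * form c h b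
  form-lin c h a r b = trans (∑-cong m λ {e} _ →
      solve 5 (λ c h a r b → c :* (h :* (a :+ r :* b)) := c :* (h :* a) :+ r :* (c :* (h :* b))) refl (c e) (h e) (a e) r (b e))
    (trans (∑-+ m _ _) (cong (form c h a +_) (∑-* m r _)))

  form-zero : ∀ c h {k} → (∀ {e} → e ℕ.< m → k e ≡ 0#) → form c h k ≡ 0#
  form-zero c h k≡0 = trans (∑-cong m λ {e} e<m → trans (cong (λ x → c e * (h e * x)) (k≡0 e<m))
    (solve 2 (λ c h → c :* (h :* 𝟘) := 𝟘) refl (c e) (h e))) (∑-0 m)

  -- A symmetric kernel acts as a self-adjoint operator for the form: exchange of summations and
  -- symmetry.
  form-swap : ∀ {L : ℕ → ℕ → Carrier} → (∀ {e f} → e ℕ.< m → f ℕ.< m → L e f ≡ L f e) → ∀ c a b →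
              form c a (λ f → form c b (λ h → L h f)) ≡ form c b (λ h → form c a (λ f → L f h))
  form-swap {L} symm c a b = begin
    form c a (λ f → form c b (λ h → L h f))
      ≡⟨ ∑-cong m (λ {f} _ → push (c f) (a f) (λ h → c h * (b h * L h f))) ⟩
    ∑< m (λ f → ∑< m (λ h → c f * (a f * (c h * (b h * L h f)))))
      ≡⟨ ∑-swap m m _ ⟩
    ∑< m (λ h → ∑< m (λ f → c f * (a f * (c h * (b h * L h f)))))
      ≡⟨ ∑-cong m (λ {h} h<m → trans (∑-cong m λ {f} f<m → trans
           (cong (λ x → c f * (a f * (c h * (b h * x)))) (symm h<m f<m))
           (solve 5 (λ p q r s x → p :* (q :* (r :* (s :* x))) := r :* (s :* (p :* (q :* x)))) refl (c f) (a f) (c h) (b h) (L f h)))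
           (sym (push (c h) (b h) (λ f → c f * (a f * L f h))))) ⟩
    form c b (λ h → form c a (λ f → L f h)) ∎
    where
    push : ∀ x y g → x * (y * ∑< m g) ≡ ∑< m (λ i → x * (y * g i))
    push x y g = trans (cong (x *_) (sym (∑-* m y g))) (sym (∑-* m x _))

  posDef-w : PosDef w
  posDef-w = record
    { nonneg   = λ {h} _ → ∑-nonneg m λ {e} e<m → *-nonneg (proj₁ (w-pos e<m)) (square-nonneg (h e))
    ; definite = λ {h} _ f≡0 {e} e<m → square-zero (*-cancel-0 (>⇒≢ (w-pos e<m)) (antisym
        (subst (w e * (h e * h e) ≤_) f≡0
          (term≤∑ m (λ {i} i<m → *-nonneg (proj₁ (w-pos i<m)) (square-nonneg (h i))) e<m))
        (*-nonneg (proj₁ (w-pos e<m)) (square-nonneg (h e))))) }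

  -- X represents the orthogonal projection onto a subspace containing the first k unit vectors,
  -- for the Laplacian form.
  record Projection (k : ℕ) (X : Mat) : Set where
    field
      symmetric  : ∀ {e f} → e ℕ.< m → f ℕ.< m → K X e f ≡ K X f e
      idempotent : ∀ {e f} → e ℕ.< m → f ℕ.< m → form w (λ h → K X h e) (λ h → K X h f) ≡ K X e f
      contains   : ∀ {j} → j ℕ.< k → ∀ {f} → f ℕ.< m → form w (D (δ j)) (λ h → K X h f) ≡ D (δ j) f
      trace      : Φ (K X) ≤ fromℕ k

  K-0 : ∀ {e f} → e ℕ.< m → f ℕ.< m → K (matrix# n λ _ _ → 0#) e f ≡ 0#
  K-0 e<m f<m = trans (K-matrix _ e<m f<m) (solve 0 (𝟘 :- 𝟘 :- (𝟘 :- 𝟘) := 𝟘) refl)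

  zero-projection : Projection 0 (matrix# n λ _ _ → 0#)
  zero-projection = record
    { symmetric  = λ e<m f<m → trans (K-0 e<m f<m) (sym (K-0 f<m e<m))
    ; idempotent = λ e<m f<m → trans (form-zero w _ λ h<m → K-0 h<m f<m) (sym (K-0 e<m f<m))
    ; contains   = λ ()
    ; trace      = ≤-reflexive (trans (∑-cong m λ {e} e<m → trans (cong (w e *_) (K-0 e<m e<m)) (zeroʳ _)) (∑-0 m))
    }

  module _ {k X} (pr : Projection k X) where

    open Projection pr

    private
      g z : ℕ → Carrier
      g = D (δ k)
      z e = g e - form w g (λ h → K X h e)

      c : Carrier
      c = form w z z

    private
      q : ℕ → Carrier
      q i = δ# k i - ∑< m λ f → w f * ((δ# k (src (edge# es f)) - δ# k (tgt (edge# es f))) * column# X (edge# es f) i)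

      y : List Carrier
      y = residual# n es k X

    opaque
      unfolding residual# ker#

      y-at : ∀ {i} → i ℕ.< n → at 0# y i ≡ q i
      y-at = at-tabulate 0# q n

      -- Identifies the residual computed on vertices with `z`, defined on edges. The program reads
      -- the entry K_ef where the projection has K_fe, hence the use of symmetry.
      D-q : ∀ {e} → e ℕ.< m → D q e ≡ z e
      D-q {e} e<m = begin
        δ# k u - ∑< m (λ f → s f u) - (δ# k v - ∑< m (λ f → s f v))
          ≡⟨ solve 4 (λ a p b r → a :- p :- (b :- r) := a :- b :- (p :+ :- 𝟙 :* r)) refl
               (δ# k u) _ (δ# k v) _ ⟩
        δ# k u - δ# k v - (∑< m (λ f → s f u) + - 1# * ∑< m (λ f → s f v))
          ≡⟨ cong₂ _-_ (cong₂ _-_ (δ#≡δ k u) (δ#≡δ k v)) (begin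
               ∑< m (λ f → s f u) + - 1# * ∑< m (λ f → s f v)
                 ≡⟨ trans (cong (∑< m (λ f → s f u) +_) (sym (∑-* m (- 1#) _))) (sym (∑-+ m _ _)) ⟩
               ∑< m (λ f → s f u + - 1# * s f v)
                 ≡⟨ ∑-cong m (λ {f} f<m → trans
                      (solve 4 (λ w d a b → w :* (d :* a) :+ :- 𝟙 :* (w :* (d :* b)) := w :* (d :* (a :- b))) refl
                        (w f) (δ# k (src (edge# es f)) - δ# k (tgt (edge# es f))) _ _)
                      (cong₂ (λ d x → w f * (d * x)) (cong₂ _-_ (δ#≡δ k _) (δ#≡δ k _)) (symmetric e<m f<m))) ⟩
               form w g (λ f → K X f e) ∎) ⟩
        z e ∎
        where
        u v : ℕ
        u = src (edge# es e)
        v = tgt (edge# es e)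
        s : ℕ → ℕ → Carrier
        s f i = w f * ((δ# k (src (edge# es f)) - δ# k (tgt (edge# es f))) * column# X (edge# es f) i)

    private
      z∈W : W z
      z∈W = q , λ e<m → sym (D-q e<m)

      z≡ : ∀ e → z e ≡ g e + - 1# * form w g (λ h → K X h e)
      z≡ e = solve 2 (λ a b → a :- b := a :+ :- 𝟙 :* b) refl (g e) _

      form-z : ∀ h → form w h z ≡ form w h g + - 1# * form w h (λ e → form w g (λ h → K X h e))
      form-z h = trans (form-≗ w h λ {e} _ → z≡ e) (form-lin w h g (- 1#) _)

      -- Writing P for the projection, z = g - P g, and P is self-adjoint and idempotent, so P z = P
      -- g - P g.
      z⊥K : ∀ {e} → e ℕ.< m → form w z (λ h → K X h e) ≡ 0#
      z⊥K {e} e<m = begin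
        form w z (λ h → K X h e)                           ≡⟨ form-comm w z _ ⟩
        form w (λ h → K X h e) z                           ≡⟨ form-z _ ⟩
        form w (λ h → K X h e) g + - 1# * form w (λ h → K X h e) (λ f → form w g (λ h → K X h f))
          ≡⟨ cong₂ (λ x y → x + - 1# * y) (form-comm w _ g) (trans (form-swap symmetric w (λ h → K X h e) g)
               (form-≗ w g λ h<m → trans (idempotent e<m h<m) (symmetric e<m h<m))) ⟩
        form w g (λ h → K X h e) + - 1# * form w g (λ h → K X h e)
          ≡⟨ solve 1 (λ x → x :+ :- 𝟙 :* x := 𝟘) refl _ ⟩
        0# ∎

      z⊥ : ∀ a → form w z (λ f → form w a (λ h → K X h f)) ≡ 0#
      z⊥ a = trans (form-swap symmetric w z a) (form-zero w a z⊥K)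

      -- g and z differ by P g, which is orthogonal to z.
      z·g : form w z g ≡ c
      z·g = sym (trans (form-z z) (trans (cong (λ x → form w z g + - 1# * x) (z⊥ g))
        (solve 1 (λ x → x :+ :- 𝟙 :* 𝟘 := x) refl (form w z g))))

      z·contained : ∀ {j} → j ℕ.< k → form w z (D (δ j)) ≡ 0#
      z·contained {j} j<k = trans (form-≗ w z λ f<m → sym (contains j<k f<m)) (z⊥ (D (δ j)))

    module _ {X′ : Mat} (X′≡ : ∀ {e f} → e ℕ.< m → f ℕ.< m → K X′ e f ≡ K X e f + z e * z f * c ⁻¹) (c≢0 : c ≢ 0#) where

      private
        i = c ⁻¹

        col : ∀ {f} → f ℕ.< m → ∀ {e} → e ℕ.< m → K X′ e f ≡ K X e f + z f * i * z e
        col {f} f<m {e} e<m = trans (X′≡ e<m f<m)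
          (solve 4 (λ k x y i → k :+ x :* y :* i := k :+ y :* i :* x) refl (K X e f) (z e) (z f) i)

        form-col : ∀ h {f} → f ℕ.< m → form w h (λ e → K X′ e f) ≡ form w h (λ e → K X e f) + z f * i * form w h z
        form-col h {f} f<m = trans (form-≗ w h (col f<m)) (form-lin w h (λ e → K X e f) (z f * i) z)

        c*i : c * i ≡ 1#
        c*i = *-inverseʳ c c≢0

      extended : Projection (suc k) X′
      extended = record { symmetric = sy ; idempotent = ide ; contains = con′ ; trace = tr }
        where
        sy : ∀ {e f} → e ℕ.< m → f ℕ.< m → K X′ e f ≡ K X′ f e
        sy {e} {f} e<m f<m = trans (X′≡ e<m f<m) (trans
          (cong₂ (λ x y → x + y * i) (symmetric e<m f<m) (*-comm (z e) (z f))) (sym (X′≡ f<m e<m)))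

        ide : ∀ {e f} → e ℕ.< m → f ℕ.< m → form w (λ h → K X′ h e) (λ h → K X′ h f) ≡ K X′ e f
        ide {e} {f} e<m f<m = begin
          form w (λ h → K X′ h e) (λ h → K X′ h f)
            ≡⟨ form-col (λ h → K X′ h e) f<m ⟩
          form w (λ h → K X′ h e) (λ h → K X h f) + z f * i * form w (λ h → K X′ h e) z
            ≡⟨ cong₂ (λ x y → x + z f * i * y)
                 (trans (form-comm w _ _) (form-col (λ h → K X h f) e<m)) (trans (form-comm w _ _) (form-col z e<m)) ⟩
          form w (λ h → K X h f) (λ h → K X h e) + z e * i * form w (λ h → K X h f) z
            + z f * i * (form w z (λ h → K X h e) + z e * i * c)
            ≡⟨ cong₂ (λ x y → x + z f * i * y)
                 (cong₂ (λ x y → x + z e * i * y) (idempotent f<m e<m) (trans (form-comm w _ z) (z⊥K f<m)))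
                 (cong (_+ z e * i * c) (z⊥K e<m)) ⟩
          K X f e + z e * i * 0# + z f * i * (0# + z e * i * c)
            ≡⟨ solve 5 (λ k x y i c → k :+ x :* i :* 𝟘 :+ y :* i :* (𝟘 :+ x :* i :* c) := k :+ x :* y :* i :* (c :* i)) refl
                 (K X f e) (z e) (z f) i c ⟩
          K X f e + z e * z f * i * (c * i)
            ≡⟨ cong₂ (λ x y → x + z e * z f * i * y) (symmetric f<m e<m) c*i ⟩
          K X e f + z e * z f * i * 1#
            ≡⟨ trans (cong (K X e f +_) (*-identityʳ _)) (sym (X′≡ e<m f<m)) ⟩
          K X′ e f ∎

        con′ : ∀ {j} → j ℕ.< suc k → ∀ {f} → f ℕ.< m → form w (D (δ j)) (λ h → K X′ h f) ≡ D (δ j) f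
        con′ {j} (ℕ.s≤s j≤k) {f} f<m with ℕ.m≤n⇒m<n∨m≡n j≤k
        ... | inj₁ j<k = trans (form-col (D (δ j)) f<m) (trans
          (cong₂ (λ x y → x + z f * i * y) (contains j<k f<m) (trans (form-comm w _ z) (z·contained j<k)))
          (solve 2 (λ x y → x :+ y :* 𝟘 := x) refl (D (δ j) f) (z f * i)))
        ... | inj₂ refl = trans (form-col g f<m) (trans
          (cong (λ y → form w g (λ h → K X h f) + y) (trans (cong (z f * i *_) (trans (form-comm w g z) z·g))
            (trans (solve 3 (λ z i c → z :* i :* c := z :* (c :* i)) refl (z f) i c) (cong (z f *_) c*i))))
          (solve 2 (λ p x → p :+ (x :- p) :* 𝟙 := x) refl (form w g (λ h → K X h f)) (g f)))

        tr : Φ (K X′) ≤ fromℕ (suc k)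
        tr = subst (_≤ fromℕ (suc k)) (sym (begin
            Φ (K X′)
              ≡⟨ ∑-cong m (λ {e} e<m → trans (cong (w e *_) (X′≡ e<m e<m))
                   (solve 4 (λ w k zz i → w :* (k :+ zz :* i) := w :* k :+ i :* (w :* zz)) refl (w e) (K X e e) (z e * z e) i)) ⟩
            ∑< m (λ e → w e * K X e e + i * (w e * (z e * z e)))
              ≡⟨ trans (∑-+ m _ _) (cong (Φ (K X) +_) (∑-* m i _)) ⟩
            -- The new rank-one term is z zᵀ / c, and its trace is the squared norm of z divided by
            -- c, that is 1.
            Φ (K X) + i * c              ≡⟨ cong (Φ (K X) +_) (trans (*-comm i c) c*i) ⟩
            Φ (K X) + 1#                 ≡⟨ +-comm _ _ ⟩
            1# + Φ (K X)                 ∎))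
          (+-mono-≤ ≤-refl trace)

    -- By definiteness z vanishes on all edges, so g was fixed by the projection already. The trace
    -- does not grow here, which is why `trace` is an inequality.
    kept : c ≤ 0# → Projection (suc k) X
    kept c≤0 = record
      { symmetric = symmetric ; idempotent = idempotent ; contains = con′
      ; trace = ≤-trans trace (≤-by 0≤1 (+-comm 1# (fromℕ k))) }
      where
      z≡0 : ∀ {e} → e ℕ.< m → z e ≡ 0#
      z≡0 = definite posDef-w z∈W (antisym c≤0 (nonneg posDef-w z∈W))
      con′ : ∀ {j} → j ℕ.< suc k → ∀ {f} → f ℕ.< m → form w (D (δ j)) (λ h → K X h f) ≡ D (δ j) f
      con′ {j} (ℕ.s≤s j≤k) {f} f<m with ℕ.m≤n⇒m<n∨m≡n j≤k
      ... | inj₁ j<k  = contains j<k f<m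
      ... | inj₂ refl = begin
        form w g (λ h → K X h f)
          ≡⟨ solve 2 (λ p x → p := x :- (x :- p)) refl _ (g f) ⟩
        g f - z f     ≡⟨ cong (λ x → g f - x) (z≡0 f<m) ⟩
        g f - 0#      ≡⟨ solve 1 (λ x → x :- 𝟘 := x) refl (g f) ⟩
        g f           ∎

    opaque
      unfolding ortho# norm#

      norm≡ : norm# es y ≡ c
      norm≡ = ∑-cong m λ {e} e<m → cong (w e *_) (cong₂ _*_ (at-z e<m) (at-z e<m))
        where
        at-z : ∀ {e} → e ℕ.< m → at 0# y (src (edge# es e)) - at 0# y (tgt (edge# es e)) ≡ z e
        at-z e<m = trans (cong₂ _-_ (y-at (src<n e<m)) (y-at (tgt<n e<m))) (D-q e<m)

      K-extend : ∀ {e f} → e ℕ.< m → f ℕ.< m →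
        K (matrix# n λ i j → entry# X i j + at 0# y i * at 0# y j / norm# es y) e f ≡ K X e f + z e * z f * c ⁻¹
      K-extend {e} {f} e<m f<m = trans
        (matrix-cong (λ {i} {j} i<n j<n → cong₂ (λ p r → entry# X i j + p / r) (cong₂ _*_ (y-at i<n) (y-at j<n)) norm≡) e<m f<m)
        (trans (K-add X q (c ⁻¹) e<m f<m) (cong₂ (λ a b → K X e f + a * b * c ⁻¹) (D-q e<m) (D-q f<m)))

      ortho-projection : Projection (suc k) (ortho# n es k X)
      ortho-projection with norm# es y ≤? 0#
      ... | yes p = kept (subst (_≤ 0#) norm≡ p)
      ... | no ¬p = extended K-extend λ c≡0 → ¬p (≤-reflexive (trans norm≡ c≡0))

  opaque
    unfolding gram#

    gram-projection : Projection (ℕ.pred n) (gram# n es)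
    gram-projection = natfold-ind Projection (ℕ.pred n) zero-projection λ _ → ortho-projection

  δ-sym : ∀ i j → δ i j ≡ δ j i
  δ-sym zero    zero    = refl
  δ-sym zero    (suc j) = refl
  δ-sym (suc i) zero    = refl
  δ-sym (suc i) (suc j) = δ-sym i j

  -- The unit vectors other than the last one span W, since D annihilates constants.
  D-span : ∀ y {e} → e ℕ.< m → D y e ≡ ∑< (ℕ.pred n) (λ j → (y j - y (ℕ.pred n)) * D (δ j) e)
  D-span y {e} e<m = sym (begin
    ∑< N (λ j → a j * (δ j u - δ j v))
      ≡⟨ ∑-cong N (λ {j} _ → trans (cong₂ (λ p r → a j * (p - r)) (δ-sym j u) (δ-sym j v))
           (solve 3 (λ a p r → a :* (p :- r) := p :* a :+ :- 𝟙 :* (r :* a)) refl (a j) (δ u j) (δ v j))) ⟩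
    ∑< N (λ j → δ u j * a j + - 1# * (δ v j * a j))
      ≡⟨ trans (∑-+ N _ _) (cong (∑< N (λ j → δ u j * a j) +_) (∑-* N (- 1#) _)) ⟩
    ∑< N (λ j → δ u j * a j) + - 1# * ∑< N (λ j → δ v j * a j)
      ≡⟨ cong₂ (λ p r → p + - 1# * r) (pick (src<n e<m)) (pick (tgt<n e<m)) ⟩
    y u - y N + - 1# * (y v - y N)
      ≡⟨ solve 3 (λ u v n → u :- n :+ :- 𝟙 :* (v :- n) := u :- v) refl (y u) (y v) (y N) ⟩
    y u - y v ∎)
    where
    N u v : ℕ
    N = ℕ.pred n
    u = src (edge# es e)
    v = tgt (edge# es e)
    a : ℕ → Carrier
    a j = y j - y N
    pick : ∀ {i} → i ℕ.< n → ∑< N (λ j → δ i j * a j) ≡ a i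
    pick {i} i<n with ℕ.m≤n⇒m<n∨m≡n (ℕ.≤-pred (ℕ.≤-trans i<n (ℕ.≤-reflexive (sym (ℕ.suc-pred n {{ℕ.>-nonZero (ℕ.≤-<-trans ℕ.z≤n i<n)}})))))
    ... | inj₁ i<N  = ∑-δ N a i<N
    -- At the last vertex no term of the sum matches, and `a` is zero there by its normalisation.
    ... | inj₂ refl = trans (∑-δ≡0 N i a ℕ.≤-refl) (sym (-‿inverseʳ (y i)))

  -- The projection fixes the differences of n - 1 unit vectors, which span `W` by `D-span`. It is
  -- therefore the identity on `W`, and this is the reproducing property.
  gram-kernel : Kernel w (K (gram# n es))
  gram-kernel = record
    { section = λ {f} _ → K-section _ f
    ; symm    = symmetric
    ; repro   = λ { {h} (y , h≡) {f} f<m → re h y h≡ f<m } }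
    where
    open Projection gram-projection
    N = ℕ.pred n
    G : ℕ → ℕ → Carrier
    G f h = K (gram# n es) h f
    re : ∀ h y → (∀ {e} → e ℕ.< m → h e ≡ D y e) → ∀ {f} → f ℕ.< m → form w h (G f) ≡ h f
    re h y h≡ {f} f<m = begin
      form w h (G f)
        ≡⟨ trans (form-comm w h (G f)) (form-≗ w (G f) λ e<m → trans (h≡ e<m) (D-span y e<m)) ⟩
      form w (G f) (λ e → ∑< N (λ j → a j * D (δ j) e))
        ≡⟨ ∑-cong m (λ {e} _ → trans (cong (w e *_) (sym (∑-* N (G f e) _))) (sym (∑-* N (w e) _))) ⟩
      ∑< m (λ e → ∑< N (λ j → w e * (G f e * (a j * D (δ j) e))))
        ≡⟨ ∑-swap m N _ ⟩
      ∑< N (λ j → ∑< m (λ e → w e * (G f e * (a j * D (δ j) e))))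
        ≡⟨ ∑-cong N (λ {j} j<N → trans (∑-cong m λ {e} _ →
             solve 4 (λ w g a d → w :* (g :* (a :* d)) := a :* (w :* (d :* g))) refl (w e) (G f e) (a j) (D (δ j) e))
             (trans (∑-* m (a j) _) (cong (a j *_) (contains j<N f<m)))) ⟩
      ∑< N (λ j → a j * D (δ j) f)
        ≡⟨ trans (h≡ f<m) (D-span y f<m) ⟨
      h f ∎
      where
      a : ℕ → Carrier
      a j = y j - y N

  gram-trace : Φ (K (gram# n es)) ≤ fromℕ (ℕ.pred n)
  gram-trace = Projection.trace gram-projection

  module _ {u r : Carrier} (0<u : 0# < u) (r*u≡1 : r * u ≡ 1#) {X : Mat} where

    opaque
      unfolding scale#

      K-scaled : ∀ {e f} → e ℕ.< m → f ℕ.< m → K (scale# n r X) e f ≡ r * K X e f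
      K-scaled = K-scale r X

    scale-posDef : PosDef (λ e → u * w e)
    scale-posDef = posDef-≥ 0<u (λ {h} _ → ≤-reflexive (sym (trans
      (∑-cong m λ {e} _ → *-assoc u (w e) (h e * h e)) (∑-* m u _)))) posDef-w

    scale-Φ : Φ (K (scale# n r X)) ≡ r * Φ (K X)
    scale-Φ = trans (∑-cong m λ {e} e<m → trans (cong (w e *_) (K-scaled e<m e<m))
      (solve 3 (λ w r k → w :* (r :* k) := r :* (w :* k)) refl (w e) r (K X e e))) (∑-* m r _)

    scale-kernel : Kernel w (K X) → Kernel (λ e → u * w e) (K (scale# n r X))
    scale-kernel κ = record
      { section = λ {f} _ → K-section _ f
      ; symm    = λ e<m f<m → trans (K-scaled e<m f<m) (trans (cong (r *_) (symm κ e<m f<m)) (sym (K-scaled f<m e<m)))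
      ; repro   = λ {h} wh {f} f<m → trans (∑-cong m λ {e} e<m → trans (cong (λ x → u * w e * (h e * x)) (K-scaled e<m f<m))
          (solve 5 (λ u w h r k → u :* w :* (h :* (r :* k)) := r :* u :* (w :* (h :* k))) refl u (w e) (h e) r (K X e f)))
          (trans (∑-* m (r * u) _) (trans (cong₂ _*_ r*u≡1 (repro κ wh f<m)) (*-identityˡ (h f)))) }

-- The number of steps.

module StepCount (ℝ : Reals) where

  open Reals ℝ
  open OrderedField ℝ
  open Semantics ℝ
  open ListArrays

  fromℕ-cancel-≤ : ∀ {j k} → fromℕ j ≤ fromℕ k → j ℕ.≤ k
  fromℕ-cancel-≤ {j} {k} h = ℕ.≤-pred (fromℕ-cancel-< (≤-<-trans h (<-by 0<1 (+-comm 1# (fromℕ k)))))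

  -- `below` says that no unit was counted after D had been reached, and `enough` that the count
  -- either reached D or advanced in every round.
  record CeilInv (D : Carrier) (k : ℕ) (p : ℕ × Carrier) : Set where
    field
      image  : proj₂ p ≡ fromℕ (proj₁ p)
      below  : ∀ {i} → suc i ≡ proj₁ p → fromℕ i < D
      enough : D ≤ proj₂ p ⊎ proj₁ p ≡ k

  opaque
    unfolding ceil#

    ceil-inv : ∀ D k → CeilInv D k (ceil# D k)
    ceil-inv D k = natfold-ind (CeilInv D) k
        (record { image = refl ; below = λ () ; enough = inj₂ refl }) (λ {k} {p} _ → next {k} {p})
      where
      next : ∀ {k p} → CeilInv D k p → CeilInv D (suc k) (if does (D ≤? proj₂ p) then p else (suc (proj₁ p) , 1# + proj₂ p))
      next {k} {p} inv with D ≤? proj₂ p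
      ... | yes D≤ = record { image = CeilInv.image inv ; below = CeilInv.below inv ; enough = inj₁ D≤ }
      ... | no D≰  = record
        { image  = cong (1# +_) (CeilInv.image inv)
        ; below  = λ { refl → subst (_< D) (CeilInv.image inv) (≰⇒> D≰) }
        ; enough = grow (CeilInv.enough inv) }
        where
        grow : D ≤ proj₂ p ⊎ proj₁ p ≡ k → D ≤ 1# + proj₂ p ⊎ suc (proj₁ p) ≡ suc k
        grow (inj₁ D≤)  = contradiction D≤ D≰
        grow (inj₂ p≡k) = inj₂ (cong suc p≡k)

  module _ (es : List Edge) (D : Carrier) where

    private
      q : ℕ
      q = steps# es D

      inv : CeilInv D (length es) (ceil# D (length es))
      inv = ceil-inv D (length es)

    steps≤⌈⌉ : q ℕ.≤ ⌈ D ⌉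
    steps≤⌈⌉ = go q (λ eq → CeilInv.below inv eq)
      where
      go : ∀ j → (∀ {i} → suc i ≡ j → fromℕ i < D) → j ℕ.≤ ⌈ D ⌉
      go zero    _ = ℕ.z≤n
      go (suc i) h = fromℕ-cancel-< (<-≤-trans (h refl) (≤⌈⌉ D))

    steps≤D+1 : 0# ≤ D → fromℕ q ≤ D + 1#
    steps≤D+1 0≤D = go q (λ eq → CeilInv.below inv eq)
      where
      go : ∀ j → (∀ {i} → suc i ≡ j → fromℕ i < D) → fromℕ j ≤ D + 1#
      go zero    _ = 0≤+ 0≤D 0≤1
      go (suc i) h = subst (_≤ D + 1#) (+-comm _ _) (+-monoˡ-≤ 1# (proj₁ (h refl)))

    -- The only way to stop short of D would be the cap at the number of edges, which is excluded by
    -- the hypothesis.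
    D≤steps : D ≤ fromℕ (length es) → D ≤ fromℕ q
    D≤steps D≤m = go (CeilInv.enough inv)
      where
      go : D ≤ proj₂ (ceil# D (length es)) ⊎ q ≡ length es → D ≤ fromℕ q
      go (inj₁ D≤)  = subst (D ≤_) (CeilInv.image inv) D≤
      go (inj₂ q≡m) = subst (λ k → D ≤ fromℕ k) (sym q≡m) D≤m

-- The choice of constants.

module Constants (ℝ : Reals) where

  open Reals ℝ
  open OrderedField ℝ
  open Semantics ℝ

  inverse-unique : ∀ {x y} → x ≢ 0# → x * y ≡ 1# → x ⁻¹ ≡ y
  inverse-unique {x} {y} x≢0 xy≡1 = trans (sym (*-identityʳ _)) (trans (cong (x ⁻¹ *_) (sym xy≡1))
    (trans (sym (*-assoc _ _ _)) (trans (cong (_* y) (*-inverseˡ x x≢0)) (*-identityˡ y))))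

  √>1 : ∀ {d} → 1# < d → 1# < √ d
  √>1 {d} 1<d = ≰⇒> λ √d≤1 → <⇒≱ 1<d (subst₂ _≤_ (√-square 0≤d) (*-identityˡ 1#)
    (*-mono-≤ (√-nonneg 0≤d) 0≤1 √d≤1 √d≤1))
    where
    0≤d : 0# ≤ d
    0≤d = ≤-trans 0≤1 (proj₁ 1<d)

  module _ {s : Carrier} (1<s : 1# < s) where

    private
      a i p : Carrier
      a = growth# s
      i = s ⁻¹
      p = (s - 1#) ⁻¹

      0<s : 0# < s
      0<s = ≤-<-trans 0≤1 1<s
      0<s-1 : 0# < s - 1#
      0<s-1 = <⇒0<- 1<s
      si≡1 : s * i ≡ 1#
      si≡1 = *-inverseʳ s (>⇒≢ 0<s)
      p≡1 : (s - 1#) * p ≡ 1#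
      p≡1 = *-inverseʳ (s - 1#) (>⇒≢ 0<s-1)

      1-i≡ : 1# - i ≡ i * (s - 1#)
      1-i≡ = trans (cong (_- i) (sym si≡1)) (solve 2 (λ s i → s :* i :- i := i :* (s :- 𝟙)) refl s i)

    growth-pos : 0# < a
    growth-pos = *-pos (<-≤-trans 0<s (≤-by 0≤1 refl)) (⁻¹-pos 0<s-1)

    growth*[s-1] : a * (s - 1#) ≡ s + 1#
    growth*[s-1] = trans (solve 2 (λ s p → (s :+ 𝟙) :* p :* (s :- 𝟙) := (s :+ 𝟙) :* ((s :- 𝟙) :* p)) refl s p)
      (trans (cong ((s + 1#) *_) p≡1) (*-identityʳ _))

    s⁻¹<1 : s ⁻¹ < 1#
    s⁻¹<1 = <-by (subst (0# <_) (sym 1-i≡) (*-pos (⁻¹-pos 0<s) 0<s-1)) (solve 1 (λ i → 𝟙 := i :+ (𝟙 :- i)) refl i)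

    -- Holds with equality, since a (1 - 1/s) = 1 + 1/s; this equation determines `growth#`.
    budget : a ⁻¹ + (s * a) ⁻¹ ≤ 1# - s ⁻¹
    budget = ≤-reflexive (trans (cong (a ⁻¹ +_) [sa]⁻¹≡)
      (trans (solve 2 (λ x i → x :+ i :* x := x :* (𝟙 :+ i)) refl (a ⁻¹) i)
      (trans (cong (a ⁻¹ *_) (sym a[1-i]))
      (trans (sym (*-assoc _ _ _)) (trans (cong (_* (1# - i)) (*-inverseˡ a (>⇒≢ growth-pos))) (*-identityˡ _))))))
      where
      a[1-i] : a * (1# - i) ≡ 1# + i
      a[1-i] = trans (cong (a *_) 1-i≡) (trans
        (solve 3 (λ a i s → a :* (i :* (s :- 𝟙)) := a :* (s :- 𝟙) :* i) refl a i s)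
        (trans (cong (_* i) growth*[s-1]) (trans (solve 2 (λ s i → (s :+ 𝟙) :* i := s :* i :+ i) refl s i) (cong (_+ i) si≡1))))
      [sa]⁻¹≡ : (s * a) ⁻¹ ≡ i * a ⁻¹
      [sa]⁻¹≡ = inverse-unique (>⇒≢ (*-pos 0<s growth-pos)) (trans
        (solve 4 (λ s a i j → s :* a :* (i :* j) := s :* i :* (a :* j)) refl s a i (a ⁻¹))
        (trans (cong₂ _*_ si≡1 (*-inverseʳ a (>⇒≢ growth-pos))) (*-identityˡ 1#)))

    -- With u = N s a + q a and l = q - N s, the condition u/l ≤ ((s+1)/(s-1))² amounts to N s² ≤ q.
    ratio : ∀ {N q d} → s * s ≡ d → d * N ≤ q →
            (N * (s * a) + q * a) * (d + 1# - fromℕ 2 * s) ≤ (d + 1# + fromℕ 2 * s) * (q - N * s)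
    ratio {N} {q} refl dN≤q = ≤-by
      -- The two sides differ by 2 (s + 1) (q - s² N). In the solver 2 is spelled as `fromℕ 2`
      -- unfolds, 1 + (1 + 0).
      (*-nonneg (0≤+ 0≤1 0≤1) (*-nonneg (0≤+ (proj₁ 0<s) 0≤1) (≤⇒0≤- dN≤q)))
      (sym (trans (cong (_+ (1# + 1#) * ((s + 1#) * (q - s * s * N)))
          (trans (solve 4 (λ N s a q → (N :* (s :* a) :+ q :* a) :* (s :* s :+ 𝟙 :- (𝟙 :+ (𝟙 :+ 𝟘)) :* s)
              := (N :* s :+ q) :* (s :- 𝟙) :* (a :* (s :- 𝟙))) refl N s a q)
            (cong ((N * s + q) * (s - 1#) *_) growth*[s-1])))
        (solve 3 (λ N s q → (N :* s :+ q) :* (s :- 𝟙) :* (s :+ 𝟙) :+ (𝟙 :+ 𝟙) :* ((s :+ 𝟙) :* (q :- s :* s :* N))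
          := (s :* s :+ 𝟙 :+ (𝟙 :+ (𝟙 :+ 𝟘)) :* s) :* (q :- N :* s)) refl N s q)))

    denominator-pos : ∀ {d} → s * s ≡ d → 0# < d + 1# - fromℕ 2 * s
    denominator-pos refl = subst (0# <_)
      (solve 1 (λ s → (s :- 𝟙) :* (s :- 𝟙) := s :* s :+ 𝟙 :- (𝟙 :+ (𝟙 :+ 𝟘)) :* s) refl s) (*-pos 0<s-1 0<s-1)

    -- For the case in which G is returned; numerator and denominator differ by 4 s.
    1≤κ : ∀ {d} → s * s ≡ d → 1# ≤ (d + 1# + fromℕ 2 * s) / (d + 1# - fromℕ 2 * s)
    1≤κ {d} s²≡d = subst (_≤ (d + 1# + fromℕ 2 * s) / (d + 1# - fromℕ 2 * s)) (*-inverseʳ _ (>⇒≢ (denominator-pos s²≡d)))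
      (*-monoʳ-≤ (proj₁ (⁻¹-pos (denominator-pos s²≡d)))
        (≤-by (*-nonneg (fromℕ-nonneg 4) (proj₁ 0<s))
          (solve 2 (λ d s → d :+ 𝟙 :+ (𝟙 :+ (𝟙 :+ 𝟘)) :* s
            := d :+ 𝟙 :- (𝟙 :+ (𝟙 :+ 𝟘)) :* s :+ (𝟙 :+ (𝟙 :+ (𝟙 :+ (𝟙 :+ 𝟘)))) :* s) refl d s)))

  cross : ∀ {u l A B} → 0# < l → 0# < B → u * B ≤ A * l → u / l ≤ A / B
  cross {u} {l} {A} {B} 0<l 0<B h = *-cancelˡ-≤ (*-pos 0<l 0<B) (subst₂ _≤_
    (sym (trans (solve 4 (λ l B u i → l :* B :* (u :* i) := u :* B :* (l :* i)) refl l B u (l ⁻¹))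
      (trans (cong (u * B *_) (*-inverseʳ l (>⇒≢ 0<l))) (*-identityʳ _))))
    (sym (trans (solve 4 (λ l B A j → l :* B :* (A :* j) := A :* l :* (B :* j)) refl l B A (B ⁻¹))
      (trans (cong (A * l *_) (*-inverseʳ B (>⇒≢ 0<B))) (*-identityʳ _)))) h)

-- Simple graphs have at most n² edges.

module Pigeonhole where

  lookup-injective : ∀ {A : Set} {xs : List A} → Unique xs → ∀ i j → lookup xs i ≡ lookup xs j → i ≡ j
  lookup-injective (x≢ ∷ u) Fin.zero    Fin.zero    eq = refl
  lookup-injective {xs = x ∷ xs} (x≢ ∷ u) Fin.zero (Fin.suc j) eq =
    contradiction eq (All.lookup x≢ (∈-lookup j))
  lookup-injective {xs = x ∷ xs} (x≢ ∷ u) (Fin.suc i) Fin.zero eq =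
    contradiction (sym eq) (All.lookup x≢ (∈-lookup i))
  lookup-injective (x≢ ∷ u) (Fin.suc i) (Fin.suc j) eq = cong Fin.suc (lookup-injective u i j eq)

  unique-length : ∀ {n} {xs : List (Fin n × Fin n)} → Unique xs → length xs ℕ.≤ n ℕ.* n
  unique-length {n} {xs} u = Fin.injective⇒≤ {f = code} λ {i} {j} eq →
      lookup-injective u i j (decode (Fin.combine-injective _ _ _ _ eq))
    where
    code : Fin (length xs) → Fin (n ℕ.* n)
    code i = Fin.combine (proj₁ (lookup xs i)) (proj₂ (lookup xs i))
    decode : ∀ {p q : Fin n × Fin n} → proj₁ p ≡ proj₁ q × proj₂ p ≡ proj₂ q → p ≡ q
    decode (refl , refl) = refl

-- Reading the subgraph off the weights.

module Selection (ℝ : Reals) where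

  open Reals ℝ
  open OrderedField ℝ
  open Summation ℝ
  open Semantics ℝ
  open ListArrays
  open Support ℝ

  private
    variable
      A B : Set

  relabel : (A → B) → A × Carrier → B × Carrier
  relabel f (a , c) = f a , c

  -- Naturality in the labels: the program picks among pairs of naturals, the subgraph is built by
  -- picking among pairs of `Fin n`, and the former encodes the latter.
  pick-map : ∀ (f : A → B) l s es → pick# l s (map (relabel f) es) ≡ map (relabel f) (pick# l s es)
  pick-map f l s []       = refl
  pick-map f l s (e ∷ es) rewrite length-map (relabel f) es with at 0# s (length es) ≤? 0#
  ... | yes _ = pick-map f l s es
  ... | no  _ = cong (_ ∷_) (pick-map f l s es)

  pick-⊆ : ∀ l s (es : List (A × Carrier)) → map proj₁ (pick# l s es) ⊆ map proj₁ es
  pick-⊆ l s (e ∷ es) x∈ with at 0# s (length es) ≤? 0#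
  pick-⊆ l s (e ∷ es) x∈          | yes _ = there (pick-⊆ l s es x∈)
  pick-⊆ l s (e ∷ es) (here refl) | no  _ = here refl
  pick-⊆ l s (e ∷ es) (there x∈)  | no  _ = there (pick-⊆ l s es x∈)

  All-⊆ : ∀ {P : A → Set} {xs ys} → xs ⊆ ys → All P ys → All P xs
  All-⊆ xs⊆ys ps = All.tabulate λ x∈ → All.lookup ps (xs⊆ys x∈)

  pick-unique : ∀ l s (es : List (A × Carrier)) → Unique (map proj₁ es) → Unique (map proj₁ (pick# l s es))
  pick-unique l s []       u        = []
  pick-unique l s (e ∷ es) (e≢ ∷ u) with at 0# s (length es) ≤? 0#
  ... | yes _ = pick-unique l s es u
  ... | no  _ = All-⊆ (pick-⊆ l s es) e≢ ∷ pick-unique l s es u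

  pick-positive : ∀ {l} s (es : List (A × Carrier)) → 0# < l → All (λ e → 0# < proj₂ e) (pick# l s es)
  pick-positive s []       0<l = []
  pick-positive s (e ∷ es) 0<l with at 0# s (length es) ≤? 0#
  ... | yes _ = pick-positive s es 0<l
  ... | no ¬p = *-pos (≰⇒> ¬p) (⁻¹-pos 0<l) ∷ pick-positive s es 0<l

  pick-length : ∀ l s (es : List (A × Carrier)) → length (pick# l s es) ≡ support (length es) (at 0# s)
  pick-length l s []       = refl
  pick-length l s (e ∷ es) with at 0# s (length es) ≤? 0#
  ... | yes _ = pick-length l s es
  ... | no  _ = cong suc (pick-length l s es)

  total-weight : (A → Carrier) → List (A × Carrier) → Carrier
  total-weight φ []             = 0#
  total-weight φ ((a , c) ∷ es) = c * φ a + total-weight φ es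

  total-∑ : ∀ (φ : A → Carrier) d es →
            total-weight φ es ≡ ∑< (length es) (λ k → proj₂ (at d es k) * φ (proj₁ (at d es k)))
  total-∑ φ d []             = refl
  total-∑ φ d ((a , c) ∷ es) = cong₂ _+_
    (cong (λ e → proj₂ e * φ (proj₁ e)) (sym (at-here d (a , c) es refl)))
    (trans (total-∑ φ d es) (∑-cong (length es) λ k< →
      cong (λ e → proj₂ e * φ (proj₁ e)) (sym (at-there d (a , c) es k<))))

  -- A dropped edge has weight at most 0 and, by hypothesis, at least 0, so dropping it does not
  -- change the sum.
  pick-total : ∀ l s (φ : A → Carrier) d es → (∀ {k} → k ℕ.< length es → 0# ≤ at 0# s k) →
               total-weight φ (pick# l s es) ≡ l ⁻¹ * ∑< (length es) (λ k → at 0# s k * φ (proj₁ (at d es k)))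
  pick-total l s φ d []             0≤s = sym (zeroʳ _)
  pick-total {A} l s φ d ((a , c) ∷ es) 0≤s = trans (branch (at 0# s (length es) ≤? 0#))
      (trans (sym (distribˡ (l ⁻¹) _ _)) (cong (l ⁻¹ *_) (cong₂ _+_
        (cong (λ e → at 0# s (length es) * φ (proj₁ e)) (sym (at-here d (a , c) es refl)))
        (∑-cong (length es) λ {k} k< → cong (λ e → at 0# s k * φ (proj₁ e)) (sym (at-there d (a , c) es k<))))))
    where
    sₑ : Carrier
    sₑ = at 0# s (length es)
    rest : total-weight φ (pick# l s es) ≡ l ⁻¹ * ∑< (length es) (λ k → at 0# s k * φ (proj₁ (at d es k)))
    rest = pick-total l s φ d es λ k< → 0≤s (ℕ.m<n⇒m<1+n k<)
    branch : ∀ dec → total-weight φ (if does dec then pick# l s es else (a , sₑ / l) ∷ pick# l s es)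
             ≡ l ⁻¹ * (sₑ * φ a) + l ⁻¹ * ∑< (length es) (λ k → at 0# s k * φ (proj₁ (at d es k)))
    branch (yes s≤0) = trans (sym (+-identityˡ (total-weight φ (pick# l s es)))) (cong₂ _+_ (sym
      (trans (cong (λ x → l ⁻¹ * (x * φ a)) (antisym s≤0 (0≤s ℕ.≤-refl)))
        (solve 2 (λ i x → i :* (𝟘 :* x) := 𝟘) refl (l ⁻¹) (φ a)))) rest)
    branch (no _) = cong₂ _+_ (solve 3 (λ s i x → s :* i :* x := i :* (s :* x)) refl sₑ (l ⁻¹) (φ a)) rest

-- The invariant along a run.

module Runs (ℝ : Reals) (n : ℕ) (es : List (Semantics.Edge ℝ)) (valid : All (Matrices.Valid ℝ n) es) where

  open Reals ℝ
  open OrderedField ℝ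
  open Semantics ℝ
  open ListArrays
  open Support ℝ
  open Constants ℝ
  open EdgeKernels ℝ n es valid
  open GramSchmidt ℝ n es valid

  N : Carrier
  N = fromℕ n - 1#

  module _ (0<m : 0 ℕ.< m) where

    1<n : 1 ℕ.< n
    1<n = ℕ.≤-trans (ℕ.s≤s (ℕ.≤-trans (ℕ.s≤s ℕ.z≤n) (proj₁ (valid-edge 0<m)))) (tgt<n 0<m)

    N≡ : N ≡ fromℕ (ℕ.pred n)
    N≡ = go n (ℕ.<⇒≤ 1<n)
      where
      go : ∀ k → 0 ℕ.< k → fromℕ k - 1# ≡ fromℕ (ℕ.pred k)
      go (suc k) _ = solve 1 (λ x → 𝟙 :+ x :- 𝟙 := x) refl (fromℕ k)

    N-pos : 0# < N
    N-pos = subst (0# <_) (sym N≡) (go n 1<n)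
      where
      go : ∀ k → 1 ℕ.< k → 0# < fromℕ (ℕ.pred k)
      go (suc (suc k)) _ = fromℕ-pos k
      go (suc zero) (ℕ.s≤s ())

    module _ {s : Carrier} (1<s : 1# < s) where

      private
        a : Carrier
        a = growth# s
        0<s : 0# < s
        0<s = ≤-<-trans 0≤1 1<s
        0<sa : 0# < s * a
        0<sa = *-pos 0<s (growth-pos 1<s)

        zeros : List Carrier
        zeros = tabulate (λ _ → 0#) m

        zeros≡ : ∀ {e} → e ℕ.< m → at 0# zeros e ≡ 0#
        zeros≡ = at-tabulate 0# (λ _ → 0#) m

        1/*≡1 : ∀ {x} → 0# < x → 1# / x * x ≡ 1#
        1/*≡1 {x} 0<x = trans (cong (_* x) (*-identityˡ _)) (*-inverseˡ x (>⇒≢ 0<x))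

        -- The trace of the projection is at most N, and scaling by 1/(N x) brings this down to 1/x.
        -- Hence the factor N in both initial barriers.
        Φ-scaled : ∀ {x} → 0# < x → Φ (K (scale# n (1# / (N * x)) (gram# n es))) ≤ x ⁻¹
        Φ-scaled {x} 0<x = subst (_≤ x ⁻¹) (sym (scale-Φ {u = N * x} {r} Nx-pos (1/*≡1 Nx-pos)))
          (subst (r * Φ (K (gram# n es)) ≤_) (sym (inverse-unique (>⇒≢ 0<x)
              (trans (solve 3 (λ x r N → x :* (r :* N) := r :* (N :* x)) refl x r N) (1/*≡1 Nx-pos))))
            (*-monoˡ-≤ (proj₁ (subst (0# <_) (sym (*-identityˡ _)) (⁻¹-pos Nx-pos)))
              (subst (Φ (K (gram# n es)) ≤_) (sym N≡) gram-trace)))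
          where
          r : Carrier
          r = 1# / (N * x)
          Nx-pos : 0# < N * x
          Nx-pos = *-pos N-pos 0<x

        -- After k steps u = N s a + k a and l = k - N s, while the bounds 1/(s a) and 1/s on the
        -- potentials stay fixed.
        P : ℕ → State → Set
        P k st = Invariant ((s * a) ⁻¹) (s ⁻¹) (N * (s * a) + fromℕ k * a) (fromℕ k - N * s) st
                 × support m (at 0# (proj₂ (proj₂ st))) ℕ.≤ k

        start : P 0 (scale# n (1# / (N * (s * a))) (gram# n es) , scale# n (1# / (N * s)) (gram# n es) , zeros)
        start = record
          { upper    = kernel-cong up (scale-kernel u-pos (1/*≡1 u-pos) gram-kernel)
          ; upper-pd = posDef-mono (λ e<m → ≤-reflexive (up e<m)) (scale-posDef u-pos (1/*≡1 u-pos) {gram# n es})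
          ; upper-Φ  = Φ-scaled 0<sa
          ; lower    = kernel-cong low (scale-kernel l-pos (1/*≡1 l-pos) gram-kernel)
          ; lower-pd = posDef-mono (λ e<m → ≤-reflexive (low e<m)) (scale-posDef l-pos (1/*≡1 l-pos) {gram# n es})
          ; lower-Φ  = Φ-scaled 0<s
          ; s-nonneg = λ e<m → ≤-reflexive (sym (zeros≡ e<m))
          } , ℕ.≤-reflexive (support-zero m zeros≡)
          where
          u-pos : 0# < N * (s * a)
          u-pos = *-pos N-pos 0<sa
          l-pos : 0# < N * s
          l-pos = *-pos N-pos 0<s
          up : ∀ {e} → e ℕ.< m → N * (s * a) * w e ≡ (N * (s * a) + 0# * a) * w e - at 0# zeros e
          up {e} e<m = trans (solve 3 (λ x a w → x :* w := (x :+ 𝟘 :* a) :* w :- 𝟘) refl (N * (s * a)) a (w e))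
            (cong (λ z → (N * (s * a) + 0# * a) * w e - z) (sym (zeros≡ e<m)))
          low : ∀ {e} → e ℕ.< m → N * s * w e ≡ at 0# zeros e - (0# - N * s) * w e
          low {e} e<m = trans (solve 2 (λ x w → x :* w := 𝟘 :- (𝟘 :- x) :* w) refl (N * s) (w e))
            (cong (λ z → z - (0# - N * s) * w e) (sym (zeros≡ e<m)))

        step : ∀ {k st} → P k st → P (suc k) (step# n es a st)
        step {k} {st} (inv , sup) =
          subst₂ (λ u l → Invariant ((s * a) ⁻¹) (s ⁻¹) u l (step# n es a st))
            (solve 3 (λ x k a → x :+ k :* a :+ a := x :+ (𝟙 :+ k) :* a) refl (N * (s * a)) (fromℕ k) a)
            (solve 2 (λ k x → k :- x :+ 𝟙 := 𝟙 :+ k :- x) refl (fromℕ k) (N * s))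
            (step-invariant 0<m (growth-pos 1<s) (s⁻¹<1 1<s) (budget 1<s) inv) ,
          ℕ.≤-trans (step-support a _ _ _) (ℕ.s≤s sup)

      opaque
        unfolding run#

        run-invariant : ∀ q → P q (run# n es N s a q)
        run-invariant q = natfold-ind P q start λ _ → step

-- Correctness and running time on a graph.

module Sparsification (ℝ : Reals) (n : ℕ) (G : Graphs.WeightedGraph ℝ n) (1≤m : 1 ℕ.≤ Graphs.#edges ℝ G) where

  open Reals ℝ
  open Graphs ℝ
  open Running ℝ
  open OrderedField ℝ
  open Summation ℝ
  open Semantics ℝ
  open ListArrays
  open Support ℝ
  open Constants ℝ
  open StepCount ℝ
  open Selection ℝ
  open Matrices ℝ using (Valid)

  vertices : Fin n × Fin n → ℕ × ℕ
  vertices (u , v) = toℕ u , toℕ v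

  es : List Edge
  es = map (relabel vertices) (wedges G)

  length-es : length es ≡ #edges G
  length-es = trans (length-map _ (wedges G)) (sym (length-map proj₁ (wedges G)))

  valid : All (Valid n) es
  valid = All.map⁺ (All.zipWith (λ {e} (u<v , 0<w) → u<v , Fin.toℕ<n (proj₂ (proj₁ e)) , 0<w)
    (All.map⁻ (ordered G) , positive G))

  open EdgeKernels ℝ n es valid
  open Runs ℝ n es valid

  0<m : 0 ℕ.< m
  0<m = subst (1 ℕ.≤_) (sym length-es) 1≤m

  extend : (Fin n → Carrier) → ℕ → Carrier
  extend x i with i ℕ.<? n
  ... | yes i<n = x (fromℕ< i<n)
  ... | no  _   = 0#

  extend-toℕ : ∀ x u → extend x (toℕ u) ≡ x u
  extend-toℕ x u with toℕ u ℕ.<? n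
  ... | yes u<n = cong x (Fin.fromℕ<-toℕ u u<n)
  ... | no  u≮n = contradiction (Fin.toℕ<n u) u≮n

  edge-energy : (ℕ → Carrier) → ℕ × ℕ → Carrier
  edge-energy y p = (y (proj₁ p) - y (proj₂ p)) * (y (proj₁ p) - y (proj₂ p))

  energy-encode : ∀ x (ws : List ((Fin n × Fin n) × Carrier)) →
    ∑ᴱ ws (λ u v w → w * ((x u - x v) * (x u - x v)))
    ≡ total-weight (edge-energy (extend x)) (map (relabel vertices) ws)
  energy-encode x []                   = refl
  energy-encode x (((u , v) , w) ∷ ws) = cong₂ _+_
    (cong (w *_) (cong₂ _*_ diff diff)) (energy-encode x ws)
    where
    diff : x u - x v ≡ extend x (toℕ u) - extend x (toℕ v)
    diff = sym (cong₂ _-_ (extend-toℕ x u) (extend-toℕ x v))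

  energyG : ∀ x → quadForm (laplacian G) x ≡ form w (D (extend x)) (D (extend x))
  energyG x = trans (laplacian-form G x) (trans (energy-encode x (wedges G))
    (total-∑ (edge-energy (extend x)) ((0 , 0) , 0#) es))

  energyG-nonneg : ∀ x → 0# ≤ quadForm (laplacian G) x
  energyG-nonneg x = subst (0# ≤_) (sym (energyG x))
    (∑-nonneg m λ {e} e<m → *-nonneg (proj₁ (w-pos e<m)) (square-nonneg (D (extend x) e)))

  -- Stated for a variable program A, so that type checking never unfolds the program.
  output-val : ∀ A {d x} → Val A (d ∷ n ∷ es ∷ []) x → output A d G ≡ x
  output-val A (val eq) = eq

  time-cost : ∀ A {d B k} → Costs.Cost ℝ B A (d ∷ n ∷ es ∷ []) k → time A d G ℕ.≤ k ℕ.* B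
  time-cost A (Costs.cost p) = p

  module _ {d : Carrier} (1<d : 1# < d) where

    private
      s a b κ : Carrier
      s = √ d
      a = growth# s
      b = d * N
      κ = (d + 1# + fromℕ 2 * √ d) / (d + 1# - fromℕ 2 * √ d)

      0<d : 0# < d
      0<d = ≤-<-trans 0≤1 1<d
      s²≡d : s * s ≡ d
      s²≡d = √-square (proj₁ 0<d)
      1<s : 1# < s
      1<s = √>1 1<d
      0<N : 0# < N
      0<N = N-pos 0<m

      q : ℕ
      q = steps# es b
      l : Carrier
      l = fromℕ q - N * s
      weights : List Carrier
      weights = proj₂ (proj₂ (run# n es N s a q))

    -- Indexed by the output list, so that the whole conclusion can be transported along `output≡`.
    Sparsifier : List Edge → Set
    Sparsifier out = Σ[ H ∈ WeightedGraph n ]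
      (out ≡ encode H × IsSubgraph H G × #edges H ℕ.≤ ⌈ b ⌉
       × (∀ x → quadForm (laplacian G) x ≤ quadForm (laplacian H) x
                × quadForm (laplacian H) x ≤ κ * quadForm (laplacian G) x))

    trivial-sparsifier : fromℕ (length es) ≤ b → Sparsifier es
    trivial-sparsifier m≤b = G , refl , (λ e∈ → e∈) ,
      subst (ℕ._≤ ⌈ b ⌉) length-es (fromℕ-cancel-≤ (≤-trans m≤b (≤⌈⌉ b))) ,
      λ x → ≤-refl , subst (_≤ κ * quadForm (laplacian G) x) (*-identityˡ _)
        (*-monoʳ-≤ (energyG-nonneg x) (1≤κ 1<s s²≡d))

    search-sparsifier : b < fromℕ (length es) → Sparsifier (search# n es d N b)
    search-sparsifier b<m = H , pick-map vertices l weights (wedges G) , pick-⊆ l weights (wedges G) , count , bounds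
      where
      inv = proj₁ (run-invariant 0<m 1<s q)
      open Invariant inv using (upper-pd; lower-pd; s-nonneg)

      b≤q : b ≤ fromℕ q
      b≤q = D≤steps es b (proj₁ b<m)

      -- b = s² N and s > 1. This makes the final l positive, so that dividing by it is legitimate.
      Ns<b : N * s < b
      Ns<b = <-by (*-pos (*-pos 0<N (≤-<-trans 0≤1 1<s)) (<⇒0<- 1<s)) (trans (cong (_* N) (sym s²≡d))
        (solve 2 (λ s N → s :* s :* N := N :* s :+ N :* s :* (s :- 𝟙)) refl s N))

      l-pos : 0# < l
      l-pos = <⇒0<- (<-≤-trans Ns<b b≤q)

      H : WeightedGraph n
      H = record
        { wedges   = pick# l weights (wedges G)
        ; ordered  = All-⊆ (pick-⊆ l weights (wedges G)) (ordered G)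
        ; simple   = pick-unique l weights (wedges G) (simple G)
        ; positive = pick-positive weights (wedges G) l-pos
        }

      count : #edges H ℕ.≤ ⌈ b ⌉
      count = ℕ.≤-trans (ℕ.≤-reflexive (trans (length-map proj₁ (wedges H)) (trans (pick-length l weights (wedges G))
          (cong (λ k → support k (at 0# weights)) (sym (length-map (relabel vertices) (wedges G)))))))
        (ℕ.≤-trans (proj₂ (run-invariant 0<m 1<s q)) (steps≤⌈⌉ es b))

      module _ (x : Fin n → Carrier) where

        h : ℕ → Carrier
        h = D (extend x)

        h∈W : W h
        h∈W = extend x , λ _ → refl

        E S u : Carrier
        E = form w h h
        S = form (at 0# weights) h h
        u = N * (s * a) + fromℕ q * a

        energyH : quadForm (laplacian H) x ≡ l ⁻¹ * S
        energyH = trans (laplacian-form H x) (trans (energy-encode x (wedges H))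
          (trans (cong (total-weight (edge-energy (extend x))) (sym (pick-map vertices l weights (wedges G))))
            (pick-total l weights (edge-energy (extend x)) ((0 , 0) , 0#) es s-nonneg)))

        scaled : ∀ c → form (λ e → c * w e) h h ≡ c * E
        scaled c = trans (∑-cong m λ {e} _ → *-assoc c (w e) (h e * h e)) (∑-* m c _)

        S≤uE : S ≤ u * E
        S≤uE = ≤-by (nonneg upper-pd h∈W) (sym (trans
          (cong (S +_) (trans (form-shift {v = at 0# weights} (- 1#)
              (λ {e} _ → solve 2 (λ x y → x :- y := x :+ :- 𝟙 :* y) refl (u * w e) (at 0# weights e)) h h)
            (cong (_+ - 1# * S) (scaled u))))
          (solve 2 (λ s x → s :+ (x :+ :- 𝟙 :* s) := x) refl S (u * E))))

        lE≤S : l * E ≤ S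
        lE≤S = ≤-by (nonneg lower-pd h∈W) (sym (trans
          (cong (l * E +_) (form-shift {v = w} (- l)
              (λ {e} _ → solve 3 (λ s l w → s :- l :* w := s :+ :- l :* w) refl (at 0# weights e) l (w e)) h h))
          (solve 3 (λ s l x → l :* x :+ (s :+ :- l :* x) := s) refl S l E)))

        bounds : quadForm (laplacian G) x ≤ quadForm (laplacian H) x
                 × quadForm (laplacian H) x ≤ κ * quadForm (laplacian G) x
        bounds = subst₂ _≤_ (sym (energyG x)) (sym energyH) E≤ , subst₂ _≤_ (sym energyH) (cong (κ *_) (sym (energyG x))) ≤κE
          where
          0≤l⁻¹ : 0# ≤ l ⁻¹
          0≤l⁻¹ = proj₁ (⁻¹-pos l-pos)
          E≤ : E ≤ l ⁻¹ * S
          E≤ = subst (_≤ l ⁻¹ * S) (trans (sym (*-assoc _ _ _)) (trans (cong (_* E) (*-inverseˡ l (>⇒≢ l-pos))) (*-identityˡ E)))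
            (*-monoˡ-≤ 0≤l⁻¹ lE≤S)
          ≤κE : l ⁻¹ * S ≤ κ * E
          ≤κE = ≤-trans (*-monoˡ-≤ 0≤l⁻¹ S≤uE) (subst (_≤ κ * E)
            (solve 3 (λ u i e → u :* i :* e := i :* (u :* e)) refl u (l ⁻¹) E)
            (*-monoʳ-≤ (subst (0# ≤_) (energyG x) (energyG-nonneg x))
              (cross l-pos (denominator-pos 1<s s²≡d) (ratio 1<s s²≡d b≤q))))

    sparsifier : Sparsifier (sparsify# d n es)
    sparsifier = cases (fromℕ (length es) ≤? b)
      where
      cases : (dec : Dec (fromℕ (length es) ≤ b)) → Sparsifier (if does dec then es else search# n es d N b)
      cases (yes m≤b) = trivial-sparsifier m≤b
      cases (no m≰b)  = search-sparsifier (≰⇒> m≰b)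

    output≡ : output Program.sparsify d G ≡ sparsify# d n es
    output≡ = output-val Program.sparsify val-sparsify

    module _ (k : ℕ) where

      private
        ν : Carrier
        ν = fromℕ n

        -- From q ≤ d (n - 1) + 1 the slack is (d - 1) n + (d - 1), nonnegative because d > 1. This
        -- is the factor 2 in the final constant.
        n+q≤ : ν + fromℕ q ≤ fromℕ 2 * (d * ν)
        n+q≤ = ≤-trans (+-mono-≤ ≤-refl (steps≤D+1 es b (*-nonneg (proj₁ 0<d) (proj₁ 0<N))))
          (≤-by (0≤+ (*-nonneg (≤⇒0≤- (proj₁ 1<d)) (fromℕ-nonneg n)) (≤⇒0≤- (proj₁ 1<d)))
            (solve 2 (λ d ν → (𝟙 :+ (𝟙 :+ 𝟘)) :* (d :* ν) := ν :+ (d :* (ν :- 𝟙) :+ 𝟙) :+ ((d :- 𝟙) :* ν :+ (d :- 𝟙))) refl d ν))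

        lhs≡ : fromℕ (k ℕ.* ((n ℕ.+ q) ℕ.* (m ℕ.* (n ℕ.* n)))) ≡ fromℕ k * ((ν + fromℕ q) * (fromℕ m * (ν * ν)))
        lhs≡ = trans (fromℕ-* k _) (cong (fromℕ k *_) (trans (fromℕ-* (n ℕ.+ q) _)
          (cong₂ _*_ (fromℕ-+ n q) (trans (fromℕ-* m _) (cong (fromℕ m *_) (fromℕ-* n n))))))

        n³≡ : fromℕ (n ℕ.^ 3) ≡ ν * (ν * ν)
        n³≡ = trans (fromℕ-* n _) (cong (ν *_) (trans (fromℕ-* n _) (cong (λ k → ν * fromℕ k) (ℕ.*-identityʳ n))))

        rhs≡ : fromℕ k * (fromℕ 2 * (d * ν) * (fromℕ m * (ν * ν))) ≡ fromℕ (k ℕ.* 2) * (d * fromℕ (n ℕ.^ 3) * fromℕ (#edges G))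
        rhs≡ = trans (solve 5 (λ c t d ν μ → c :* (t :* (d :* ν) :* (μ :* (ν :* ν))) := c :* t :* (d :* (ν :* (ν :* ν)) :* μ)) refl
            (fromℕ k) (fromℕ 2) d ν (fromℕ m))
          (cong₂ _*_ (sym (fromℕ-* k 2)) (cong₂ (λ x y → d * x * fromℕ y) (sym n³≡) length-es))

      steps-bound : ∀ {t} → t ℕ.≤ k ℕ.* ((n ℕ.+ q) ℕ.* (m ℕ.* (n ℕ.* n))) →
                    fromℕ t ≤ fromℕ (k ℕ.* 2) * (d * fromℕ (n ℕ.^ 3) * fromℕ (#edges G))
      steps-bound t≤ = ≤-trans (fromℕ-mono t≤) (subst₂ _≤_ (sym lhs≡) rhs≡ (*-monoˡ-≤ (fromℕ-nonneg k)
          (*-monoʳ-≤ (*-nonneg (fromℕ-nonneg m) (*-nonneg (fromℕ-nonneg n) (fromℕ-nonneg n))) n+q≤)))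

    m≤n² : m ℕ.≤ n ℕ.* n
    m≤n² = subst (ℕ._≤ n ℕ.* n) (sym length-es) (Pigeonhole.unique-length (simple G))

    time-bound : fromℕ (time Program.sparsify d G) ≤ fromℕ (142 ℕ.* 2) * (d * fromℕ (n ℕ.^ 3) * fromℕ (#edges G))
    time-bound = steps-bound 142 (time-cost Program.sparsify (Costs.c-sparsify ℝ (ℕ.<⇒≤ (1<n 0<m)) 0<m m≤n² d))

mainTheorem2 : Σ[ A ∈ Algorithm ] Σ[ C ∈ ℕ ]
    ((ℝ : Reals) → let open Reals ℝ in let open Graphs ℝ in let open Running ℝ in
    (d : Carrier) → 1# < d →
    (n : ℕ) (G : WeightedGraph n) → 1 ℕ.≤ #edges G →
    fromℕ (time A d G) ≤ fromℕ C * (d * fromℕ (n ℕ.^ 3) * fromℕ (#edges G))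
    × Σ[ H ∈ WeightedGraph n ]
    (output A d G ≡ encode H
    × IsSubgraph H G
    × #edges H ℕ.≤ ⌈ d * (fromℕ n - 1#) ⌉
    × (∀ (x : Fin n → Carrier) →
    quadForm (laplacian G) x ≤ quadForm (laplacian H) x
    × quadForm (laplacian H) x
    ≤ (d + 1# + fromℕ 2 * √ d) / (d + 1# - fromℕ 2 * √ d)
    * quadForm (laplacian G) x)))
mainTheorem2 = Program.sparsify , 142 ℕ.* 2 , λ ℝ d 1<d n G 1≤m →
  let open Sparsification ℝ n G 1≤m in
  time-bound 1<d , subst (Sparsifier 1<d) (sym (output≡ 1<d)) (sparsifier 1<d)
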